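{- The polynomials $Q_n(x,q)$ satisfy, for $n\geq 0$, $$Q_{n+1}(x,q)=(q+2nx)Q_n(x,q)+2x(1-x)\frac{\partial}{\partial x}Q_n(x,q),$$ with $Q_0(x,q)=1$. Moreover, $$Q(x,q;z):=1+\sum_{n\geq1}Q_n(x,q)\frac{z^n}{n!}=\left(\sqrt{\frac{x-1}{x-e^{2z(x-1)}}}\right)^q.$$
   Context: Let $[n]_2=\{1,1,\ldots,n,n\}$. A Stirling permutation of order $k$ is a permutation of $[k]_2$ such that for each $i$ every entry between the two occurrences of $i$ is greater than $i$; $\mathcal{Q}_k$ denotes their set. For a word $\omega$, ${\rm red}(\omega)$ replaces each occurrence of the $i$th smallest distinct value by $i$. A Stirling permutation of the second kind of order $n$ is a permutation $\sigma$ of $[n]_2$ written as a nonempty disjoint union of cycles in standard cycle form such that: (i) the two copies of each $i\in[n]$ lie in the same cycle; (ii) each cycle is written with one of its smallest entries first and cycles are in increasing order of smallest entries; (iii) for each cycle $(c_1,\ldots,c_{2k})$, ${\rm red}(c_1\cdots c_{2k})\in\mathcal{Q}_k$. $\mathcal{Q}_n^2$ is the set of these. For a cycle $(c_1,\ldots,c_{2k})$ with $k\ge2$, an entry $c_i$ with $2\le i\le 2k-1$ is a cycle ascent plateau if $c_{i-1}<c_i=c_{i+1}$. ${\rm cap}(\sigma)$ is the total number of cycle ascent plateaus of $\sigma$ and ${\rm cyc}(\sigma)$ its number of cycles. $Q_n(x,q)=\sum_{\sigma\in\mathcal{Q}_n^2}x^{{\rm cap}(\sigma)}q^{{\rm cyc}(\sigma)}$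 for $n\ge1$, and $Q_0(x,q)=1$. -}

module Defs where

open import Data.Bool using (Bool; true; false; _∧_; _∨_; not; if_then_else_)
open import Data.Nat as ℕ using (ℕ; zero; suc; _≤ᵇ_; _<ᵇ_; _≡ᵇ_; _!; _∸_)
open import Data.Nat.Properties using (_≟_; _!≢0)
open import Data.List using (List; []; _∷_; length; map; concat; concatMap; filterᵇ;
  deduplicate; upTo; foldr; dropWhileᵇ; takeWhileᵇ; drop; _++_)
open import Data.Bool.ListAction using (all; any)
open import Data.Integer as ℤ using (ℤ)
open import Data.Rational as ℚ using (ℚ)

doubled : ℕ → List ℕ
doubled n = concatMap (λ i → suc i ∷ suc i ∷ []) (upTo n)

occ : ℕ → List ℕ → ℕ
occ v w = length (filterᵇ (λ u → u ≡ᵇ v) w)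

isPermDoubled : ℕ → List ℕ → Bool
isPermDoubled k w = (length w ≡ᵇ (k ℕ.+ k)) ∧ all (λ i → occ (suc i) w ≡ᵇ 2) (upTo k)

betweenGreater : ℕ → List ℕ → Bool
betweenGreater i w =
  all (λ u → i <ᵇ u) (takeWhileᵇ (λ u → not (u ≡ᵇ i)) (drop 1 (dropWhileᵇ (λ u → not (u ≡ᵇ i)) w)))

isStirling : ℕ → List ℕ → Bool
isStirling k w = isPermDoubled k w ∧ all (λ i → betweenGreater (suc i) w) (upTo k)

red : List ℕ → List ℕ
red w = map (λ v → length (filterᵇ (λ u → u ≤ᵇ v) (deduplicate _≟_ w))) w

-- a permutation in standard cycle form: list of cycles, each cycle written as a word
Cycles : Set
Cycles = List (List ℕ)

-- half of a natural number (length of a cycle (c_1..c_2k) is 2k)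
half : ℕ → ℕ
half zero = zero
half (suc zero) = zero
half (suc (suc n)) = suc (half n)

headIsMin : List ℕ → Bool
headIsMin [] = false
headIsMin (c ∷ cs) = all (λ u → c ≤ᵇ u) cs

headsIncreasing : Cycles → Bool
headsIncreasing ((a ∷ _) ∷ rest@((b ∷ _) ∷ _)) = (a <ᵇ b) ∧ headsIncreasing rest
headsIncreasing (_ ∷ ([] ∷ _)) = false
headsIncreasing ([] ∷ _) = false
headsIncreasing (_ ∷ []) = true
headsIncreasing [] = true

nonEmpty : {A : Set} → List A → Bool
nonEmpty [] = false
nonEmpty (_ ∷ _) = true

isStirling2 : ℕ → Cycles → Bool
isStirling2 n σ =
  nonEmpty σ
  ∧ isPermDoubled n (concat σ)
  ∧ all (λ i → any (λ c → occ (suc i) c ≡ᵇ 2) σ) (upTo n)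
  ∧ all headIsMin σ
  ∧ headsIncreasing σ
  ∧ all (λ c → isStirling (half (length c)) (red c)) σ

capCycle : List ℕ → ℕ
capCycle (a ∷ b ∷ d ∷ rest) =
  (if (a <ᵇ b) ∧ (b ≡ᵇ d) then 1 else 0) ℕ.+ capCycle (b ∷ d ∷ rest)
capCycle _ = 0

cap : Cycles → ℕ
cap σ = foldr ℕ._+_ 0 (map capCycle σ)

cyc : Cycles → ℕ
cyc = length

words : ℕ → ℕ → List (List ℕ)
words n zero = [] ∷ []
words n (suc m) = concatMap (λ i → map (suc i ∷_) (words n m)) (upTo n)

splits : List ℕ → List Cycles
splits [] = []
splits (a ∷ []) = ((a ∷ []) ∷ []) ∷ []
splits (a ∷ b ∷ w) =
  map (λ σ → (a ∷ []) ∷ σ) (splits (b ∷ w))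
  ++ map (λ { [] → [] ; (c ∷ σ) → (a ∷ c) ∷ σ }) (splits (b ∷ w))

-- every list of nonempty cycles whose concatenation is a word of length 2n over [n]
-- appears exactly once here; hence every σ ∈ 𝒬²_n (n ≥ 1) appears exactly once
candidates : ℕ → List Cycles
candidates n = concatMap splits (words n (n ℕ.+ n))

-- Polynomials in x, q over ℤ : coefficient functions (i ↦ exponent of x, j ↦ exponent of q)

Poly : Set
Poly = ℕ → ℕ → ℤ

sumℤ : ℕ → (ℕ → ℤ) → ℤ
sumℤ zero f = f 0
sumℤ (suc n) f = sumℤ n f ℤ.+ f (suc n)

_+P_ : Poly → Poly → Poly
(p +P r) i j = p i j ℤ.+ r i j

_*P_ : Poly → Poly → Poly
(p *P r) i j = sumℤ i (λ a → sumℤ j (λ b → p a b ℤ.* r (i ∸ a) (j ∸ b)))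

constP : ℤ → Poly
constP c zero zero = c
constP c _ _ = ℤ.0ℤ

xP : Poly
xP (suc zero) zero = ℤ.1ℤ
xP _ _ = ℤ.0ℤ

qP : Poly
qP zero (suc zero) = ℤ.1ℤ
qP _ _ = ℤ.0ℤ

dxP : Poly → Poly
dxP p i j = ℤ.+ (suc i) ℤ.* p (suc i) j

-- Q_n(x,q) = Σ_{σ ∈ 𝒬²_n} x^{cap σ} q^{cyc σ},  Q_0 = 1
Qcount : ℕ → ℕ → ℕ → ℕ
Qcount n i j = length (filterᵇ (λ σ → isStirling2 n σ ∧ (cap σ ≡ᵇ i) ∧ (cyc σ ≡ᵇ j)) (candidates n))

Q : ℕ → Poly
Q zero = constP ℤ.1ℤ
Q (suc n) i j = ℤ.+ (Qcount (suc n) i j)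

-- Formal power series in x, q, z over ℚ : coefficient functions (x-exp, q-exp, z-exp)

PS : Set
PS = ℕ → ℕ → ℕ → ℚ

sumℚ : ℕ → (ℕ → ℚ) → ℚ
sumℚ zero f = f 0
sumℚ (suc n) f = sumℚ n f ℚ.+ f (suc n)

_+S_ : PS → PS → PS
(f +S g) a b c = f a b c ℚ.+ g a b c

_-S_ : PS → PS → PS
(f -S g) a b c = f a b c ℚ.- g a b c

_*S_ : PS → PS → PS
(f *S g) a b c =
  sumℚ a (λ i → sumℚ b (λ j → sumℚ c (λ k → f i j k ℚ.* g (a ∸ i) (b ∸ j) (c ∸ k))))

constS : ℚ → PS
constS r zero zero zero = r
constS r _ _ _ = ℚ.0ℚ

oneS : PS
oneS = constS ℚ.1ℚ

scaleS : ℚ → PS → PS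
scaleS r f a b c = r ℚ.* f a b c

xS qS zS : PS
xS (suc zero) zero zero = ℚ.1ℚ
xS _ _ _ = ℚ.0ℚ
qS zero (suc zero) zero = ℚ.1ℚ
qS _ _ _ = ℚ.0ℚ
zS zero zero (suc zero) = ℚ.1ℚ
zS _ _ _ = ℚ.0ℚ

powS : PS → ℕ → PS
powS f zero = oneS
powS f (suc k) = f *S powS f k

-- Σ_{k≥0} r_k f^k for f with zero constant term: the coefficient of total degree d
-- only receives contributions from k ≤ d
seriesS : (ℕ → ℚ) → PS → PS
seriesS r f a b c = sumℚ (a ℕ.+ b ℕ.+ c) (λ k → r k ℚ.* powS f k a b c)

invFact : ℕ → ℚ
invFact k = ℤ.+ 1 ℚ./ (k !) where instance _ = k !≢0

-- exp f = Σ f^k / k!   (f with zero constant term)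
expS : PS → PS
expS = seriesS invFact

-- log (1 + f) = Σ_{k≥1} (-1)^{k+1} f^k / k   (f with zero constant term)
log1pS : PS → PS
log1pS = seriesS r
  where
  r : ℕ → ℚ
  r zero = ℚ.0ℚ
  r (suc k) = sgn k ℚ.* (ℤ.+ 1 ℚ./ suc k)
    where
    sgn : ℕ → ℚ
    sgn zero = ℚ.1ℚ
    sgn (suc m) = ℚ.- sgn m

-- total reciprocal on ℚ (1/r for r ≠ 0; only used at nonzero arguments)
recipQ : ℚ → ℚ
recipQ p@(ℚ.mkℚ (ℤ.+ suc n) _ _) = ℚ.1/ p
recipQ p@(ℚ.mkℚ ℤ.-[1+ n ] _ _) = ℚ.1/ p
recipQ _ = ℚ.0ℚ

-- 1/g for g with nonzero constant term g₀:  1/g = g₀⁻¹ Σ_{k≥0} (1 - g/g₀)^k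
invS : PS → PS
invS g = scaleS c (seriesS (λ _ → ℚ.1ℚ) (oneS -S scaleS c g))
  where
  c : ℚ
  c = recipQ (g 0 0 0)

egfQ : PS
egfQ a b zero = constS ℚ.1ℚ a b zero
egfQ a b (suc n) = (Q (suc n) a b ℚ./ 1) ℚ.* invFact (suc n)

-- ( sqrt( (x-1)/(x - e^{2z(x-1)}) ) )^q
--   := exp( q · ½ · log( (x-1)/(x - e^{2z(x-1)}) ) ),
-- where the base has constant term 1 and sqrt is the square root with constant term 1
closedForm : PS
closedForm = expS (qS *S scaleS (ℤ.+ 1 ℚ./ 2) (log1pS (G -S oneS)))
  where
  xm1 : PS
  xm1 = xS -S oneS
  G : PS
  G = xm1 *S invS (xS -S expS (scaleS (ℤ.+ 2 ℚ./ 1) (zS *S xm1)))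

{-# OPTIONS --safe #-}

-- Recurrence. In a Stirling permutation of the second kind of order n + 1 no letter can stand between the two
-- copies of n + 1, so these are adjacent, and deleting them leaves one, σ, of order n. Conversely they may form a new
-- last cycle of σ, or be inserted after any of the 2n letters of σ. Every such insertion creates a plateau; it
-- destroys one exactly when it takes place next to the first upper letter of a plateau, which happens for
-- 2 cap(σ) of the 2n positions.
--
-- Closed form. In ℚ[[x, q, z]] let δ = z ((1 − 2xz) ∂/∂z − 2x(1 − x) ∂/∂x), a derivation. By the recurrence the
-- generating function E satisfies δ E = z q E. So does F = exp (q/2 · log G), because δ (log G) = 2z.
-- Both series are 1 at z = 0, and the equation determines a series from its value at z = 0.

module Submission where

open import Defs
open import Algebra.Bundles using (CommutativeRing)
open import Data.Bool using (Bool; true; false; T; T?; _∧_; not; if_then_else_)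
open import Data.Bool.ListAction using (all; any)
open import Data.Empty using (⊥; ⊥-elim)
open import Data.Integer as ℤ using (ℤ; 0ℤ; -1ℤ; +_)
import Data.Integer.Properties as ℤₚ
open import Data.Integer.Solver using () renaming (module +-*-Solver to ℤ-Solver)
open import Data.List using (List; []; _∷_; _++_; length; map; concat; concatMap; filterᵇ; takeWhileᵇ; upTo; deduplicate)
open import Data.List.Membership.Propositional using (_∈_; _∉_; find)
import Data.List.Membership.Propositional.Properties as ∈ₚ
open import Data.List.Membership.Propositional.Properties.WithK using (unique∧set⇒bag)
import Data.List.Properties as Listₚ
open import Data.List.Relation.Binary.BagAndSetEquality using (∼bag⇒↭)
open import Data.List.Relation.Binary.Permutation.Propositional using (_↭_)
import Data.List.Relation.Binary.Permutation.Propositional.Properties as ↭ₚ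
open import Data.List.Relation.Unary.All as All using (All; []; _∷_)
import Data.List.Relation.Unary.All.Properties as Allₚ
open import Data.List.Relation.Unary.AllPairs using ([]; _∷_)
open import Data.List.Relation.Unary.Any as Any using (here; there)
open import Data.List.Relation.Unary.Unique.DecPropositional.Properties using (deduplicate-!)
open import Data.List.Relation.Unary.Unique.Propositional using (Unique)
import Data.List.Relation.Unary.Unique.Propositional.Properties as Uniqueₚ
open import Data.Nat as ℕ using (ℕ; zero; suc; z≤n; s≤s; _∸_; _!; _≡ᵇ_; _<ᵇ_; _≤ᵇ_; NonZero)
open import Data.Nat.ListAction using (sum)
open import Data.Nat.ListAction.Properties using (sum-++; sum-↭)
import Data.Nat.Properties as ℕₚ
open import Data.Nat.Solver using (module +-*-Solver)
open import Data.Product using (_×_; _,_; proj₁; proj₂; ∃-syntax)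
open import Data.Rational as ℚ using (ℚ; 0ℚ; 1ℚ; fromℚᵘ)
import Data.Rational.Properties as ℚₚ
import Data.Rational.Unnormalised as ℚᵘ
import Data.Rational.Unnormalised.Properties as ℚᵘₚ
open import Data.Sum using (_⊎_; inj₁; inj₂)
open import Data.Unit using (⊤; tt)
open import Function using (_∘_; mk⇔)
open import Level using (_⊔_; 0ℓ)
open import Relation.Binary.Definitions using (tri<; tri≈; tri>)
open import Relation.Binary.PropositionalEquality as ≡ using (_≡_; _≢_)
open import Relation.Nullary using (yes; no)

-- Formal power series

-- The factor z in δ turns partial derivatives into Euler operators, which multiply each coefficient
-- by an exponent. So δ never lowers a degree and respects truncation at every total degree, and
-- what concerns exp, log and reciprocals can be proved on partial sums. Truncation is forced: in
-- the statement these series are given coefficient by coefficient, by sums cut off at the total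
-- degree, without a ring structure. They are therefore matched with a ring obtained by iterating
-- one-variable power series, while the differential calculus takes place in an abstract ring with a
-- derivation. Cancelling x - 1 is legitimate there, since its constant term -1 makes it a unit. On
-- the combinatorial side, the definition tests reduced words, and reduction renumbers the letters
-- of each cycle separately. It is replaced by conditions on the original letters, which can be
-- followed through the insertion of n + 1. The counting stays in ℕ: the negative term of the
-- recurrence is kept on the other side until the last step.

record Derivation {c ℓ} (R : CommutativeRing c ℓ) : Set (c ⊔ ℓ) where
  open CommutativeRing R
  field
    δ      : Carrier → Carrier
    δ-cong : ∀ {x y} → x ≈ y → δ x ≈ δ y
    δ-+    : ∀ x y → δ (x + y) ≈ δ x + δ y
    δ-*    : ∀ x y → δ (x * y) ≈ δ x * y + x * δ y

module Derivations {c ℓ} (R : CommutativeRing c ℓ) where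
  open CommutativeRing R
  open import Algebra.Properties.Ring ring
  open import Relation.Binary.Reasoning.Setoid setoid
  open import Algebra.Solver.Ring.NaturalCoefficients.Default commutativeSemiring

  module _ (D : Derivation R) where
    open Derivation D

    δ-0 : δ 0# ≈ 0#
    δ-0 = +-cancelˡ (δ 0#) _ _ (begin
      δ 0# + δ 0# ≈⟨ δ-+ 0# 0# ⟨
      δ (0# + 0#) ≈⟨ δ-cong (+-identityʳ 0#) ⟩
      δ 0#        ≈⟨ +-identityʳ _ ⟨
      δ 0# + 0#   ∎)

    δ-1 : δ 1# ≈ 0#
    δ-1 = +-cancelˡ (δ 1#) _ _ (begin
      δ 1# + δ 1#           ≈⟨ solve 1 (λ d → d :+ d := d :* con 1 :+ con 1 :* d) refl (δ 1#) ⟩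
      δ 1# * 1# + 1# * δ 1# ≈⟨ δ-* 1# 1# ⟨
      δ (1# * 1#)           ≈⟨ δ-cong (*-identityʳ 1#) ⟩
      δ 1#                  ≈⟨ +-identityʳ _ ⟨
      δ 1# + 0#             ∎)

    δ-neg : ∀ x → δ (- x) ≈ - δ x
    δ-neg x = +-cancelˡ (δ x) _ _ (begin
      δ x + δ (- x) ≈⟨ δ-+ x (- x) ⟨
      δ (x + - x)   ≈⟨ δ-cong (-‿inverseʳ x) ⟩
      δ 0#          ≈⟨ δ-0 ⟩
      0#            ≈⟨ -‿inverseʳ (δ x) ⟨
      δ x + - δ x   ∎)

  scaled : Carrier → Derivation R → Derivation R
  scaled a D = record
    { δ      = λ x → a * δ x
    ; δ-cong = λ e → *-congˡ (δ-cong e)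
    ; δ-+    = λ x y → trans (*-congˡ (δ-+ x y)) (distribˡ a _ _)
    ; δ-*    = λ x y → trans (*-congˡ (δ-* x y))
        (solve 5 (λ a dx x dy y → a :* (dx :* y :+ x :* dy) := (a :* dx) :* y :+ x :* (a :* dy))
          refl a (δ x) x (δ y) y)
    }
    where open Derivation D

  _⊞_ : Derivation R → Derivation R → Derivation R
  D ⊞ E = record
    { δ      = λ x → D.δ x + E.δ x
    ; δ-cong = λ e → +-cong (D.δ-cong e) (E.δ-cong e)
    ; δ-+    = λ x y → trans (+-cong (D.δ-+ x y) (E.δ-+ x y))
        (solve 4 (λ a b c d → (a :+ b) :+ (c :+ d) := (a :+ c) :+ (b :+ d)) refl _ _ _ _)
    ; δ-*    = λ x y → trans (+-cong (D.δ-* x y) (E.δ-* x y))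
        (solve 6 (λ a b c d x y → (a :* y :+ x :* b) :+ (c :* y :+ x :* d) := (a :+ c) :* y :+ x :* (b :+ d))
          refl (D.δ x) (D.δ y) (E.δ x) (E.δ y) x y)
    }
    where module D = Derivation D
          module E = Derivation E

-- Coefficients come from an arbitrary commutative ring so that the construction can be iterated:
-- three times over ℚ for x, q, z, and twice over ℤ for x, q.
module PowerSeries {c ℓ} (R : CommutativeRing c ℓ) where
  open CommutativeRing R
  open import Algebra.Properties.Ring ring
  open import Algebra.Definitions.RawMonoid +-rawMonoid using () renaming (_×_ to _·_)
  open import Algebra.Properties.Monoid.Mult +-monoid using (×-congʳ; ×-homo-+; ×-congˡ)
  open import Algebra.Properties.CommutativeMonoid.Mult +-commutativeMonoid using (×-distrib-+)
  open import Algebra.Properties.Semiring.Mult semiring using (×-assoc-*; ×-comm-*)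
  open import Relation.Binary.Reasoning.Setoid setoid
  open import Algebra.Solver.Ring.NaturalCoefficients.Default commutativeSemiring

  Series : Set c
  Series = ℕ → Carrier

  infix 4 _≋_
  _≋_ : Series → Series → Set ℓ
  f ≋ g = ∀ n → f n ≈ g n

  ∑ : ℕ → Series → Carrier
  ∑ zero    f = f 0
  ∑ (suc n) f = ∑ n f + f (suc n)

  -- The bound `k ≤ n` is passed on because the index `n ∸ k` of a convolution can be rewritten only
  -- where the subtraction is not truncated.
  sum-cong : ∀ n {f g} → (∀ k → k ℕ.≤ n → f k ≈ g k) → ∑ n f ≈ ∑ n g
  sum-cong zero    e = e 0 z≤n
  sum-cong (suc n) e = +-cong (sum-cong n (λ k k≤n → e k (ℕₚ.m≤n⇒m≤1+n k≤n))) (e (suc n) ℕₚ.≤-refl)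

  sum-head : ∀ n f → ∑ (suc n) f ≈ f 0 + ∑ n (λ k → f (suc k))
  sum-head zero    f = refl
  sum-head (suc n) f = trans (+-congʳ (sum-head n f)) (+-assoc _ _ _)

  sum-+ : ∀ n f g → ∑ n (λ k → f k + g k) ≈ ∑ n f + ∑ n g
  sum-+ zero    f g = refl
  sum-+ (suc n) f g = trans (+-congʳ (sum-+ n f g))
    (solve 4 (λ a b c d → (a :+ b) :+ (c :+ d) := (a :+ c) :+ (b :+ d)) refl _ _ _ _)

  sum-0 : ∀ n → ∑ n (λ _ → 0#) ≈ 0#
  sum-0 zero    = refl
  sum-0 (suc n) = trans (+-identityʳ _) (sum-0 n)

  infixl 7 _⊛_
  _⊛_ : Series → Series → Series
  (f ⊛ g) n = ∑ n (λ k → f k * g (n ∸ k))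

  tail : Series → Series
  tail f n = f (suc n)

  -- Splitting off the constant term of the left factor here, and of the right factor in `⊛-suc′`,
  -- replaces the reindexing of double sums: commutativity and associativity become inductions on
  -- the degree with `tail f` in place of `f`.
  ⊛-suc : ∀ f g n → (f ⊛ g) (suc n) ≈ f 0 * g (suc n) + (tail f ⊛ g) n
  ⊛-suc f g n = sum-head n _

  ⊛-suc′ : ∀ f g n → (f ⊛ g) (suc n) ≈ (f ⊛ tail g) n + f (suc n) * g 0
  ⊛-suc′ f g n = +-cong
    (sum-cong n (λ k k≤n → *-congˡ (reflexive (≡.cong g (ℕₚ.+-∸-assoc 1 k≤n)))))
    (*-congˡ (reflexive (≡.cong g (ℕₚ.n∸n≡0 n))))

  ⊛-cong : ∀ {f f′ g g′} → f ≋ f′ → g ≋ g′ → f ⊛ g ≋ f′ ⊛ g′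
  ⊛-cong e e′ n = sum-cong n (λ k _ → *-cong (e k) (e′ (n ∸ k)))

  ⊛-comm : ∀ f g → f ⊛ g ≋ g ⊛ f
  ⊛-comm f g zero    = *-comm _ _
  ⊛-comm f g (suc n) = begin
    (f ⊛ g) (suc n)                   ≈⟨ ⊛-suc f g n ⟩
    f 0 * g (suc n) + (tail f ⊛ g) n  ≈⟨ +-cong (*-comm _ _) (⊛-comm (tail f) g n) ⟩
    g (suc n) * f 0 + (g ⊛ tail f) n  ≈⟨ +-comm _ _ ⟩
    (g ⊛ tail f) n + g (suc n) * f 0  ≈⟨ ⊛-suc′ g f n ⟨
    (g ⊛ f) (suc n)                   ∎

  ⊛-distribˡ : ∀ f g h → f ⊛ (λ n → g n + h n) ≋ (λ n → (f ⊛ g) n + (f ⊛ h) n)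
  ⊛-distribˡ f g h n = trans (sum-cong n (λ k _ → distribˡ (f k) _ _)) (sum-+ n _ _)

  ⊛-distribʳ : ∀ f g h → (λ n → g n + h n) ⊛ f ≋ (λ n → (g ⊛ f) n + (h ⊛ f) n)
  ⊛-distribʳ f g h n = trans (sum-cong n (λ k _ → distribʳ _ (g k) _)) (sum-+ n _ _)

  ⊛-scaleˡ : ∀ a f g → (λ n → a * f n) ⊛ g ≋ (λ n → a * (f ⊛ g) n)
  ⊛-scaleˡ a f g zero    = *-assoc _ _ _
  ⊛-scaleˡ a f g (suc n) = begin
    ((λ m → a * f m) ⊛ g) (suc n)                        ≈⟨ ⊛-suc (λ m → a * f m) g n ⟩
    a * f 0 * g (suc n) + ((λ m → a * tail f m) ⊛ g) n   ≈⟨ +-cong (*-assoc _ _ _) (⊛-scaleˡ a (tail f) g n) ⟩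
    a * (f 0 * g (suc n)) + a * (tail f ⊛ g) n           ≈⟨ distribˡ a _ _ ⟨
    a * (f 0 * g (suc n) + (tail f ⊛ g) n)               ≈⟨ *-congˡ (⊛-suc f g n) ⟨
    a * (f ⊛ g) (suc n)                                  ∎

  ⊛-assoc : ∀ f g h → (f ⊛ g) ⊛ h ≋ f ⊛ (g ⊛ h)
  ⊛-assoc f g h zero    = *-assoc _ _ _
  ⊛-assoc f g h (suc n) = begin
    ((f ⊛ g) ⊛ h) (suc n)
      ≈⟨ ⊛-suc (f ⊛ g) h n ⟩
    f 0 * g 0 * h (suc n) + (tail (f ⊛ g) ⊛ h) n
      ≈⟨ +-congˡ (⊛-cong {g = h} (⊛-suc f g) (λ _ → refl) n) ⟩
    f 0 * g 0 * h (suc n) + ((λ m → f 0 * tail g m + (tail f ⊛ g) m) ⊛ h) n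
      ≈⟨ +-congˡ (⊛-distribʳ h (λ m → f 0 * tail g m) (tail f ⊛ g) n) ⟩
    f 0 * g 0 * h (suc n) + (((λ m → f 0 * tail g m) ⊛ h) n + ((tail f ⊛ g) ⊛ h) n)
      ≈⟨ +-congˡ (+-cong (⊛-scaleˡ (f 0) (tail g) h n) (⊛-assoc (tail f) g h n)) ⟩
    f 0 * g 0 * h (suc n) + (f 0 * (tail g ⊛ h) n + (tail f ⊛ (g ⊛ h)) n)
      ≈⟨ solve 5 (λ a b c d e → a :* b :* c :+ (a :* d :+ e) := a :* (b :* c :+ d) :+ e) refl _ _ _ _ _ ⟩
    f 0 * (g 0 * h (suc n) + (tail g ⊛ h) n) + (tail f ⊛ (g ⊛ h)) n
      ≈⟨ +-congʳ (*-congˡ (⊛-suc g h n)) ⟨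
    f 0 * (g ⊛ h) (suc n) + (tail f ⊛ (g ⊛ h)) n
      ≈⟨ ⊛-suc f (g ⊛ h) n ⟨
    (f ⊛ (g ⊛ h)) (suc n)
      ∎

  C : Carrier → Series
  C a zero    = a
  C a (suc _) = 0#

  indet : Series
  indet zero          = 0#
  indet (suc zero)    = 1#
  indet (suc (suc _)) = 0#

  0⊛ : ∀ f → (λ _ → 0#) ⊛ f ≋ (λ _ → 0#)
  0⊛ f n = trans (sum-cong n (λ k _ → zeroˡ _)) (sum-0 n)

  C-⊛ : ∀ a f → C a ⊛ f ≋ (λ n → a * f n)
  C-⊛ a f zero    = refl
  C-⊛ a f (suc n) = trans (⊛-suc (C a) f n) (trans (+-congˡ (0⊛ f n)) (+-identityʳ _))

  indet-⊛-suc : ∀ f n → (indet ⊛ f) (suc n) ≈ f n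
  indet-⊛-suc f n = begin
    (indet ⊛ f) (suc n)                  ≈⟨ ⊛-suc indet f n ⟩
    0# * f (suc n) + (tail indet ⊛ f) n  ≈⟨ +-cong (zeroˡ _) (⊛-cong {g = f} tail-indet (λ _ → refl) n) ⟩
    0# + (C 1# ⊛ f) n                ≈⟨ +-identityˡ _ ⟩
    (C 1# ⊛ f) n                     ≈⟨ C-⊛ 1# f n ⟩
    1# * f n                         ≈⟨ *-identityˡ _ ⟩
    f n                              ∎
    where
    tail-indet : tail indet ≋ C 1#
    tail-indet zero    = refl
    tail-indet (suc _) = refl

  seriesRing : CommutativeRing c ℓ
  seriesRing = record
    { Carrier = Series
    ; _≈_ = _≋_
    ; _+_ = λ f g n → f n + g n
    ; _*_ = _⊛_
    ; -_  = λ f n → - f n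
    ; 0#  = λ _ → 0#
    ; 1#  = C 1#
    ; isCommutativeRing = record
      { isRing = record
        { +-isAbelianGroup = record
          { isGroup = record
            { isMonoid = record
              { isSemigroup = record
                { isMagma = record
                  { isEquivalence = record
                    { refl  = λ _ → refl
                    ; sym   = λ e n → sym (e n)
                    ; trans = λ e e′ n → trans (e n) (e′ n) }
                  ; ∙-cong = λ e e′ n → +-cong (e n) (e′ n) }
                ; assoc = λ f g h n → +-assoc _ _ _ }
              ; identity = (λ f n → +-identityˡ _) , (λ f n → +-identityʳ _) }
            ; inverse = (λ f n → -‿inverseˡ _) , (λ f n → -‿inverseʳ _)
            ; ⁻¹-cong = λ e n → -‿cong (e n) }
          ; comm = λ f g n → +-comm _ _ }
        ; *-cong = λ {f} {f′} {g} {g′} → ⊛-cong {f} {f′} {g} {g′}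
        ; *-assoc = ⊛-assoc
        ; *-identity = ⊛-identityˡ , (λ f n → trans (⊛-comm f (C 1#) n) (⊛-identityˡ f n))
        ; distrib = ⊛-distribˡ , ⊛-distribʳ }
      ; *-comm = ⊛-comm }
    }
    where
    ⊛-identityˡ : ∀ f → C 1# ⊛ f ≋ f
    ⊛-identityˡ f n = trans (C-⊛ 1# f n) (*-identityˡ _)

  -- The Euler operator t d/dt satisfies the Leibniz rule because k + (n ∸ k) = n inside the convolution.
  euler : Derivation seriesRing
  euler = record
    { δ      = λ f n → n · f n
    ; δ-cong = λ e n → ×-congʳ n (e n)
    ; δ-+    = λ f g n → ×-distrib-+ (f n) (g n) n
    ; δ-*    = λ f g n → begin
        n · (f ⊛ g) n                                                  ≈⟨ ·-sum n n _ ⟩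
        ∑ n (λ k → n · (f k * g (n ∸ k)))                            ≈⟨ sum-cong n (leibniz f g n) ⟩
        ∑ n (λ k → (k · f k) * g (n ∸ k) + f k * ((n ∸ k) · g (n ∸ k))) ≈⟨ sum-+ n _ _ ⟩
        ((λ m → m · f m) ⊛ g) n + (f ⊛ (λ m → m · g m)) n              ∎
    }
    where
    ·-sum : ∀ m n f → m · ∑ n f ≈ ∑ n (λ k → m · f k)
    ·-sum m zero    f = refl
    ·-sum m (suc n) f = trans (×-distrib-+ _ _ m) (+-congʳ (·-sum m n f))

    leibniz : ∀ f g n k → k ℕ.≤ n →
      n · (f k * g (n ∸ k)) ≈ (k · f k) * g (n ∸ k) + f k * ((n ∸ k) · g (n ∸ k))
    leibniz f g n k k≤n = begin
      n · p                                 ≈⟨ ×-congˡ (ℕₚ.m+[n∸m]≡n k≤n) ⟨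
      (k ℕ.+ (n ∸ k)) · p                   ≈⟨ ×-homo-+ p k (n ∸ k) ⟩
      k · p + (n ∸ k) · p                   ≈⟨ +-cong (×-assoc-* k _ _) (×-comm-* (n ∸ k) _ _) ⟨
      (k · f k) * g (n ∸ k) + f k * ((n ∸ k) · g (n ∸ k)) ∎
      where p = f k * g (n ∸ k)

  coefficientwise : Derivation R → Derivation seriesRing
  coefficientwise D = record
    { δ      = λ f n → δ (f n)
    ; δ-cong = λ e n → δ-cong (e n)
    ; δ-+    = λ f g n → δ-+ _ _
    ; δ-*    = λ f g n → begin
        δ ((f ⊛ g) n)                                       ≈⟨ δ-sum n _ ⟩
        ∑ n (λ k → δ (f k * g (n ∸ k)))                   ≈⟨ sum-cong n (λ k _ → δ-* _ _) ⟩
        ∑ n (λ k → δ (f k) * g (n ∸ k) + f k * δ (g (n ∸ k))) ≈⟨ sum-+ n _ _ ⟩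
        ((λ m → δ (f m)) ⊛ g) n + (f ⊛ (λ m → δ (g m))) n   ∎
    }
    where
    open Derivation D
    δ-sum : ∀ n f → δ (∑ n f) ≈ ∑ n (λ k → δ (f k))
    δ-sum zero    f = refl
    δ-sum (suc n) f = trans (δ-+ _ _) (+-congʳ (δ-sum n f))

-- Substitution into power series in one variable, and its derivative

natℚ : ℕ → ℚ
natℚ zero    = 0ℚ
natℚ (suc k) = 1ℚ ℚ.+ natℚ k

shift : (ℕ → ℚ) → ℕ → ℚ
shift r zero    = 0ℚ
shift r (suc k) = r k

unit : ℕ → ℚ
unit zero    = 1ℚ
unit (suc _) = 0ℚ

deriv : (ℕ → ℚ) → ℕ → ℚ
deriv r k = natℚ (suc k) ℚ.* r (suc k)

-- Kept apart from `SubstitutionRing`, whose fields mention partial sums, so that those fields can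
-- be established for the concrete ring beforehand.
module PartialSums (A : CommutativeRing 0ℓ 0ℓ) (K : ℚ → CommutativeRing.Carrier A) where
  open CommutativeRing A

  infixr 8 _^_
  _^_ : Carrier → ℕ → Carrier
  f ^ zero  = 1#
  f ^ suc k = f * f ^ k

  partialSum : (ℕ → ℚ) → Carrier → ℕ → Carrier
  partialSum r f zero    = K (r 0) * f ^ 0
  partialSum r f (suc M) = partialSum r f M + K (r (suc M)) * f ^ suc M

-- The relations _~[ M ]_ stand for agreement up to total degree M, and S r f for the series Σ r k f^k.
record SubstitutionRing : Set₁ where
  field
    A : CommutativeRing 0ℓ 0ℓ
    D : Derivation A
  open CommutativeRing A public
  open Derivation D public
  field
    K    : ℚ → Carrier
    K-+  : ∀ r s → K (r ℚ.+ s) ≈ K r + K s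
    K-*  : ∀ r s → K (r ℚ.* s) ≈ K r * K s
    K-0  : K 0ℚ ≈ 0#
    K-1  : K 1ℚ ≈ 1#
    δ-K  : ∀ r → δ (K r) ≈ 0#

  open PartialSums A K public
  field
    _~[_]_   : Carrier → ℕ → Carrier → Set
    ~-reflexive : ∀ {M x y} → x ≈ y → x ~[ M ] y
    ~-sym    : ∀ {M x y} → x ~[ M ] y → y ~[ M ] x
    ~-trans  : ∀ {M x y z} → x ~[ M ] y → y ~[ M ] z → x ~[ M ] z
    ~-+      : ∀ {M x y x′ y′} → x ~[ M ] y → x′ ~[ M ] y′ → (x + x′) ~[ M ] (y + y′)
    ~-*      : ∀ {M x y x′ y′} → x ~[ M ] y → x′ ~[ M ] y′ → (x * x′) ~[ M ] (y * y′)
    -- A derivation such as ∂/∂z would lose one degree here.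
    ~-δ      : ∀ {M x y} → x ~[ M ] y → δ x ~[ M ] δ y
    ~-separated : ∀ {x y} → (∀ M → x ~[ M ] y) → x ≈ y
    Small    : Carrier → Set
    S        : (ℕ → ℚ) → Carrier → Carrier
    -- The length `M′` is independent of the degree `M` because multiplication by `f` and
    -- differentiation change the length of a partial sum by one.
    S-trunc  : ∀ {f} r M M′ → Small f → M ℕ.≤ M′ → S r f ~[ M ] partialSum r f M′

module Substitution (𝒮 : SubstitutionRing) where
  open SubstitutionRing 𝒮
  open Derivations A using (δ-0; δ-1; δ-neg)
  open import Algebra.Properties.Ring ring
  open import Relation.Binary.Reasoning.Setoid setoid
  open import Algebra.Solver.Ring.NaturalCoefficients.Default commutativeSemiring

  partialSum-shift : ∀ r f M → f * partialSum r f M ≈ partialSum (shift r) f (suc M)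
  partialSum-shift r f zero = begin
    f * (K (r 0) * 1#)                  ≈⟨ solve 2 (λ f k → f :* (k :* con 1) := con 0 :* con 1 :+ k :*
        (f :* con 1)) refl f (K (r 0)) ⟩
    0# * 1# + K (r 0) * (f * 1#)        ≈⟨ +-congʳ (*-congʳ K-0) ⟨
    K 0ℚ * 1# + K (r 0) * (f * 1#)      ∎
  partialSum-shift r f (suc M) = begin
    f * (partialSum r f M + K (r (suc M)) * (f * f ^ M))
      ≈⟨ solve 4 (λ f p k g → f :* (p :+ k :* g) := f :* p :+ k :* (f :* g)) refl f _ _ _ ⟩
    f * partialSum r f M + K (r (suc M)) * (f * (f * f ^ M))
      ≈⟨ +-congʳ (partialSum-shift r f M) ⟩
    partialSum (shift r) f (suc M) + K (r (suc M)) * (f * (f * f ^ M))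
      ∎

  partialSum-+ : ∀ r s f M → partialSum (λ k → r k ℚ.+ s k) f M ≈ partialSum r f M + partialSum s f M
  partialSum-+ r s f zero    = trans (*-congʳ (K-+ _ _)) (distribʳ _ _ _)
  partialSum-+ r s f (suc M) = trans (+-cong (partialSum-+ r s f M) (*-congʳ (K-+ _ _)))
    (solve 5 (λ p q a b g → (p :+ q) :+ (a :+ b) :* g := (p :+ a :* g) :+ (q :+ b :* g)) refl _ _ _ _ _)

  partialSum-* : ∀ e r f M → partialSum (λ k → e ℚ.* r k) f M ≈ K e * partialSum r f M
  partialSum-* e r f zero    = trans (*-congʳ (K-* _ _)) (*-assoc _ _ _)
  partialSum-* e r f (suc M) = trans (+-cong (partialSum-* e r f M) (*-congʳ (K-* _ _)))
    (solve 4 (λ e p k g → e :* p :+ e :* k :* g := e :* (p :+ k :* g)) refl _ _ _ _)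

  partialSum-unit : ∀ f M → partialSum unit f M ≈ 1#
  partialSum-unit f zero    = trans (*-congʳ K-1) (*-identityʳ _)
  partialSum-unit f (suc M) = trans (+-cong (partialSum-unit f M) (trans (*-congʳ K-0) (zeroˡ _))) (+-identityʳ _)

  partialSum-cong : ∀ {r s} → (∀ k → r k ≡ s k) → ∀ f M → partialSum r f M ≈ partialSum s f M
  partialSum-cong e f zero    = *-congʳ (reflexive (≡.cong K (e 0)))
  partialSum-cong e f (suc M) = +-cong (partialSum-cong e f M) (*-congʳ (reflexive (≡.cong K (e (suc M)))))

  δ-^ : ∀ f k → δ (f ^ suc k) ≈ K (natℚ (suc k)) * (f ^ k * δ f)
  δ-^ f zero = begin
    δ (f * 1#)                 ≈⟨ δ-cong (*-identityʳ f) ⟩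
    δ f                        ≈⟨ solve 1 (λ d → d := con 1 :* (con 1 :* d)) refl (δ f) ⟩
    1# * (1# * δ f)            ≈⟨ *-congʳ K-1 ⟨
    K 1ℚ * (1# * δ f)          ∎
  δ-^ f (suc k) = begin
    δ (f * f ^ suc k)                                      ≈⟨ δ-* f (f ^ suc k) ⟩
    δ f * f ^ suc k + f * δ (f ^ suc k)                    ≈⟨ +-congˡ (*-congˡ (δ-^ f k)) ⟩
    δ f * (f * f ^ k) + f * (K (natℚ (suc k)) * (f ^ k * δ f))
      ≈⟨ solve 4 (λ d f g k → d :* (f :* g) :+ f :* (k :* (g :* d)) := (con 1 :+ k) :* (f :* g :* d)) refl _ _ _ _ ⟩
    (1# + K (natℚ (suc k))) * (f ^ suc k * δ f)            ≈⟨ *-congʳ (+-congʳ K-1) ⟨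
    (K 1ℚ + K (natℚ (suc k))) * (f ^ suc k * δ f)          ≈⟨ *-congʳ (K-+ 1ℚ (natℚ (suc k))) ⟨
    K (natℚ (suc (suc k))) * (f ^ suc k * δ f)             ∎

  δ-K* : ∀ r y → δ (K r * y) ≈ K r * δ y
  δ-K* r y = trans (δ-* (K r) y) (trans (+-congʳ (trans (*-congʳ (δ-K r)) (zeroˡ y))) (+-identityˡ _))

  δ-term : ∀ r f k → δ (K (r (suc k)) * f ^ suc k) ≈ δ f * (K (deriv r k) * f ^ k)
  δ-term r f k = begin
    δ (K (r (suc k)) * f ^ suc k)                    ≈⟨ δ-K* _ _ ⟩
    K (r (suc k)) * δ (f ^ suc k)                    ≈⟨ *-congˡ (δ-^ f k) ⟩
    K (r (suc k)) * (K (natℚ (suc k)) * (f ^ k * δ f))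
      ≈⟨ solve 4 (λ a b g d → a :* (b :* (g :* d)) := d :* (b :* a :* g)) refl _ _ _ _ ⟩
    δ f * (K (natℚ (suc k)) * K (r (suc k)) * f ^ k) ≈⟨ *-congˡ (*-congʳ (K-* _ _)) ⟨
    δ f * (K (deriv r k) * f ^ k)                    ∎

  δ-partialSum : ∀ r f M → δ (partialSum r f (suc M)) ≈ δ f * partialSum (deriv r) f M
  δ-partialSum r f zero = begin
    δ (K (r 0) * 1# + K (r 1) * f ^ 1)         ≈⟨ δ-+ _ _ ⟩
    δ (K (r 0) * 1#) + δ (K (r 1) * f ^ 1)     ≈⟨ +-cong (trans (δ-cong (*-identityʳ _)) (δ-K _)) (δ-term r f 0) ⟩
    0# + δ f * (K (deriv r 0) * f ^ 0)         ≈⟨ +-identityˡ _ ⟩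
    δ f * (K (deriv r 0) * f ^ 0)              ∎
  δ-partialSum r f (suc M) = trans (δ-+ _ _) (trans (+-cong (δ-partialSum r f M) (δ-term r f (suc M)))
    (sym (distribˡ _ _ _)))

  private
    -- Reduces the identities for `S` to identities between partial sums: agreement up to every
    -- degree is equality.
    via : ∀ {x y : ℕ → Carrier} {a b} →
      (∀ M → a ~[ M ] x M) → (∀ M → x M ≈ y M) → (∀ M → b ~[ M ] y M) → a ≈ b
    via p e q = ~-separated (λ M → ~-trans (p M) (~-trans (~-reflexive (e M)) (~-sym (q M))))

    ~-refl : ∀ {M x} → x ~[ M ] x
    ~-refl = ~-reflexive refl

    trunc : ∀ {f} r → Small f → ∀ M → S r f ~[ M ] partialSum r f M
    trunc r small M = S-trunc r M M small ℕₚ.≤-refl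

  module _ {f} (small : Small f) where

    S-cong : ∀ {r s} → (∀ k → r k ≡ s k) → S r f ≈ S s f
    S-cong {r} {s} e = via (trunc r small) (partialSum-cong e f) (trunc s small)

    S-shift : ∀ r → f * S r f ≈ S (shift r) f
    S-shift r = via (λ M → ~-* ~-refl (trunc r small M)) (partialSum-shift r f)
      (λ M → S-trunc (shift r) M (suc M) small (ℕₚ.n≤1+n M))

    S-+ : ∀ r s → S (λ k → r k ℚ.+ s k) f ≈ S r f + S s f
    S-+ r s = via (trunc _ small) (partialSum-+ r s f) (λ M → ~-+ (trunc r small M) (trunc s small M))

    S-* : ∀ e r → S (λ k → e ℚ.* r k) f ≈ K e * S r f
    S-* e r = via (trunc _ small) (partialSum-* e r f) (λ M → ~-* ~-refl (trunc r small M))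

    S-unit : S unit f ≈ 1#
    S-unit = via (trunc unit small) (partialSum-unit f) (λ M → ~-refl)

    δ-S : ∀ r → δ (S r f) ≈ δ f * S (deriv r) f
    δ-S r = via (λ M → ~-δ (S-trunc r M (suc M) small (ℕₚ.n≤1+n M))) (δ-partialSum r f)
      (λ M → ~-* ~-refl (trunc (deriv r) small M))

    -- Coefficients in geometric progression satisfy `r = unit + e · shift r`, and `shift` is
    -- multiplication by `f`. Ratio 1 serves the reciprocals, ratio -1 the derivative of the
    -- logarithm.
    S-geometric : ∀ r e → r 0 ≡ 1ℚ → (∀ k → r (suc k) ≡ e ℚ.* r k) → S r f ≈ 1# + K e * (f * S r f)
    S-geometric r e r0 rs = begin
      S r f                                    ≈⟨ S-cong split ⟩
      S (λ k → unit k ℚ.+ e ℚ.* shift r k) f   ≈⟨ S-+ unit (λ k → e ℚ.* shift r k) ⟩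
      S unit f + S (λ k → e ℚ.* shift r k) f   ≈⟨ +-cong S-unit (S-* e (shift r)) ⟩
      1# + K e * S (shift r) f                 ≈⟨ +-congˡ (*-congˡ (S-shift r)) ⟨
      1# + K e * (f * S r f)                   ∎
      where
      split : ∀ k → r k ≡ unit k ℚ.+ e ℚ.* shift r k
      split zero    = ≡.trans r0 (≡.sym (≡.trans (≡.cong (1ℚ ℚ.+_) (ℚₚ.*-zeroʳ e)) (ℚₚ.+-identityʳ 1ℚ)))
      split (suc k) = ≡.trans (rs k) (≡.sym (ℚₚ.+-identityˡ _))

  -- With h = 1 - c g, the geometric series σ satisfies σ = 1 + h σ, while c g σ + h σ = σ. This is
  -- the recipe of `invS`, where `c` will be the reciprocal of the constant term of `g`.
  S-inverse : ∀ g c r → Small (1# - K c * g) → r 0 ≡ 1ℚ → (∀ k → r (suc k) ≡ 1ℚ ℚ.* r k) →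
    g * (K c * S r (1# - K c * g)) ≈ 1#
  S-inverse g c r small r0 rs = +-cancelʳ (h * σ) _ _ (begin
    g * (K c * σ) + h * σ           ≈⟨ solve 4 (λ g k s h → g :* (k :* s) :+ h :* s := (h :+ k :* g) :* s) refl g
        (K c) σ h ⟩
    (1# - K c * g + K c * g) * σ    ≈⟨ *-congʳ (trans (+-assoc _ _ _)
        (trans (+-congˡ (-‿inverseˡ (K c * g))) (+-identityʳ 1#))) ⟩
    1# * σ                          ≈⟨ *-identityˡ σ ⟩
    σ                               ≈⟨ S-geometric small r 1ℚ r0 rs ⟩
    1# + K 1ℚ * (h * σ)             ≈⟨ +-congˡ (trans (*-congʳ K-1) (*-identityˡ _)) ⟩
    1# + h * σ                      ∎)
    where
    h = 1# - K c * g
    σ = S r h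

-- The point is that δ u = u for u = 2 z (x − 1): this gives δ (x − e^u) = u (x − e^u), hence δ G = 2 z G for
-- the base G of the power, and δ (log G) = 2 z.
module ClosedForm (𝒮 : SubstitutionRing) where
  open SubstitutionRing 𝒮
  open Substitution 𝒮
  open Derivations A using (δ-1; δ-neg)
  open import Algebra.Properties.Ring ring
  open import Relation.Binary.Reasoning.Setoid setoid
  open import Algebra.Solver.Ring.NaturalCoefficients.Default commutativeSemiring

  -- `H⁻¹` is a parameter rather than computed from `H`: it is to be the `invS` of the denominator
  -- as `closedForm` spells it, which agrees with `H` only up to `≈`.
  module Construction (x z q two half H⁻¹ : Carrier) (expC logC : ℕ → ℚ) where

    m u H G L V : Carrier
    m = x - 1#
    u = two * (z * m)
    H = x - S expC u
    G = m * H⁻¹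
    L = S logC (G - 1#)
    V = q * (half * L)

    module Equation
      (δ-two : δ two ≈ 0#) (δ-half : δ half ≈ 0#) (half-two : half * two ≈ 1#)
      -- The rule for z is δ z = z - 2 x z², with the negative term moved to the left for the
      -- semiring solver.
      (δ-x : δ x ≈ x * u) (δ-z : δ z + two * (x * (z * z)) ≈ z) (δ-q : δ q ≈ 0#)
      (H-inv : H * H⁻¹ ≈ 1#) (m⁻¹ : Carrier) (m-inv : m * m⁻¹ ≈ 1#)
      (exp-deriv : ∀ k → deriv expC k ≡ expC k)
      (altC : ℕ → ℚ) (log-deriv : ∀ k → deriv logC k ≡ altC k)
      (alt-zero : altC 0 ≡ 1ℚ) (alt-suc : ∀ k → altC (suc k) ≡ (ℚ.- 1ℚ) ℚ.* altC k)
      (u-small : Small u) (G-small : Small (G - 1#)) (V-small : Small V)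
      where

      δ-const* : ∀ {c} y → δ c ≈ 0# → δ (c * y) ≈ c * δ y
      δ-const* {c} y e = trans (δ-* c y) (trans (+-congʳ (trans (*-congʳ e) (zeroˡ y))) (+-identityˡ _))

      δ-m : δ m ≈ x * u
      δ-m = begin
        δ (x - 1#)       ≈⟨ δ-+ x (- 1#) ⟩
        δ x + δ (- 1#)   ≈⟨ +-cong δ-x (trans (δ-neg D 1#) (-‿cong (δ-1 D))) ⟩
        x * u - 0#       ≈⟨ +-congˡ -0#≈0# ⟩
        x * u + 0#       ≈⟨ +-identityʳ _ ⟩
        x * u            ∎

      δ-u : δ u ≈ u
      δ-u = begin
        δ (two * (z * m))                          ≈⟨ δ-const* _ δ-two ⟩
        two * δ (z * m)                            ≈⟨ *-congˡ (δ-* z m) ⟩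
        two * (δ z * m + z * δ m)                  ≈⟨ *-congˡ (+-congˡ (*-congˡ δ-m)) ⟩
        two * (δ z * m + z * (x * (two * (z * m))))
          ≈⟨ solve 5 (λ t d m z x → t :* (d :* m :+ z :* (x :* (t :* (z :* m)))) :=
               t :* ((d :+ t :* (x :* (z :* z))) :* m)) refl two (δ z) m z x ⟩
        two * ((δ z + two * (x * (z * z))) * m)    ≈⟨ *-congˡ (*-congʳ δ-z) ⟩
        two * (z * m)                              ∎

      δ-exp : ∀ {f} → Small f → δ (S expC f) ≈ δ f * S expC f
      δ-exp small = trans (δ-S small expC) (*-congˡ (S-cong small exp-deriv))

      δ-H : δ H ≈ u * H
      δ-H = begin
        δ (x - S expC u)               ≈⟨ δ-+ x _ ⟩
        δ x + δ (- S expC u)           ≈⟨ +-cong δ-x (δ-neg D _) ⟩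
        x * u - δ (S expC u)           ≈⟨ +-cong (*-comm x u) (-‿cong (trans (δ-exp u-small) (*-congʳ δ-u))) ⟩
        u * x - u * S expC u           ≈⟨ x[y-z]≈xy-xz u x _ ⟨
        u * (x - S expC u)             ∎

      G*H : G * H ≈ m
      G*H = begin
        m * H⁻¹ * H    ≈⟨ *-assoc m _ _ ⟩
        m * (H⁻¹ * H)  ≈⟨ *-congˡ (trans (*-comm _ _) H-inv) ⟩
        m * 1#         ≈⟨ *-identityʳ m ⟩
        m              ∎

      x≈m+1 : x ≈ m + 1#
      x≈m+1 = sym (trans (+-assoc x (- 1#) 1#) (trans (+-congˡ (-‿inverseˡ 1#)) (+-identityʳ x)))

      -- Differentiating G H = m gives δ G · H + m u = x u, and x - m = 1.
      δG*H : δ G * H ≈ u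
      δG*H = +-cancelˡ (u * m) _ _ (begin
        u * m + δ G * H          ≈⟨ +-congʳ (*-congˡ G*H) ⟨
        u * (G * H) + δ G * H    ≈⟨ solve 4 (λ u g h d → u :* (g :* h) :+ d :* h := d :* h :+ g :* (u :* h)) refl u
            G H (δ G) ⟩
        δ G * H + G * (u * H)    ≈⟨ +-congˡ (*-congˡ δ-H) ⟨
        δ G * H + G * δ H        ≈⟨ δ-* G H ⟨
        δ (G * H)                ≈⟨ δ-cong G*H ⟩
        δ m                      ≈⟨ δ-m ⟩
        x * u                    ≈⟨ *-congʳ x≈m+1 ⟩
        (m + 1#) * u             ≈⟨ solve 2 (λ m u → (m :+ con 1) :* u := u :* m :+ u) refl m u ⟩
        u * m + u                ∎)

      G⁻¹ = S altC (G - 1#)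

      -- `altC` is the derivative of `logC`, so `G⁻¹` is the series 1/(1 + f) at f = G - 1; the
      -- geometric recursion reads `G⁻¹ = 1 − f G⁻¹`.
      G-inv : G * G⁻¹ ≈ 1#
      G-inv = +-cancelʳ (- (f * G⁻¹)) _ _ (begin
        G * G⁻¹ - f * G⁻¹          ≈⟨ [y-z]x≈yx-zx G⁻¹ G f ⟨
        (G - f) * G⁻¹              ≈⟨ *-congʳ G-f ⟩
        1# * G⁻¹                   ≈⟨ *-identityˡ _ ⟩
        G⁻¹                        ≈⟨ S-geometric G-small altC (ℚ.- 1ℚ) alt-zero alt-suc ⟩
        1# + K (ℚ.- 1ℚ) * (f * G⁻¹) ≈⟨ +-congˡ (trans (*-congʳ K-neg1) (-1*x≈-x _)) ⟩
        1# - f * G⁻¹               ∎)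
        where
        f = G - 1#
        G-f : G - f ≈ 1#
        G-f = begin
          G - (G - 1#)         ≈⟨ +-congˡ (⁻¹-anti-homo-// G 1#) ⟩
          G + (1# - G)         ≈⟨ +-comm _ _ ⟩
          1# - G + G           ≈⟨ +-assoc _ _ _ ⟩
          1# + (- G + G)       ≈⟨ +-congˡ (-‿inverseˡ G) ⟩
          1# + 0#              ≈⟨ +-identityʳ _ ⟩
          1#                   ∎
        K-neg1 : K (ℚ.- 1ℚ) ≈ - 1#
        K-neg1 = +-cancelˡ 1# _ _ (begin
          1# + K (ℚ.- 1ℚ)       ≈⟨ +-congʳ K-1 ⟨
          K 1ℚ + K (ℚ.- 1ℚ)     ≈⟨ K-+ 1ℚ (ℚ.- 1ℚ) ⟨
          K 0ℚ                  ≈⟨ K-0 ⟩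
          0#                    ≈⟨ -‿inverseʳ 1# ⟨
          1# - 1#               ∎)

      -- Only the product `δ G * H` is known, so `δ L` is first multiplied by `m = G H`, where `G⁻¹`
      -- cancels `G`; `m⁻¹` then removes the factor `m`.
      δ-L : δ L ≈ two * z
      δ-L = begin
        δ L                    ≈⟨ *-identityʳ _ ⟨
        δ L * 1#               ≈⟨ *-congˡ m-inv ⟨
        δ L * (m * m⁻¹)        ≈⟨ *-assoc _ _ _ ⟨
        δ L * m * m⁻¹          ≈⟨ *-congʳ δL*m ⟩
        two * z * m * m⁻¹      ≈⟨ *-assoc _ _ _ ⟩
        two * z * (m * m⁻¹)    ≈⟨ *-congˡ m-inv ⟩
        two * z * 1#           ≈⟨ *-identityʳ _ ⟩
        two * z                ∎
        where
        δf : δ (G - 1#) ≈ δ G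
        δf = trans (δ-+ G (- 1#)) (trans (+-congˡ (trans (δ-neg D 1#) (trans (-‿cong (δ-1 D)) -0#≈0#)))
            (+-identityʳ _))
        δL*m : δ L * m ≈ two * z * m
        δL*m = begin
          δ L * m                     ≈⟨ *-cong (trans (δ-S G-small logC) (*-cong δf (S-cong G-small log-deriv)))
              (sym G*H) ⟩
          δ G * G⁻¹ * (G * H)         ≈⟨ solve 4 (λ d w g h → d :* w :* (g :* h) := g :* w :* (d :* h)) refl (δ G)
              G⁻¹ G H ⟩
          G * G⁻¹ * (δ G * H)         ≈⟨ *-cong G-inv δG*H ⟩
          1# * (two * (z * m))        ≈⟨ solve 3 (λ t z m → con 1 :* (t :* (z :* m)) := t :* z :* m) refl two z m ⟩
          two * z * m                 ∎

      δ-closedForm : δ (S expC V) ≈ z * q * S expC V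
      δ-closedForm = trans (δ-exp V-small) (*-congʳ (begin
        δ (q * (half * L))      ≈⟨ δ-const* _ δ-q ⟩
        q * δ (half * L)        ≈⟨ *-congˡ (trans (δ-const* _ δ-half) (*-congˡ δ-L)) ⟩
        q * (half * (two * z))  ≈⟨ solve 4 (λ q h t z → q :* (h :* (t :* z)) := h :* t :* (z :* q)) refl q half two
            z ⟩
        half * two * (z * q)    ≈⟨ *-congʳ half-two ⟩
        1# * (z * q)            ≈⟨ *-identityˡ _ ⟩
        z * q                   ∎))

-- The ring ℚ[[x, q, z]] and its coefficients

open ≡ using (refl; cong; cong₂; module ≡-Reasoning)

module Pz  = PowerSeries ℚₚ.+-*-commutativeRing
module Pqz = PowerSeries Pz.seriesRing
module Pxqz = PowerSeries Pqz.seriesRing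

module 𝔸 = CommutativeRing Pxqz.seriesRing

sumℚ-cong : ∀ n {f g : ℕ → ℚ} → (∀ k → k ℕ.≤ n → f k ≡ g k) → sumℚ n f ≡ sumℚ n g
sumℚ-cong zero    e = e 0 z≤n
sumℚ-cong (suc n) e = cong₂ ℚ._+_ (sumℚ-cong n (λ k k≤n → e k (ℕₚ.m≤n⇒m≤1+n k≤n))) (e (suc n) ℕₚ.≤-refl)

sumℚ-zero : ∀ n {f : ℕ → ℚ} → (∀ k → k ℕ.≤ n → f k ≡ 0ℚ) → sumℚ n f ≡ 0ℚ
sumℚ-zero n e = ≡.trans (sumℚ-cong n e) (zeros n)
  where
  zeros : ∀ n → sumℚ n (λ _ → 0ℚ) ≡ 0ℚ
  zeros zero    = refl
  zeros (suc n) = ≡.trans (ℚₚ.+-identityʳ _) (zeros n)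

*S≈* : ∀ f g → f *S g 𝔸.≈ f 𝔸.* g
*S≈* f g a b c = ≡.sym (begin
  (f 𝔸.* g) a b c
    ≡⟨ atₓ a _ b c ⟩
  sumℚ a (λ i → (f i Pqz.⊛ g (a ∸ i)) b c)
    ≡⟨ sumℚ-cong a (λ i _ → ≡.trans (at_q b _ c) (sumℚ-cong b (λ j _ → at_z c _))) ⟩
  (f *S g) a b c ∎)
  where
  open ≡-Reasoning
  at_z : ∀ n F → Pz.∑ n F ≡ sumℚ n F
  at_z zero    F = refl
  at_z (suc n) F = cong (ℚ._+ F (suc n)) (at_z n F)
  at_q : ∀ n F c → Pqz.∑ n F c ≡ sumℚ n (λ i → F i c)
  at_q zero    F c = refl
  at_q (suc n) F c = cong (ℚ._+ F (suc n) c) (at_q n F c)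
  atₓ : ∀ n F b c → Pxqz.∑ n F b c ≡ sumℚ n (λ i → F i b c)
  atₓ zero    F b c = refl
  atₓ (suc n) F b c = cong (ℚ._+ F (suc n) b c) (atₓ n F b c)

Region : Set₁
Region = ℕ → ℕ → ℕ → Set

-- A coefficient of a product involves only coefficients of the factors at smaller exponents, so
-- agreement on a down-closed region is compatible with the ring operations. The regions used are a
-- bound on the total degree, a bound on the degree in z, degree 0 in z, and everything.
record DownClosed (U : Region) : Set where
  field down : ∀ {a b c a′ b′ c′} → a′ ℕ.≤ a → b′ ℕ.≤ b → c′ ℕ.≤ c → U a b c → U a′ b′ c′
open DownClosed

Agree : Region → PS → PS → Set
Agree U f g = ∀ a b c → U a b c → f a b c ≡ g a b c

*-agree : ∀ {U f f′ g g′} → DownClosed U → Agree U f f′ → Agree U g g′ → Agree U (f 𝔸.* g) (f′ 𝔸.* g′)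
*-agree {U} {f} {f′} {g} {g′} U↓ e e′ a b c u = ≡.trans (≡.sym (*S≈* f g a b c)) (≡.trans
  (sumℚ-cong a (λ i i≤a → sumℚ-cong b (λ j j≤b → sumℚ-cong c (λ k k≤c → cong₂ ℚ._*_
    (e i j k (down U↓ i≤a j≤b k≤c u))
    (e′ _ _ _ (down U↓ (ℕₚ.m∸n≤m a i) (ℕₚ.m∸n≤m b j) (ℕₚ.m∸n≤m c k) u))))))
  (*S≈* f′ g′ a b c))

K : ℚ → PS
K r = Pxqz.C (Pqz.C (Pz.C r))

X 𝐪 𝐳 : PS
X = Pxqz.indet
𝐪 = Pxqz.C Pqz.indet
𝐳 = Pxqz.C (Pqz.C Pz.indet)

constS≈K : ∀ r → constS r 𝔸.≈ K r
constS≈K r zero    zero    zero    = refl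
constS≈K r zero    zero    (suc c) = refl
constS≈K r zero    (suc b) c       = refl
constS≈K r (suc a) b       c       = refl

xS≈X : xS 𝔸.≈ X
xS≈X zero          b       c       = refl
xS≈X (suc zero)    zero    zero    = refl
xS≈X (suc zero)    zero    (suc c) = refl
xS≈X (suc zero)    (suc b) c       = refl
xS≈X (suc (suc a)) b       c       = refl

qS≈𝐪 : qS 𝔸.≈ 𝐪
qS≈𝐪 zero    zero          c       = refl
qS≈𝐪 zero    (suc zero)    zero    = refl
qS≈𝐪 zero    (suc zero)    (suc c) = refl
qS≈𝐪 zero    (suc (suc b)) c       = refl
qS≈𝐪 (suc a) b             c       = refl

zS≈𝐳 : zS 𝔸.≈ 𝐳
zS≈𝐳 zero    zero    zero          = refl
zS≈𝐳 zero    zero    (suc zero)    = refl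
zS≈𝐳 zero    zero    (suc (suc c)) = refl
zS≈𝐳 zero    (suc b) c             = refl
zS≈𝐳 (suc a) b       c             = refl

K-eval : ∀ r f a b c → (K r 𝔸.* f) a b c ≡ r ℚ.* f a b c
K-eval r f a b c = ≡.trans (Pxqz.C-⊛ _ f a b c) (≡.trans (Pqz.C-⊛ _ (f a) b c) (Pz.C-⊛ r (f a b) c))

X-eval : ∀ f a b c → (X 𝔸.* f) (suc a) b c ≡ f a b c
X-eval f a b c = Pxqz.indet-⊛-suc f a b c

X-eval0 : ∀ f b c → (X 𝔸.* f) 0 b c ≡ 0ℚ
X-eval0 f b c = CommutativeRing.zeroˡ Pqz.seriesRing (f 0) b c

𝐪-eval : ∀ f a b c → (𝐪 𝔸.* f) a (suc b) c ≡ f a b c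
𝐪-eval f a b c = ≡.trans (Pxqz.C-⊛ _ f a (suc b) c) (Pqz.indet-⊛-suc (f a) b c)

𝐪-eval0 : ∀ f a c → (𝐪 𝔸.* f) a 0 c ≡ 0ℚ
𝐪-eval0 f a c = ≡.trans (Pxqz.C-⊛ _ f a 0 c) (CommutativeRing.zeroˡ Pz.seriesRing (f a 0) c)

𝐳-eval : ∀ f a b c → (𝐳 𝔸.* f) a b (suc c) ≡ f a b c
𝐳-eval f a b c = ≡.trans (Pxqz.C-⊛ _ f a b (suc c)) (≡.trans (Pqz.C-⊛ _ (f a) b (suc c)) (Pz.indet-⊛-suc (f a b) c))

𝐳-eval0 : ∀ f a b → (𝐳 𝔸.* f) a b 0 ≡ 0ℚ
𝐳-eval0 f a b = ≡.trans (Pxqz.C-⊛ _ f a b 0) (≡.trans (Pqz.C-⊛ _ (f a) b 0) (ℚₚ.*-zeroˡ (f a b 0)))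

scaleS≈K : ∀ r f → scaleS r f 𝔸.≈ K r 𝔸.* f
scaleS≈K r f a b c = ≡.sym (K-eval r f a b c)

Θx Θz : Derivation Pxqz.seriesRing
Θx = Pxqz.euler
Θz = Pxqz.coefficientwise (Pqz.coefficientwise Pz.euler)

module Θx = Derivation Θx
module Θz = Derivation Θz

Θx-eval : ∀ f a b c → Θx.δ f a b c ≡ natℚ a ℚ.* f a b c
Θx-eval f a b c = go a (f a) b c
  where
  open import Algebra.Definitions.RawMonoid (CommutativeRing.+-rawMonoid Pqz.seriesRing) using () renaming (_×_ to _·_)
  go : ∀ n g b c → (n · g) b c ≡ natℚ n ℚ.* g b c
  go zero    g b c = ≡.sym (ℚₚ.*-zeroˡ (g b c))
  go (suc n) g b c = ≡.trans (cong₂ ℚ._+_ (≡.sym (ℚₚ.*-identityˡ (g b c))) (go n g b c))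
      (≡.sym (ℚₚ.*-distribʳ-+ (g b c) 1ℚ (natℚ n)))

Θz-eval : ∀ f a b c → Θz.δ f a b c ≡ natℚ c ℚ.* f a b c
Θz-eval f a b c = go c (f a b c)
  where
  open import Algebra.Definitions.RawMonoid (CommutativeRing.+-rawMonoid ℚₚ.+-*-commutativeRing) using () renaming (_×_ to _·_)
  go : ∀ n g → (n · g) ≡ natℚ n ℚ.* g
  go zero    g = ≡.sym (ℚₚ.*-zeroˡ g)
  go (suc n) g = ≡.trans (cong₂ ℚ._+_ (≡.sym (ℚₚ.*-identityˡ g)) (go n g)) (≡.sym (ℚₚ.*-distribʳ-+ g 1ℚ (natℚ n)))

two 𝐦 𝐮 : PS
two = K (ℤ.+ 2 ℚ./ 1)
𝐦 = X 𝔸.- 𝔸.1#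
𝐮 = two 𝔸.* (𝐳 𝔸.* 𝐦)

-- z times the operator (1 − 2xz) ∂/∂z − 2x(1 − x) ∂/∂x of the recurrence.
𝔻 : Derivation Pxqz.seriesRing
𝔻 = scaled (𝔸.1# 𝔸.- two 𝔸.* (X 𝔸.* 𝐳)) Θz ⊞ scaled 𝐮 Θx
  where open Derivations Pxqz.seriesRing

module 𝔻 = Derivation 𝔻

Θx-agree : ∀ {U f g} → Agree U f g → Agree U (Θx.δ f) (Θx.δ g)
Θx-agree {f = f} {g} e a b c u = ≡.trans (Θx-eval f a b c) (≡.trans (cong (natℚ a ℚ.*_) (e a b c u))
    (≡.sym (Θx-eval g a b c)))

Θz-agree : ∀ {U f g} → Agree U f g → Agree U (Θz.δ f) (Θz.δ g)
Θz-agree {f = f} {g} e a b c u = ≡.trans (Θz-eval f a b c) (≡.trans (cong (natℚ c ℚ.*_) (e a b c u))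
    (≡.sym (Θz-eval g a b c)))

+-agree : ∀ {U f f′ g g′} → Agree U f f′ → Agree U g g′ → Agree U (f 𝔸.+ g) (f′ 𝔸.+ g′)
+-agree e e′ a b c u = cong₂ ℚ._+_ (e a b c u) (e′ a b c u)

𝔻-agree : ∀ {U f g} → DownClosed U → Agree U f g → Agree U (𝔻.δ f) (𝔻.δ g)
𝔻-agree {U} {f} {g} U↓ e = +-agree {g = 𝐮 𝔸.* Θx.δ f} {𝐮 𝔸.* Θx.δ g}
  (*-agree {f = α} {α} U↓ (λ _ _ _ _ → refl) (Θz-agree {U} {f} {g} e))
  (*-agree {f = 𝐮} {𝐮} U↓ (λ _ _ _ _ → refl) (Θx-agree {U} {f} {g} e))
  where α = 𝔸.1# 𝔸.- two 𝔸.* (X 𝔸.* 𝐳)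

open PartialSums Pxqz.seriesRing K

TotalDegree≤ : ℕ → Region
TotalDegree≤ M a b c = a ℕ.+ b ℕ.+ c ℕ.≤ M

TotalDegree≤-down : ∀ M → DownClosed (TotalDegree≤ M)
TotalDegree≤-down M .down p q r u = ℕₚ.≤-trans (ℕₚ.+-mono-≤ (ℕₚ.+-mono-≤ p q) r) u

powS≈^ : ∀ f k → powS f k 𝔸.≈ f ^ k
powS≈^ f zero    = constS≈K 1ℚ
powS≈^ f (suc k) = 𝔸.trans {powS f (suc k)} {f 𝔸.* powS f k} {f ^ suc k} (*S≈* f (powS f k))
  (𝔸.*-congˡ {f} {powS f k} {f ^ k} (powS≈^ f k))

-- In a term of the convolution either the first factor is the constant term of `f`, which is 0, or
-- it uses up some degree and the remaining power vanishes by induction.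
powS-vanishes : ∀ {f} → f 0 0 0 ≡ 0ℚ → ∀ k a b c → a ℕ.+ b ℕ.+ c ℕ.< k → powS f k a b c ≡ 0ℚ
powS-vanishes {f} f₀ (suc k) a b c (s≤s d≤k) =
  sumℚ-zero a (λ i i≤a → sumℚ-zero b (λ j j≤b → sumℚ-zero c (λ l l≤c → term i j l i≤a j≤b l≤c)))
  where
  +-mono₃ : ∀ {a b c a′ b′ c′} → a ℕ.≤ a′ → b ℕ.≤ b′ → c ℕ.≤ c′ → a ℕ.+ b ℕ.+ c ℕ.≤ a′ ℕ.+ b′ ℕ.+ c′
  +-mono₃ p q r = ℕₚ.+-mono-≤ (ℕₚ.+-mono-≤ p q) r
  lower : ∀ m n → suc n ℕ.≤ m → m ∸ suc n ℕ.< m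
  lower (suc m) n _ = s≤s (ℕₚ.m∸n≤m m n)
  by : ∀ v a′ b′ c′ → a′ ℕ.+ b′ ℕ.+ c′ ℕ.< a ℕ.+ b ℕ.+ c → v ℚ.* powS f k a′ b′ c′ ≡ 0ℚ
  by v a′ b′ c′ lt = ≡.trans (cong (v ℚ.*_) (powS-vanishes f₀ k a′ b′ c′ (ℕₚ.<-≤-trans lt d≤k))) (ℚₚ.*-zeroʳ v)
  term : ∀ i j l → i ℕ.≤ a → j ℕ.≤ b → l ℕ.≤ c → f i j l ℚ.* powS f k (a ∸ i) (b ∸ j) (c ∸ l) ≡ 0ℚ
  term zero zero zero _ _ _ = ≡.trans (cong (ℚ._* powS f k a b c) f₀) (ℚₚ.*-zeroˡ (powS f k a b c))
  term zero zero (suc l) _ _ l<c = by (f 0 0 (suc l)) a b (c ∸ suc l) (ℕₚ.+-monoʳ-< (a ℕ.+ b) (lower c l l<c))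
  term zero (suc j) l _ j<b _ = by (f 0 (suc j) l) a (b ∸ suc j) (c ∸ l)
      (ℕₚ.+-mono-<-≤ (ℕₚ.+-monoʳ-< a (lower b j j<b)) (ℕₚ.m∸n≤m c l))
  term (suc i) j l i<a _ _ = by (f (suc i) j l) (a ∸ suc i) (b ∸ j) (c ∸ l)
      (ℕₚ.+-mono-<-≤ (ℕₚ.+-mono-<-≤ (lower a i i<a) (ℕₚ.m∸n≤m b j)) (ℕₚ.m∸n≤m c l))

partialSum-eval : ∀ r f M a b c → partialSum r f M a b c ≡ sumℚ M (λ k → r k ℚ.* powS f k a b c)
partialSum-eval r f M a b c = go M
  where
  at : ∀ k → (K (r k) 𝔸.* (f ^ k)) a b c ≡ r k ℚ.* powS f k a b c
  at k = ≡.trans (K-eval (r k) (f ^ k) a b c) (cong (r k ℚ.*_) (≡.sym (powS≈^ f k a b c)))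
  go : ∀ M → partialSum r f M a b c ≡ sumℚ M (λ k → r k ℚ.* powS f k a b c)
  go zero    = at 0
  go (suc M) = cong₂ ℚ._+_ (go M) (at (suc M))

sumℚ-extend : ∀ {f : ℕ → ℚ} n {m} → n ℕ.≤ m → (∀ k → n ℕ.< k → f k ≡ 0ℚ) → sumℚ n f ≡ sumℚ m f
sumℚ-extend {f} n n≤m e = go (ℕₚ.≤⇒≤′ n≤m)
  where
  go : ∀ {m} → n ℕ.≤′ m → sumℚ n f ≡ sumℚ m f
  go ℕ.≤′-refl             = refl
  go {suc m} (ℕ.≤′-step p) = begin
    sumℚ n f               ≡⟨ go p ⟩
    sumℚ m f               ≡⟨ ℚₚ.+-identityʳ (sumℚ m f) ⟨
    sumℚ m f ℚ.+ 0ℚ        ≡⟨ cong (sumℚ m f ℚ.+_) (e (suc m) (s≤s (ℕₚ.≤′⇒≤ p))) ⟨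
    sumℚ m f ℚ.+ f (suc m) ∎
    where open ≡-Reasoning

-- `seriesS` stops at the total degree of the coefficient; the further terms of a longer partial sum
-- vanish there by `powS-vanishes`.
seriesS-trunc : ∀ {f} r M M′ → f 0 0 0 ≡ 0ℚ → M ℕ.≤ M′ → Agree (TotalDegree≤ M) (seriesS r f) (partialSum r f M′)
seriesS-trunc {f} r M M′ f₀ M≤M′ a b c d≤M = ≡.trans
  (sumℚ-extend (a ℕ.+ b ℕ.+ c) (ℕₚ.≤-trans d≤M M≤M′)
    (λ k d<k → ≡.trans (cong (r k ℚ.*_) (powS-vanishes f₀ k a b c d<k)) (ℚₚ.*-zeroʳ (r k))))
  (≡.sym (partialSum-eval r f M′ a b c))

K-homo-+ : ∀ r s → K (r ℚ.+ s) 𝔸.≈ K r 𝔸.+ K s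
K-homo-+ r s zero    zero    zero    = refl
K-homo-+ r s zero    zero    (suc c) = refl
K-homo-+ r s zero    (suc b) c       = refl
K-homo-+ r s (suc a) b       c       = refl

K-homo-* : ∀ r s → K (r ℚ.* s) 𝔸.≈ K r 𝔸.* K s
K-homo-* r s a b c = ≡.trans (go a b c) (≡.sym (K-eval r (K s) a b c))
  where
  go : ∀ a b c → K (r ℚ.* s) a b c ≡ r ℚ.* K s a b c
  go zero    zero    zero    = refl
  go zero    zero    (suc c) = ≡.sym (ℚₚ.*-zeroʳ r)
  go zero    (suc b) c       = ≡.sym (ℚₚ.*-zeroʳ r)
  go (suc a) b       c       = ≡.sym (ℚₚ.*-zeroʳ r)

K-homo-0 : K 0ℚ 𝔸.≈ 𝔸.0#
K-homo-0 zero    zero    zero    = refl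
K-homo-0 zero    zero    (suc c) = refl
K-homo-0 zero    (suc b) c       = refl
K-homo-0 (suc a) b       c       = refl

Θx-const : ∀ g → Θx.δ (Pxqz.C g) 𝔸.≈ 𝔸.0#
Θx-const g zero    b c = refl
Θx-const g (suc a) b c = ≡.trans (Θx-eval (Pxqz.C g) (suc a) b c) (ℚₚ.*-zeroʳ (natℚ (suc a)))

Θz-const : ∀ f → (∀ a b c → f a b (suc c) ≡ 0ℚ) → Θz.δ f 𝔸.≈ 𝔸.0#
Θz-const f e a b zero    = refl
Θz-const f e a b (suc c) = ≡.trans (Θz-eval f a b (suc c)) (≡.trans (cong (natℚ (suc c) ℚ.*_) (e a b c))
    (ℚₚ.*-zeroʳ (natℚ (suc c))))

𝔻-const : ∀ {f} → Θx.δ f 𝔸.≈ 𝔸.0# → Θz.δ f 𝔸.≈ 𝔸.0# → 𝔻.δ f 𝔸.≈ 𝔸.0#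
𝔻-const {f} ex ez = begin
  α 𝔸.* Θz.δ f 𝔸.+ 𝐮 𝔸.* Θx.δ f  ≈⟨ 𝔸.+-cong {α 𝔸.* Θz.δ f} {𝔸.0#} {𝐮 𝔸.* Θx.δ f} {𝔸.0#}
      (𝔸.trans {α 𝔸.* Θz.δ f} {α 𝔸.* 𝔸.0#} {𝔸.0#} (𝔸.*-congˡ {α} {Θz.δ f} ez) (𝔸.zeroʳ α))
      (𝔸.trans {𝐮 𝔸.* Θx.δ f} {𝐮 𝔸.* 𝔸.0#} {𝔸.0#} (𝔸.*-congˡ {𝐮} {Θx.δ f} ex) (𝔸.zeroʳ 𝐮)) ⟩
  𝔸.0# 𝔸.+ 𝔸.0#                   ≈⟨ 𝔸.+-identityˡ 𝔸.0# ⟩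
  𝔸.0#                            ∎
  where
  open import Relation.Binary.Reasoning.Setoid 𝔸.setoid
  α = 𝔸.1# 𝔸.- two 𝔸.* (X 𝔸.* 𝐳)

K-z : ∀ r a b c → K r a b (suc c) ≡ 0ℚ
K-z r zero    zero    c = refl
K-z r zero    (suc b) c = refl
K-z r (suc a) b       c = refl

𝔻-K : ∀ r → 𝔻.δ (K r) 𝔸.≈ 𝔸.0#
𝔻-K r = 𝔻-const {K r} (Θx-const _) (Θz-const (K r) (K-z r))

𝒮 : SubstitutionRing
𝒮 = record
  { A = Pxqz.seriesRing
  ; D = 𝔻
  ; K = K
  ; K-+ = K-homo-+
  ; K-* = K-homo-*
  ; K-0 = K-homo-0
  ; K-1 = λ _ _ _ → refl
  ; δ-K = 𝔻-K
  ; _~[_]_ = λ f M g → Agree (TotalDegree≤ M) f g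
  ; ~-reflexive = λ e a b c _ → e a b c
  ; ~-sym = λ e a b c u → ≡.sym (e a b c u)
  ; ~-trans = λ e e′ a b c u → ≡.trans (e a b c u) (e′ a b c u)
  ; ~-+ = λ {M} {x} {y} {x′} {y′} → +-agree {f = x} {y} {x′} {y′}
  ; ~-* = λ {M} {x} {y} {x′} {y′} → *-agree {f = x} {y} {x′} {y′} (TotalDegree≤-down M)
  ; ~-δ = λ {M} {x} {y} → 𝔻-agree {f = x} {y} (TotalDegree≤-down M)
  ; ~-separated = λ e a b c → e (a ℕ.+ b ℕ.+ c) a b c ℕₚ.≤-refl
  ; Small = λ f → f 0 0 0 ≡ 0ℚ
  ; S = seriesS
  ; S-trunc = seriesS-trunc
  }

-- Rational arithmetic and the coefficients of exp and log

fromℚᵘ-homo-+ : ∀ p q → fromℚᵘ (p ℚᵘ.+ q) ≡ fromℚᵘ p ℚ.+ fromℚᵘ q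
fromℚᵘ-homo-+ p q = ℚₚ.toℚᵘ-injective (ℚᵘₚ.≃-trans (ℚₚ.toℚᵘ-fromℚᵘ (p ℚᵘ.+ q)) (ℚᵘₚ.≃-sym
  (ℚᵘₚ.≃-trans (ℚₚ.toℚᵘ-homo-+ (fromℚᵘ p) (fromℚᵘ q)) (ℚᵘₚ.+-cong (ℚₚ.toℚᵘ-fromℚᵘ p) (ℚₚ.toℚᵘ-fromℚᵘ q)))))

fromℚᵘ-homo-* : ∀ p q → fromℚᵘ (p ℚᵘ.* q) ≡ fromℚᵘ p ℚ.* fromℚᵘ q
fromℚᵘ-homo-* p q = ℚₚ.toℚᵘ-injective (ℚᵘₚ.≃-trans (ℚₚ.toℚᵘ-fromℚᵘ (p ℚᵘ.* q)) (ℚᵘₚ.≃-sym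
  (ℚᵘₚ.≃-trans (ℚₚ.toℚᵘ-homo-* (fromℚᵘ p) (fromℚᵘ q)) (ℚᵘₚ.*-cong (ℚₚ.toℚᵘ-fromℚᵘ p) (ℚₚ.toℚᵘ-fromℚᵘ q)))))

/1-homo-+ : ∀ i j → (i ℤ.+ j) ℚ./ 1 ≡ i ℚ./ 1 ℚ.+ j ℚ./ 1
/1-homo-+ i j = ≡.trans
  (cong (ℚ._/ 1) (≡.sym (cong₂ ℤ._+_ (ℤₚ.*-identityʳ i) (ℤₚ.*-identityʳ j))))
  (fromℚᵘ-homo-+ (ℚᵘ.mkℚᵘ i 0) (ℚᵘ.mkℚᵘ j 0))

/1-homo-* : ∀ i j → (i ℤ.* j) ℚ./ 1 ≡ (i ℚ./ 1) ℚ.* (j ℚ./ 1)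
/1-homo-* i j = fromℚᵘ-homo-* (ℚᵘ.mkℚᵘ i 0) (ℚᵘ.mkℚᵘ j 0)

-- `natℚ` is recursive so that it unfolds one unit at a time, as do the multiples in the Euler
-- operators and the powers in `δ-^`; the comparison with fractions is made here once.
natℚ≡/1 : ∀ n → natℚ n ≡ ℤ.+ n ℚ./ 1
natℚ≡/1 zero    = refl
natℚ≡/1 (suc n) = ≡.trans (cong (1ℚ ℚ.+_) (natℚ≡/1 n)) (≡.sym (/1-homo-+ (ℤ.+ 1) (ℤ.+ n)))

natℚ-homo-* : ∀ m n → natℚ (m ℕ.* n) ≡ natℚ m ℚ.* natℚ n
natℚ-homo-* m n = begin
  natℚ (m ℕ.* n)                   ≡⟨ natℚ≡/1 (m ℕ.* n) ⟩
  ℤ.+ (m ℕ.* n) ℚ./ 1              ≡⟨ cong (ℚ._/ 1) (ℤₚ.pos-* m n) ⟩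
  (ℤ.+ m ℤ.* ℤ.+ n) ℚ./ 1          ≡⟨ /1-homo-* (ℤ.+ m) (ℤ.+ n) ⟩
  (ℤ.+ m ℚ./ 1) ℚ.* (ℤ.+ n ℚ./ 1)      ≡⟨ cong₂ ℚ._*_ (natℚ≡/1 m) (natℚ≡/1 n) ⟨
  natℚ m ℚ.* natℚ n                ∎
  where open ≡-Reasoning

natℚ-inverse : ∀ n .{{_ : NonZero n}} → natℚ n ℚ.* (ℤ.+ 1 ℚ./ n) ≡ 1ℚ
natℚ-inverse (suc n) = begin
  natℚ (suc n) ℚ.* (ℤ.+ 1 ℚ./ suc n)         ≡⟨ cong (ℚ._* (ℤ.+ 1 ℚ./ suc n)) (natℚ≡/1 (suc n)) ⟩
  (ℤ.+ suc n ℚ./ 1) ℚ.* (ℤ.+ 1 ℚ./ suc n)    ≡⟨ fromℚᵘ-homo-* p q ⟨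
  fromℚᵘ (p ℚᵘ.* q)                          ≡⟨ ℚₚ.fromℚᵘ-cong {p ℚᵘ.* q} {ℚᵘ.1ℚᵘ} (ℚᵘ.*≡* (cong (λ k → ℤ.+ k) eq)) ⟩
  1ℚ                                         ∎
  where
  open ≡-Reasoning
  p = ℚᵘ.mkℚᵘ (ℤ.+ suc n) 0
  q = ℚᵘ.mkℚᵘ (ℤ.+ 1) n
  eq : suc n ℕ.* 1 ℕ.* 1 ≡ 1 ℕ.* suc (n ℕ.+ 0 ℕ.* suc n)
  eq = ≡.trans (ℕₚ.*-identityʳ _) (≡.trans (ℕₚ.*-identityʳ _)
      (≡.sym (≡.trans (ℕₚ.*-identityˡ _) (cong suc (ℕₚ.+-identityʳ n)))))

-- Inserting k! · 1/k! turns the left side into (k+1)! · 1/(k+1)! · 1/k!.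
invFact-deriv : ∀ k → deriv invFact k ≡ invFact k
invFact-deriv k = begin
  s ℚ.* i′                    ≡⟨ ℚₚ.*-identityʳ _ ⟨
  s ℚ.* i′ ℚ.* 1ℚ             ≡⟨ cong (s ℚ.* i′ ℚ.*_) (natℚ-inverse (k !) {{ℕₚ._!≢0 k}}) ⟨
  s ℚ.* i′ ℚ.* (f ℚ.* i)      ≡⟨ solve 4 (λ s j f i → s :* j :* (f :* i) := s :* f :* j :* i) refl s i′ f i ⟩
  s ℚ.* f ℚ.* i′ ℚ.* i        ≡⟨ cong (λ t → t ℚ.* i′ ℚ.* i) (natℚ-homo-* (suc k) (k !)) ⟨
  natℚ (suc k !) ℚ.* i′ ℚ.* i ≡⟨ cong (ℚ._* i) (natℚ-inverse (suc k !) {{ℕₚ._!≢0 (suc k)}}) ⟩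
  1ℚ ℚ.* i                    ≡⟨ ℚₚ.*-identityˡ i ⟩
  i                           ∎
  where
  open ≡-Reasoning
  open import Algebra.Solver.Ring.NaturalCoefficients.Default (CommutativeRing.commutativeSemiring ℚₚ.+-*-commutativeRing)
  s = natℚ (suc k)
  f = natℚ (k !)
  i = invFact k
  i′ = invFact (suc k)

altC : ℕ → ℚ
altC zero    = 1ℚ
altC (suc k) = ℚ.- altC k

logC : ℕ → ℚ
logC zero    = 0ℚ
logC (suc k) = altC k ℚ.* (ℤ.+ 1 ℚ./ suc k)

altC-suc : ∀ k → altC (suc k) ≡ (ℚ.- 1ℚ) ℚ.* altC k
altC-suc k = ≡.sym (≡.trans (≡.sym (ℚₚ.neg-distribˡ-* 1ℚ (altC k))) (cong ℚ.-_ (ℚₚ.*-identityˡ (altC k))))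

logC-deriv : ∀ k → deriv logC k ≡ altC k
logC-deriv k = begin
  s ℚ.* (altC k ℚ.* i)   ≡⟨ ℚₚ.*-comm s _ ⟩
  altC k ℚ.* i ℚ.* s     ≡⟨ ℚₚ.*-assoc (altC k) i s ⟩
  altC k ℚ.* (i ℚ.* s)   ≡⟨ cong (altC k ℚ.*_) (≡.trans (ℚₚ.*-comm i s) (natℚ-inverse (suc k))) ⟩
  altC k ℚ.* 1ℚ          ≡⟨ ℚₚ.*-identityʳ _ ⟩
  altC k                 ∎
  where
  open ≡-Reasoning
  s = natℚ (suc k)
  i = ℤ.+ 1 ℚ./ suc k

-- The coefficients of log1pS, and the signs in them, are functions local to its definition, without a name in
-- scope. The metavariables below are solved by them: abstracting over the multiplication makes the goal
-- rigid, and abstracting over suc k separates the two arguments of the sign function.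
summand : ∀ n x {f} → x ≡ sumℚ n f → ℕ → ℚ
summand n x {f} _ = f

mutual
  log1pSign : ℕ → ℕ → ℚ
  log1pSign = _

  log1pS-summand : ∀ f a b c k →
    summand (a ℕ.+ b ℕ.+ c) (log1pS f a b c) refl k ≡ logC k ℚ.* powS f k a b c
  log1pS-summand f a b c zero       = refl
  log1pS-summand f a b c (suc zero) = refl
  log1pS-summand f a b c (suc (suc k)) with ℤ.+ 1 ℚ./ suc (suc k) | powS f (suc (suc k)) a b c
  ... | i | p with suc k | ℚ._*_
  ...   | n | _·_ = cong (λ t → ((ℚ.- t) · i) · p) (log1pSign≡altC n k)

  log1pSign≡altC : ∀ n k → log1pSign n k ≡ altC k
  log1pSign≡altC n zero    = refl
  log1pSign≡altC n (suc k) = cong ℚ.-_ (log1pSign≡altC n k)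

log1pS≡seriesS : ∀ f → log1pS f 𝔸.≈ seriesS logC f
log1pS≡seriesS f a b c = sumℚ-cong (a ℕ.+ b ℕ.+ c) (λ k _ → log1pS-summand f a b c k)

-- The closed form as an expression in the ring

powS-agree : ∀ {U f g} → DownClosed U → Agree U f g → ∀ k → Agree U (powS f k) (powS g k)
powS-agree U↓ e zero    a b c u = refl
powS-agree {U} {f} {g} U↓ e (suc k) a b c u = begin
  (f *S powS f k) a b c     ≡⟨ *S≈* f (powS f k) a b c ⟩
  (f 𝔸.* powS f k) a b c    ≡⟨ *-agree U↓ e (powS-agree U↓ e k) a b c u ⟩
  (g 𝔸.* powS g k) a b c    ≡⟨ *S≈* g (powS g k) a b c ⟨
  (g *S powS g k) a b c     ∎
  where open ≡-Reasoning

seriesS-agree : ∀ {U f g r s} → DownClosed U → (∀ k → r k ≡ s k) → Agree U f g → Agree U (seriesS r f) (seriesS s g)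
seriesS-agree U↓ e e′ a b c u =
  sumℚ-cong (a ℕ.+ b ℕ.+ c) (λ k _ → cong₂ ℚ._*_ (e k) (powS-agree U↓ e′ k a b c u))

Everywhere : Region
Everywhere _ _ _ = ⊤

seriesS-cong : ∀ {r s f g} → (∀ k → r k ≡ s k) → f 𝔸.≈ g → seriesS r f 𝔸.≈ seriesS s g
seriesS-cong e e′ a b c = seriesS-agree {Everywhere} (record { down = λ _ _ _ _ → tt }) e (λ a b c _ → e′ a b c) a
    b c tt

seriesS-zero : ∀ r → seriesS r 𝔸.0# 𝔸.≈ K (r 0)
seriesS-zero r a b c = ≡.trans (go (a ℕ.+ b ℕ.+ c)) (const a b c)
  where
  open ≡-Reasoning
  pow : ∀ k → powS 𝔸.0# (suc k) a b c ≡ 0ℚ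
  pow k = ≡.trans (*S≈* 𝔸.0# (powS 𝔸.0# k) a b c) (𝔸.zeroˡ (powS 𝔸.0# k) a b c)
  go : ∀ n → sumℚ n (λ k → r k ℚ.* powS 𝔸.0# k a b c) ≡ r 0 ℚ.* oneS a b c
  go zero    = refl
  go (suc n) = begin
    sumℚ n (λ k → r k ℚ.* powS 𝔸.0# k a b c) ℚ.+ r (suc n) ℚ.* powS 𝔸.0# (suc n) a b c
      ≡⟨ cong₂ ℚ._+_ (go n) (≡.trans (cong (r (suc n) ℚ.*_) (pow n)) (ℚₚ.*-zeroʳ (r (suc n)))) ⟩
    r 0 ℚ.* oneS a b c ℚ.+ 0ℚ
      ≡⟨ ℚₚ.+-identityʳ _ ⟩
    r 0 ℚ.* oneS a b c
      ∎
  const : ∀ a b c → r 0 ℚ.* oneS a b c ≡ K (r 0) a b c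
  const zero    zero    zero    = ℚₚ.*-identityʳ (r 0)
  const zero    zero    (suc c) = ℚₚ.*-zeroʳ (r 0)
  const zero    (suc b) c       = ℚₚ.*-zeroʳ (r 0)
  const (suc a) b       c       = ℚₚ.*-zeroʳ (r 0)

minus-cong : ∀ {f f′ g g′} → f 𝔸.≈ f′ → g 𝔸.≈ g′ → f 𝔸.- g 𝔸.≈ f′ 𝔸.- g′
minus-cong e e′ a b c = cong₂ ℚ._-_ (e a b c) (e′ a b c)

_⟨≈⟩_ : ∀ {f g h} → f 𝔸.≈ g → g 𝔸.≈ h → f 𝔸.≈ h
(e ⟨≈⟩ e′) a b c = ≡.trans (e a b c) (e′ a b c)

infixr 5 _⟨≈⟩_

*-cong-≈ : ∀ {f f′ g g′} → f 𝔸.≈ f′ → g 𝔸.≈ g′ → f *S g 𝔸.≈ f′ 𝔸.* g′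
*-cong-≈ {f} {f′} {g} {g′} e e′ a b c = ≡.trans (*S≈* f g a b c) (𝔸.*-cong {f} {f′} {g} {g′} e e′ a b c)

scaleS-cong : ∀ r {f g} → f 𝔸.≈ g → scaleS r f 𝔸.≈ K r 𝔸.* g
scaleS-cong r {f} {g} e a b c = ≡.trans (cong (r ℚ.*_) (e a b c)) (scaleS≈K r g a b c)

-- The hypothesis expresses that the constant term is nonzero. In both applications this term is -1,
-- and the equation holds by computation.
invS-inverse : ∀ g → recipQ (g 0 0 0) ℚ.* g 0 0 0 ≡ 1ℚ → g 𝔸.* invS g 𝔸.≈ 𝔸.1#
invS-inverse g eq a b d = ≡.trans
  (𝔸.*-congˡ {g} {invS g} {K c 𝔸.* seriesS (λ _ → 1ℚ) (𝔸.1# 𝔸.- K c 𝔸.* g)}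
    (scaleS-cong c {seriesS (λ _ → 1ℚ) (oneS -S scaleS c g)} (seriesS-cong {λ _ → 1ℚ} {λ _ → 1ℚ}
        {oneS -S scaleS c g} (λ _ → refl)
      (minus-cong {oneS} {𝔸.1#} {scaleS c g} (constS≈K 1ℚ) (scaleS≈K c g)))) a b d)
  (Substitution.S-inverse 𝒮 g c (λ _ → 1ℚ) (≡.trans (cong (λ t → 1ℚ ℚ.- t) eq) (ℚₚ.+-inverseʳ 1ℚ)) refl
      (λ _ → refl) a b d)
  where c = recipQ (g 0 0 0)

-- The primed series repeat the local definitions of `closedForm` with the operations of the
-- statement; their unprimed counterparts from `Construction` use the ring operations.
x-1′ exponent′ denominator′ base′ logarithm′ power′ : PS
x-1′ = xS -S oneS
exponent′ = scaleS (ℤ.+ 2 ℚ./ 1) (zS *S x-1′)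
denominator′ = xS -S expS exponent′
base′ = x-1′ *S invS denominator′
logarithm′ = log1pS (base′ -S oneS)
power′ = qS *S scaleS (ℤ.+ 1 ℚ./ 2) logarithm′

open ClosedForm.Construction 𝒮 X 𝐳 𝐪 two (K (ℤ.+ 1 ℚ./ 2)) (invS denominator′) invFact logC
  renaming (u to exponent; H to denominator; G to base; L to logarithm; V to power; m to x-1)

x-1′≈x-1 : x-1′ 𝔸.≈ x-1
x-1′≈x-1 = minus-cong {xS} {X} {oneS} xS≈X (constS≈K 1ℚ)

exponent′≈exponent : exponent′ 𝔸.≈ exponent
exponent′≈exponent = scaleS-cong (ℤ.+ 2 ℚ./ 1) {zS *S x-1′} {𝐳 𝔸.* x-1} (*-cong-≈ {zS} {𝐳} {x-1′} {x-1} zS≈𝐳 x-1′≈x-1)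

denominator′≈denominator : denominator′ 𝔸.≈ denominator
denominator′≈denominator = minus-cong {xS} {X} {expS exponent′} {seriesS invFact exponent} xS≈X
    (seriesS-cong {invFact} {invFact} {exponent′} {exponent} (λ _ → refl) exponent′≈exponent)

base′≈base : base′ 𝔸.≈ base
base′≈base = *-cong-≈ {x-1′} {x-1} {invS denominator′} {invS denominator′} x-1′≈x-1 (λ _ _ _ → refl)

base′-1≈base-1 : base′ -S oneS 𝔸.≈ base 𝔸.- 𝔸.1#
base′-1≈base-1 = minus-cong {base′} {base} {oneS} base′≈base (constS≈K 1ℚ)

logarithm′≈logarithm : logarithm′ 𝔸.≈ logarithm
logarithm′≈logarithm = log1pS≡seriesS (base′ -S oneS) ⟨≈⟩ seriesS-cong {logC} {logC} {base′ -S oneS}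
    {base 𝔸.- 𝔸.1#} (λ _ → refl) base′-1≈base-1

power′≈power : power′ 𝔸.≈ power
power′≈power = *-cong-≈ {qS} {𝐪} {scaleS (ℤ.+ 1 ℚ./ 2) logarithm′} {K (ℤ.+ 1 ℚ./ 2) 𝔸.* logarithm} qS≈𝐪
    (scaleS-cong (ℤ.+ 1 ℚ./ 2) {logarithm′} {logarithm} logarithm′≈logarithm)

closedForm≈ : closedForm 𝔸.≈ seriesS invFact power
closedForm≈ = seriesS-cong {invFact} {invFact} {power′} {power} (λ _ → refl) power′≈power

module LinearCombinations {c ℓ} (R : CommutativeRing c ℓ) where
  open CommutativeRing R renaming (refl to ≈-refl)
  open import Algebra.Properties.Ring ring
  open import Relation.Binary.Reasoning.Setoid setoid
  open import Algebra.Solver.Ring.NaturalCoefficients.Default commutativeSemiring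

  -- The values of `𝔻` at the indeterminates: this lemma serves x, where `Θz` vanishes, and
  -- `first-only` serves z, where `Θx` does.
  second-only : ∀ {dz dx x} α u → dz ≈ 0# → dx ≈ x → α * dz + u * dx ≈ x * u
  second-only {dz} {dx} {x} α u ez ex = begin
    α * dz + u * dx   ≈⟨ +-cong (*-congˡ ez) (*-congˡ ex) ⟩
    α * 0# + u * x    ≈⟨ solve 3 (λ α u x → α :* con 0 :+ u :* x   := x :* u) ≈-refl α u x ⟩
    x * u             ∎

  first-only : ∀ {dz dx z} t x u → dz ≈ z → dx ≈ 0# →
    (1# - t * (x * z)) * dz + u * dx + t * (x * (z * z)) ≈ z
  first-only {dz} {dx} {z} t x u ez ex = begin
    (1# - p) * dz + u * dx + t * (x * (z * z))
      ≈⟨ +-congʳ (+-cong (*-congˡ ez) (*-congˡ ex)) ⟩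
    (1# - p) * z + u * 0# + t * (x * (z * z))
      ≈⟨ solve 5 (λ b t x z u → b :* z :+ u :* con 0 :+ t :* (x :* (z :* z)) := (b :+ t :* (x :* z)) :* z) ≈-refl
          (1# - p) t x z u ⟩
    (1# - p + p) * z
      ≈⟨ *-congʳ (trans (+-assoc _ _ _) (trans (+-congˡ (-‿inverseˡ p)) (+-identityʳ 1#))) ⟩
    1# * z
      ≈⟨ *-identityˡ z ⟩
    z
      ∎
    where p = t * (x * z)

open LinearCombinations Pxqz.seriesRing

Θx-X : Θx.δ X 𝔸.≈ X
Θx-X a b c = ≡.trans (Θx-eval X a b c) (go a b c)
  where
  go : ∀ a b c → natℚ a ℚ.* X a b c ≡ X a b c
  go zero          b c = refl
  go (suc zero)    b c = ℚₚ.*-identityˡ (X 1 b c)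
  go (suc (suc a)) b c = ℚₚ.*-zeroʳ (natℚ (suc (suc a)))

Θz-𝐳 : Θz.δ 𝐳 𝔸.≈ 𝐳
Θz-𝐳 a b c = ≡.trans (Θz-eval 𝐳 a b c) (go a b c)
  where
  go : ∀ a b c → natℚ c ℚ.* 𝐳 a b c ≡ 𝐳 a b c
  go zero    zero    zero          = refl
  go zero    zero    (suc zero)    = refl
  go zero    zero    (suc (suc c)) = ℚₚ.*-zeroʳ (natℚ (suc (suc c)))
  go zero    (suc b) c             = ℚₚ.*-zeroʳ (natℚ c)
  go (suc a) b       c             = ℚₚ.*-zeroʳ (natℚ c)

X-z : ∀ a b c → X a b (suc c) ≡ 0ℚ
X-z zero          b       c = refl
X-z (suc zero)    zero    c = refl
X-z (suc zero)    (suc b) c = refl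
X-z (suc (suc a)) b       c = refl

𝐪-z : ∀ a b c → 𝐪 a b (suc c) ≡ 0ℚ
𝐪-z zero    zero          c = refl
𝐪-z zero    (suc zero)    c = refl
𝐪-z zero    (suc (suc b)) c = refl
𝐪-z (suc a) b             c = refl

denominator-inverse : denominator 𝔸.* invS denominator′ 𝔸.≈ 𝔸.1#
denominator-inverse = 𝔸.*-congʳ {invS denominator′} {denominator} {denominator′}
    (𝔸.sym {denominator′} {denominator} denominator′≈denominator) ⟨≈⟩ invS-inverse denominator′ refl

[x-1]⁻¹ : PS
[x-1]⁻¹ = invS x-1

open Equation
  (𝔻-K (ℤ.+ 2 ℚ./ 1)) (𝔻-K (ℤ.+ 1 ℚ./ 2))
  (λ a b c → ≡.sym (K-homo-* (ℤ.+ 1 ℚ./ 2) (ℤ.+ 2 ℚ./ 1) a b c))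
  (second-only {Θz.δ X} {Θx.δ X} {X} (𝔸.1# 𝔸.- two 𝔸.* (X 𝔸.* 𝐳)) exponent (Θz-const X X-z) Θx-X)
  (first-only {Θz.δ 𝐳} {Θx.δ 𝐳} {𝐳} two X exponent Θz-𝐳 (Θx-const _))
  (𝔻-const {𝐪} (Θx-const _) (Θz-const 𝐪 𝐪-z))
  denominator-inverse
  [x-1]⁻¹ (invS-inverse x-1 refl)
  -- The last three `refl` compute the constant terms of `exponent`, `base − 1` and `power`, which
  -- have to vanish for the substitutions.
  invFact-deriv altC logC-deriv refl altC-suc refl refl refl
  public using (δ-closedForm)

-- Values at z = 0

AtZero : Region
AtZero _ _ c = c ≡ 0

AtZero-down : DownClosed AtZero
AtZero-down .DownClosed.down _ _ c′≤c refl = ℕₚ.n≤0⇒n≡0 c′≤c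

_⟨~⟩_ : ∀ {U f g h} → Agree U f g → Agree U g h → Agree U f h
(e ⟨~⟩ e′) a b c in-U = ≡.trans (e a b c in-U) (e′ a b c in-U)

everywhere : ∀ {U f g} → f 𝔸.≈ g → Agree U f g
everywhere e a b c _ = e a b c

exponent-initial : Agree AtZero exponent 𝔸.0#
exponent-initial = _⟨~⟩_ {f = exponent} {two 𝔸.* 𝔸.0#}
  (*-agree {f = two} {two} {𝐳 𝔸.* x-1} {𝔸.0#} AtZero-down (everywhere {f = two} (λ _ _ _ → refl)) vanish)
  (everywhere (𝔸.zeroʳ two))
  where
  vanish : Agree AtZero (𝐳 𝔸.* x-1) 𝔸.0#
  vanish a b .0 refl = 𝐳-eval0 x-1 a b

seriesS-initial : ∀ r {f} → Agree AtZero f 𝔸.0# → Agree AtZero (seriesS r f) (K (r 0))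
seriesS-initial r {f} e = _⟨~⟩_ {f = seriesS r f} {seriesS r 𝔸.0#}
  (seriesS-agree {r = r} {r} AtZero-down (λ _ → refl) e) (everywhere (seriesS-zero r))

denominator-initial : Agree AtZero denominator x-1
denominator-initial a b c in-U = cong (λ t → X a b c ℚ.- t) (seriesS-initial invFact exponent-initial a b c in-U)

-- At z = 0 the exponential is 1, so the numerator x - 1 may be replaced by `denominator`, and
-- `base` becomes `denominator` times its inverse.
base-initial : Agree AtZero (base 𝔸.- 𝔸.1#) 𝔸.0#
base-initial a b c in-U = ≡.trans (cong (ℚ._- 𝔸.1# a b c) (base~1 a b c in-U)) (ℚₚ.+-inverseʳ (𝔸.1# a b c))
  where
  base~1 : Agree AtZero base 𝔸.1#
  base~1 = _⟨~⟩_ {f = base} {denominator 𝔸.* invS denominator′}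
    (*-agree {f = x-1} {denominator} {invS denominator′} {invS denominator′} AtZero-down
        (λ a b c in-U → ≡.sym (denominator-initial a b c in-U)) (λ _ _ _ _ → refl))
    (everywhere denominator-inverse)

power-initial : Agree AtZero power 𝔸.0#
power-initial = _⟨~⟩_ {f = power} {𝐪 𝔸.* 𝔸.0#}
  (*-agree {f = 𝐪} {𝐪} {h 𝔸.* logarithm} {𝔸.0#} AtZero-down (λ _ _ _ _ → refl)
      (_⟨~⟩_ {f = h 𝔸.* logarithm} {h 𝔸.* 𝔸.0#}
    (*-agree {f = h} {h} {logarithm} {𝔸.0#} AtZero-down (λ _ _ _ _ → refl)
      (λ a b c in-U → ≡.trans (seriesS-initial logC {base 𝔸.- 𝔸.1#} base-initial a b c in-U) (K-homo-0 a b c)))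
    (everywhere (𝔸.zeroʳ h))))
  (everywhere (𝔸.zeroʳ 𝐪))
  where h = K (ℤ.+ 1 ℚ./ 2)

F : PS
F = seriesS invFact power

F-initial : Agree AtZero F 𝔸.1#
F-initial = seriesS-initial invFact {power} power-initial

-- The recurrence and the differential equation, coefficient by coefficient

up : {A : Set} → A → (ℕ → A) → ℕ → A
up z f zero    = z
up z f (suc n) = f n

module PolynomialIdentity {c ℓ} (R : CommutativeRing c ℓ) where
  open CommutativeRing R renaming (refl to ≈-refl)
  open import Algebra.Properties.Ring ring
  open import Relation.Binary.Reasoning.Setoid setoid
  open import Algebra.Solver.Ring.NaturalCoefficients.Default commutativeSemiring

  expand : ∀ q k x t n p d →
    (q + k * x) * p + (t * (x * (1# + n * x))) * d ≈ q * p + (k * (x * p) + (t * (x * d) + n * (t * (x * (x * d)))))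
  expand q k x t n p d = solve 7 (λ q k x t n p d →
    (q :+ k :* x) :* p :+ (t :* (x :* (con 1 :+ n :* x))) :* d
      := q :* p :+ (k :* (x :* p) :+ (t :* (x :* d) :+ n :* (t :* (x :* (x :* d)))))) ≈-refl q k x t n p d

  -- In the result everything on the right carries the factor z, which makes it a recursion in the
  -- degree of z. The differences 1 - w, x - 1 and t r - t x r are introduced by `cancel` and then
  -- treated as single variables.
  solve-for-Θz : ∀ t x z q p r f → (1# - t * (x * z)) * p + (t * (z * (x - 1#))) * r ≈ z * q * f →
    p ≈ z * (q * f + (t * (x * p) + (t * r - t * (x * r))))
  solve-for-Θz t x z q p r f e = +-cancelʳ (z * (t * (x * r))) _ _ (begin
    p + z * (t * (x * r))
      ≈⟨ +-cong p-split xr-split ⟩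
    (1# - w) * p + w * p + (z * (t * ((x - 1#) * r)) + z * (t * r))
      ≈⟨ solve 7 (λ b w p z t m r → b :* p :+ w :* p :+ (z :* (t :* (m :* r)) :+ z :* (t :* r))
           := (b :* p :+ (t :* (z :* m)) :* r) :+ (w :* p :+ z :* (t :* r))) ≈-refl (1# - w) w p z t (x - 1#) r ⟩
    (1# - w) * p + (t * (z * (x - 1#))) * r + (w * p + z * (t * r))
      ≈⟨ +-congʳ e ⟩
    z * q * f + (w * p + z * (t * r))
      ≈⟨ +-congˡ (+-congˡ (*-congˡ tr-split)) ⟩
    z * q * f + (w * p + z * (t * r - t * (x * r) + t * (x * r)))
      ≈⟨ solve 8 (λ z q f t x p r y → z :* q :* f :+ (t :* (x :* z) :* p :+ z :* (y :+ t :* (x :* r)))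
           := z :* (q :* f :+ (t :* (x :* p) :+ y)) :+ z :* (t :* (x :* r))) ≈-refl z q f t x p r
               (t * r - t * (x * r)) ⟩
    z * (q * f + (t * (x * p) + (t * r - t * (x * r)))) + z * (t * (x * r))
      ∎)
    where
    w = t * (x * z)
    cancel : ∀ a b → a ≈ a - b + b
    cancel a b = sym (trans (+-assoc a (- b) b) (trans (+-congˡ (-‿inverseˡ b)) (+-identityʳ a)))
    p-split : p ≈ (1# - w) * p + w * p
    p-split = trans (sym (*-identityˡ p)) (trans (*-congʳ (cancel 1# w)) (distribʳ p _ _))
    xr-split : z * (t * (x * r)) ≈ z * (t * ((x - 1#) * r)) + z * (t * r)
    xr-split = begin
      z * (t * (x * r))                          ≈⟨ *-congˡ (*-congˡ (*-congʳ (cancel x 1#))) ⟩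
      z * (t * ((x - 1# + 1#) * r))
        ≈⟨ solve 4 (λ z t m r → z :* (t :* ((m :+ con 1) :* r)) := z :* (t :* (m :* r)) :+ z :* (t :* r)) ≈-refl z
            t (x - 1#) r ⟩
      z * (t * ((x - 1#) * r)) + z * (t * r)     ∎
    tr-split : t * r ≈ t * r - t * (x * r) + t * (x * r)
    tr-split = cancel (t * r) (t * (x * r))

module Pq  = PowerSeries ℤₚ.+-*-commutativeRing
module Pxq = PowerSeries Pq.seriesRing
module 𝔹 = CommutativeRing Pxq.seriesRing

*P≈* : ∀ p r → p *P r 𝔹.≈ p 𝔹.* r
*P≈* p r i j = ≡.sym (≡.trans (atₓ i _ j) (sumℤ-cong i (λ a → at_q j _)))
  where
  at_q : ∀ n F → Pq.∑ n F ≡ sumℤ n F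
  at_q zero    F = refl
  at_q (suc n) F = cong (ℤ._+ F (suc n)) (at_q n F)
  atₓ : ∀ n F j → Pxq.∑ n F j ≡ sumℤ n (λ i → F i j)
  atₓ zero    F j = refl
  atₓ (suc n) F j = cong (ℤ._+ F (suc n) j) (atₓ n F j)
  sumℤ-cong : ∀ n {f g : ℕ → ℤ} → (∀ k → f k ≡ g k) → sumℤ n f ≡ sumℤ n g
  sumℤ-cong zero    e = e 0
  sumℤ-cong (suc n) e = cong₂ ℤ._+_ (sumℤ-cong n e) (e (suc n))

*P-cong : ∀ {p p′ r r′} → p 𝔹.≈ p′ → r 𝔹.≈ r′ → p *P r 𝔹.≈ p′ 𝔹.* r′
*P-cong {p} {p′} {r} {r′} e e′ i j = ≡.trans (*P≈* p r i j) (𝔹.*-cong {p} {p′} {r} {r′} e e′ i j)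

Kℤ : ℤ → Poly
Kℤ k = Pxq.C (Pq.C k)

xℤ qℤ : Poly
xℤ = Pxq.indet
qℤ = Pxq.C Pq.indet

constP≈ : ∀ k → constP k 𝔹.≈ Kℤ k
constP≈ k zero    zero    = refl
constP≈ k zero    (suc j) = refl
constP≈ k (suc i) j       = refl

xP≈ : xP 𝔹.≈ xℤ
xP≈ zero          j       = refl
xP≈ (suc zero)    zero    = refl
xP≈ (suc zero)    (suc j) = refl
xP≈ (suc (suc i)) j       = refl

qP≈ : qP 𝔹.≈ qℤ
qP≈ zero    zero          = refl
qP≈ zero    (suc zero)    = refl
qP≈ zero    (suc (suc j)) = refl
qP≈ (suc i) j             = refl

Kℤ-eval : ∀ k p i j → (Kℤ k 𝔹.* p) i j ≡ k ℤ.* p i j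
Kℤ-eval k p i j = ≡.trans (Pxq.C-⊛ _ p i j) (Pq.C-⊛ k (p i) j)

xℤ-eval : ∀ p i j → (xℤ 𝔹.* p) i j ≡ up 0ℤ (λ i → p i j) i
xℤ-eval p zero    j = CommutativeRing.zeroˡ Pq.seriesRing (p 0) j
xℤ-eval p (suc i) j = Pxq.indet-⊛-suc p i j

qℤ-eval : ∀ p i j → (qℤ 𝔹.* p) i j ≡ up 0ℤ (p i) j
qℤ-eval p i zero    = Pxq.C-⊛ Pq.indet p i 0
qℤ-eval p i (suc j) = ≡.trans (Pxq.C-⊛ Pq.indet p i (suc j)) (Pq.indet-⊛-suc (p i) j)

xdx : Poly → Poly
xdx p i j = + i ℤ.* p i j

x-dxP : ∀ p i j → (xℤ 𝔹.* dxP p) i j ≡ xdx p i j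
x-dxP p zero    j = xℤ-eval (dxP p) 0 j
x-dxP p (suc i) j = xℤ-eval (dxP p) (suc i) j

-- The coefficients of q p + 2n x p + 2 x p′ - 2 x² p′. One factor x is always absorbed into the
-- derivative, since x p′ leaves the exponents in place.
step : ℕ → Poly → Poly
step n p i j = up 0ℤ (p i) j ℤ.+ (+ (2 ℕ.* n) ℤ.* up 0ℤ (λ i → p i j) i
  ℤ.+ (+ 2 ℤ.* xdx p i j ℤ.+ -1ℤ ℤ.* (+ 2 ℤ.* up 0ℤ (λ i → xdx p i j) i)))

rhs≈step : ∀ n p →
  ((qP +P (constP (+ (2 ℕ.* n)) *P xP)) *P p)
    +P ((constP (+ 2) *P (xP *P (constP (+ 1) +P (constP -1ℤ *P xP)))) *P dxP p)
  𝔹.≈ step n p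
rhs≈step n p i j = begin
  (((qP +P (constP (+ (2 ℕ.* n)) *P xP)) *P p)
    +P ((constP (+ 2) *P (xP *P (constP (+ 1) +P (constP -1ℤ *P xP)))) *P dxP p)) i j
    ≡⟨ cong₂ ℤ._+_
      (*P-cong {qP +P (constP (+ (2 ℕ.* n)) *P xP)} {qℤ 𝔹.+ k 𝔹.* xℤ} {p} {p}
        (λ i j → cong₂ ℤ._+_ (qP≈ i j) (*P-cong {constP (+ (2 ℕ.* n))} {k} {xP} {xℤ} (constP≈ _) xP≈ i j))
        (λ _ _ → refl) i j)
      (*P-cong {constP (+ 2) *P (xP *P (constP (+ 1) +P (constP -1ℤ *P xP)))}
          {t 𝔹.* (xℤ 𝔹.* (𝔹.1# 𝔹.+ neg 𝔹.* xℤ))} {d} {d}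
        (*P-cong {constP (+ 2)} {t} {xP *P (constP (+ 1) +P (constP -1ℤ *P xP))} {xℤ 𝔹.* (𝔹.1# 𝔹.+ neg 𝔹.* xℤ)}
            (constP≈ _)
          (*P-cong {xP} {xℤ} {constP (+ 1) +P (constP -1ℤ *P xP)} {𝔹.1# 𝔹.+ neg 𝔹.* xℤ} xP≈
            (λ i j → cong₂ ℤ._+_ (constP≈ (+ 1) i j) (*P-cong {constP -1ℤ} {neg} {xP} {xℤ} (constP≈ _) xP≈ i j))))
        (λ _ _ → refl) i j) ⟩
  ((qℤ 𝔹.+ k 𝔹.* xℤ) 𝔹.* p 𝔹.+ (t 𝔹.* (xℤ 𝔹.* (𝔹.1# 𝔹.+ neg 𝔹.* xℤ))) 𝔹.* d) i j
    ≡⟨ PolynomialIdentity.expand Pxq.seriesRing qℤ k xℤ t neg p d i j ⟩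
  (qℤ 𝔹.* p 𝔹.+ (k 𝔹.* (xℤ 𝔹.* p) 𝔹.+ (t 𝔹.* (xℤ 𝔹.* d) 𝔹.+ neg 𝔹.* (t 𝔹.* (xℤ 𝔹.* (xℤ 𝔹.* d)))))) i j
    ≡⟨ cong₂ ℤ._+_ (qℤ-eval p i j) (cong₂ ℤ._+_
         (≡.trans (Kℤ-eval _ (xℤ 𝔹.* p) i j) (cong (+ (2 ℕ.* n) ℤ.*_) (xℤ-eval p i j)))
         (cong₂ ℤ._+_ (≡.trans (Kℤ-eval _ (xℤ 𝔹.* d) i j) (cong (+ 2 ℤ.*_) (x-dxP p i j)))
           (≡.trans (Kℤ-eval _ (t 𝔹.* (xℤ 𝔹.* (xℤ 𝔹.* d))) i j) (cong (-1ℤ ℤ.*_)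
             (≡.trans (Kℤ-eval _ (xℤ 𝔹.* (xℤ 𝔹.* d)) i j) (cong (+ 2 ℤ.*_) (xxd i))))))) ⟩
  step n p i j ∎
  where
  open ≡-Reasoning
  d = dxP p
  k = Kℤ (+ (2 ℕ.* n))
  t = Kℤ (+ 2)
  neg = Kℤ -1ℤ
  xxd : ∀ i → (xℤ 𝔹.* (xℤ 𝔹.* d)) i j ≡ up 0ℤ (λ i → xdx p i j) i
  xxd zero    = xℤ-eval (xℤ 𝔹.* d) 0 j
  xxd (suc i) = ≡.trans (xℤ-eval (xℤ 𝔹.* d) (suc i) j) (x-dxP p i j)

2ℚ : ℚ
2ℚ = + 2 ℚ./ 1

-- The equation 𝔻 f = z q f is equivalent to Θz f = z Φ f, which determines f from its part of degree 0 in z.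
Φ : PS → PS
Φ f = 𝐪 𝔸.* f 𝔸.+ (two 𝔸.* (X 𝔸.* Θz.δ f) 𝔸.+ (two 𝔸.* Θx.δ f 𝔸.- two 𝔸.* (X 𝔸.* Θx.δ f)))

Φ-agree : ∀ {U f g} → DownClosed U → Agree U f g → Agree U (Φ f) (Φ g)
Φ-agree {U} {f} {g} U↓ e = +-agree {f = 𝐪 𝔸.* f} {𝐪 𝔸.* g} (times 𝐪 {f} {g} e)
  (+-agree {f = two 𝔸.* (X 𝔸.* Θz.δ f)} {two 𝔸.* (X 𝔸.* Θz.δ g)} (times two (times X z-agree))
  (λ a b c u → cong₂ ℚ._-_ (times two {Θx.δ f} {Θx.δ g} x-agree a b c u)
      (times two {X 𝔸.* Θx.δ f} {X 𝔸.* Θx.δ g} (times X x-agree) a b c u)))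
  where
  times : ∀ h {f g} → Agree U f g → Agree U (h 𝔸.* f) (h 𝔸.* g)
  times h {f} {g} e = *-agree {f = h} {h} {f} {g} U↓ (λ _ _ _ _ → refl) e
  z-agree : Agree U (Θz.δ f) (Θz.δ g)
  z-agree = Θz-agree {f = f} {g} e
  x-agree : Agree U (Θx.δ f) (Θx.δ g)
  x-agree = Θx-agree {f = f} {g} e

natℚ-cancel : ∀ n {x y} → natℚ (suc n) ℚ.* x ≡ natℚ (suc n) ℚ.* y → x ≡ y
natℚ-cancel n {x} {y} e = ≡.trans (≡.sym (undo x)) (≡.trans (cong (i ℚ.*_) e) (undo y))
  where
  i = + 1 ℚ./ suc n
  undo : ∀ x → i ℚ.* (natℚ (suc n) ℚ.* x) ≡ x
  undo x = ≡.trans (≡.sym (ℚₚ.*-assoc i (natℚ (suc n)) x)) (≡.trans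
    (cong (ℚ._* x) (≡.trans (ℚₚ.*-comm i (natℚ (suc n))) (natℚ-inverse (suc n)))) (ℚₚ.*-identityˡ x))

Degree_z≤ : ℕ → Region
Degree_z≤ n _ _ c = c ℕ.≤ n

-- In degree c of z, `Φ f` depends only on the degrees of `f` up to c. So z times `Φ f` determines
-- degree c + 1 of `Θz f`, which is that of `f` multiplied by c + 1, a unit of ℚ.
Φ-unique : ∀ {f g} → Θz.δ f 𝔸.≈ 𝐳 𝔸.* Φ f → Θz.δ g 𝔸.≈ 𝐳 𝔸.* Φ g → Agree AtZero f g → f 𝔸.≈ g
Φ-unique {f} {g} ef eg e₀ a b c = go c a b c ℕₚ.≤-refl
  where
  -- All exponents of x and q are treated at once, because `Φ` mixes them.
  go : ∀ n → Agree (Degree_z≤ n) f g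
  go n a b zero _ = e₀ a b 0 refl
  go (suc n) a b (suc c) (s≤s c≤n) = natℚ-cancel c (begin
    natℚ (suc c) ℚ.* f a b (suc c)  ≡⟨ Θz-eval f a b (suc c) ⟨
    Θz.δ f a b (suc c)              ≡⟨ ef a b (suc c) ⟩
    (𝐳 𝔸.* Φ f) a b (suc c)         ≡⟨ 𝐳-eval (Φ f) a b c ⟩
    Φ f a b c                       ≡⟨ Φ-agree {Degree_z≤ n} {f} {g} (record { down = λ _ _ → ℕₚ.≤-trans }) (go n)
        a b c c≤n ⟩
    Φ g a b c                       ≡⟨ 𝐳-eval (Φ g) a b c ⟨
    (𝐳 𝔸.* Φ g) a b (suc c)         ≡⟨ eg a b (suc c) ⟨
    Θz.δ g a b (suc c)              ≡⟨ Θz-eval g a b (suc c) ⟩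
    natℚ (suc c) ℚ.* g a b (suc c)  ∎)
    where open ≡-Reasoning

F-Φ : Θz.δ F 𝔸.≈ 𝐳 𝔸.* Φ F
F-Φ = PolynomialIdentity.solve-for-Θz Pxqz.seriesRing two X 𝐳 𝐪 (Θz.δ F) (Θx.δ F) F δ-closedForm

X-eval-up : ∀ f a b c → (X 𝔸.* f) a b c ≡ up 0ℚ (λ a → f a b c) a
X-eval-up f zero    b c = X-eval0 f b c
X-eval-up f (suc a) b c = X-eval f a b c

𝐪-eval-up : ∀ f a b c → (𝐪 𝔸.* f) a b c ≡ up 0ℚ (λ b → f a b c) b
𝐪-eval-up f a zero    c = 𝐪-eval0 f a c
𝐪-eval-up f a (suc b) c = 𝐪-eval f a b c

Φ-eval : ∀ f a b c → Φ f a b c ≡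
  up 0ℚ (λ b → f a b c) b ℚ.+ (2ℚ ℚ.* up 0ℚ (λ a → natℚ c ℚ.* f a b c) a
    ℚ.+ (2ℚ ℚ.* (natℚ a ℚ.* f a b c) ℚ.- 2ℚ ℚ.* up 0ℚ (λ a → natℚ a ℚ.* f a b c) a))
Φ-eval f a b c = cong₂ ℚ._+_ (𝐪-eval-up f a b c) (cong₂ ℚ._+_
  (twice (X 𝔸.* Θz.δ f) (≡.trans (X-eval-up (Θz.δ f) a b c) (up-cong a (λ a → Θz-eval f a b c))))
  (cong₂ ℚ._-_ (twice (Θx.δ f) (Θx-eval f a b c))
    (twice (X 𝔸.* Θx.δ f) (≡.trans (X-eval-up (Θx.δ f) a b c) (up-cong a (λ a → Θx-eval f a b c))))))
  where
  twice : ∀ h {y} → h a b c ≡ y → (two 𝔸.* h) a b c ≡ 2ℚ ℚ.* y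
  twice h e = ≡.trans (K-eval 2ℚ h a b c) (cong (2ℚ ℚ.*_) e)
  up-cong : ∀ n {g h : ℕ → ℚ} → (∀ k → g k ≡ h k) → up 0ℚ g n ≡ up 0ℚ h n
  up-cong zero    e = refl
  up-cong (suc n) e = e n

up-map : ∀ {A B : Set} (φ : A → B) {z w} {f : ℕ → A} {g : ℕ → B} →
  φ z ≡ w → (∀ n → φ (f n) ≡ g n) → ∀ n → φ (up z f n) ≡ up w g n
up-map φ e₀ e zero    = e₀
up-map φ e₀ e (suc n) = e n

-- One formula for all degrees: the separate case of `egfQ` in degree 0 of z is covered by `Q 0 = 1`
-- and `invFact 0 = 1`.
E : PS
E a b c = (Q c a b ℚ./ 1) ℚ.* invFact c

egfQ≈E : egfQ 𝔸.≈ E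
egfQ≈E zero    zero    zero    = refl
egfQ≈E zero    (suc b) zero    = refl
egfQ≈E (suc a) b       zero    = refl
egfQ≈E a       b       (suc c) = refl

E-initial : Agree AtZero E 𝔸.1#
E-initial zero    zero    .0 refl = refl
E-initial zero    (suc b) .0 refl = refl
E-initial (suc a) b       .0 refl = refl

module ℚ-Identity where
  open CommutativeRing ℚₚ.+-*-commutativeRing using (commutativeSemiring; ring)
  open import Algebra.Properties.Ring ring using (-1*x≈-x)
  open import Algebra.Solver.Ring.NaturalCoefficients.Default commutativeSemiring
  open ≡-Reasoning

  distribute : ∀ A B C D k c w →
    (A ℚ.+ (k ℚ.* c ℚ.* B ℚ.+ (k ℚ.* D ℚ.+ (ℚ.- 1ℚ) ℚ.* (k ℚ.* C)))) ℚ.* w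
    ≡ A ℚ.* w ℚ.+ (k ℚ.* (c ℚ.* (B ℚ.* w)) ℚ.+ (k ℚ.* (D ℚ.* w) ℚ.- k ℚ.* (C ℚ.* w)))
  distribute A B C D k c w = begin
    (A ℚ.+ (k ℚ.* c ℚ.* B ℚ.+ (k ℚ.* D ℚ.+ (ℚ.- 1ℚ) ℚ.* (k ℚ.* C)))) ℚ.* w
      -- The number -1 enters as an eighth variable; `-1*x≈-x` afterwards turns it into the
      -- subtraction found in `Φ-eval`.
      ≡⟨ solve 8 (λ A B C D k c w n → (A :+ (k :* c :* B :+ (k :* D :+ n :* (k :* C)))) :* w
           := A :* w :+ (k :* (c :* (B :* w)) :+ (k :* (D :* w) :+ n :* (k :* (C :* w))))) refl A B C D k c w
               (ℚ.- 1ℚ) ⟩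
    A ℚ.* w ℚ.+ (k ℚ.* (c ℚ.* (B ℚ.* w)) ℚ.+ (k ℚ.* (D ℚ.* w) ℚ.+ (ℚ.- 1ℚ) ℚ.* (k ℚ.* (C ℚ.* w))))
      ≡⟨ cong (λ t → A ℚ.* w ℚ.+ (k ℚ.* (c ℚ.* (B ℚ.* w)) ℚ.+ (k ℚ.* (D ℚ.* w) ℚ.+ t))) (-1*x≈-x (k ℚ.* (C ℚ.* w))) ⟩
    A ℚ.* w ℚ.+ (k ℚ.* (c ℚ.* (B ℚ.* w)) ℚ.+ (k ℚ.* (D ℚ.* w) ℚ.- k ℚ.* (C ℚ.* w)))
      ∎

module GeneratingFunction (recurrence : ∀ n i j → Q (suc n) i j ≡ step n (Q n) i j) where
  open ≡-Reasoning

  step/1 : ∀ n p i j → step n p i j ℚ./ 1 ≡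
    (up 0ℤ (p i) j ℚ./ 1) ℚ.+ (2ℚ ℚ.* natℚ n ℚ.* (up 0ℤ (λ i → p i j) i ℚ./ 1)
      ℚ.+ (2ℚ ℚ.* (natℚ i ℚ.* (p i j ℚ./ 1)) ℚ.+ (ℚ.- 1ℚ) ℚ.* (2ℚ ℚ.* (up 0ℤ (λ i → xdx p i j) i ℚ./ 1))))
  step/1 n p i j = ≡.trans (/1-homo-+ a _) (cong ((a ℚ./ 1) ℚ.+_)
    (≡.trans (/1-homo-+ (+ (2 ℕ.* n) ℤ.* b) _) (cong₂ ℚ._+_
      (≡.trans (/1-homo-* (+ (2 ℕ.* n)) b) (cong (ℚ._* (b ℚ./ 1))
          (≡.trans (≡.sym (natℚ≡/1 (2 ℕ.* n))) (natℚ-homo-* 2 n))))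
      (≡.trans (/1-homo-+ (+ 2 ℤ.* xdx p i j) _) (cong₂ ℚ._+_
        (≡.trans (/1-homo-* (+ 2) (xdx p i j)) (cong (2ℚ ℚ.*_) (xdx/1 i)))
        (≡.trans (/1-homo-* -1ℤ (+ 2 ℤ.* d)) (cong ((ℚ.- 1ℚ) ℚ.*_) (/1-homo-* (+ 2) d))))))))
    where
    a = up 0ℤ (p i) j
    b = up 0ℤ (λ i → p i j) i
    d = up 0ℤ (λ i → xdx p i j) i
    xdx/1 : ∀ i → xdx p i j ℚ./ 1 ≡ natℚ i ℚ.* (p i j ℚ./ 1)
    xdx/1 i = ≡.trans (/1-homo-* (+ i) (p i j)) (cong (ℚ._* (p i j ℚ./ 1)) (≡.sym (natℚ≡/1 i)))

  -- This is the recurrence divided by c!, since (c + 1)/(c + 1)! = 1/c!. The factor n in 2nx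
  -- becomes `Θz`, because n is the exponent of z.
  E-suc : ∀ a b c → natℚ (suc c) ℚ.* E a b (suc c) ≡ Φ E a b c
  E-suc a b c = begin
    natℚ (suc c) ℚ.* ((Q (suc c) a b ℚ./ 1) ℚ.* invFact (suc c))
      ≡⟨ cong (λ t → natℚ (suc c) ℚ.* ((t ℚ./ 1) ℚ.* invFact (suc c))) (recurrence c a b) ⟩
    natℚ (suc c) ℚ.* (s ℚ.* invFact (suc c))
      ≡⟨ ℚₚ.*-assoc (natℚ (suc c)) s (invFact (suc c)) ⟨
    natℚ (suc c) ℚ.* s ℚ.* invFact (suc c)
      ≡⟨ cong (ℚ._* invFact (suc c)) (ℚₚ.*-comm (natℚ (suc c)) s) ⟩
    s ℚ.* natℚ (suc c) ℚ.* invFact (suc c)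
      ≡⟨ ℚₚ.*-assoc s (natℚ (suc c)) (invFact (suc c)) ⟩
    s ℚ.* deriv invFact c
      ≡⟨ cong₂ ℚ._*_ (step/1 c (Q c) a b) (invFact-deriv c) ⟩
    (A ℚ.+ (2ℚ ℚ.* natℚ c ℚ.* B ℚ.+ (2ℚ ℚ.* D ℚ.+ (ℚ.- 1ℚ) ℚ.* (2ℚ ℚ.* C)))) ℚ.* w
      ≡⟨ ℚ-Identity.distribute A B C D 2ℚ (natℚ c) w ⟩
    A ℚ.* w ℚ.+ (2ℚ ℚ.* (natℚ c ℚ.* (B ℚ.* w)) ℚ.+ (2ℚ ℚ.* (D ℚ.* w) ℚ.- 2ℚ ℚ.* (C ℚ.* w)))
      ≡⟨ cong₂ ℚ._+_ (up-map φ zero-φ (λ _ → refl) b) (cong₂ ℚ._+_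
           (cong (2ℚ ℚ.*_) (up-map (λ t → natℚ c ℚ.* φ t) (≡.trans (cong (natℚ c ℚ.*_) zero-φ)
               (ℚₚ.*-zeroʳ (natℚ c))) (λ _ → refl) a))
           (cong₂ ℚ._-_ (cong (2ℚ ℚ.*_) (ℚₚ.*-assoc (natℚ a) (Q c a b ℚ./ 1) w))
             (cong (2ℚ ℚ.*_) (up-map φ zero-φ φ-xdx a)))) ⟩
    up 0ℚ (λ b → E a b c) b ℚ.+ (2ℚ ℚ.* up 0ℚ (λ a → natℚ c ℚ.* E a b c) a
      ℚ.+ (2ℚ ℚ.* (natℚ a ℚ.* E a b c) ℚ.- 2ℚ ℚ.* up 0ℚ (λ a → natℚ a ℚ.* E a b c) a))
      ≡⟨ Φ-eval E a b c ⟨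
    Φ E a b c
      ∎
    where
    s = step c (Q c) a b ℚ./ 1
    w = invFact c
    A = up 0ℤ (Q c a) b ℚ./ 1
    B = up 0ℤ (λ a → Q c a b) a ℚ./ 1
    C = up 0ℤ (λ a → xdx (Q c) a b) a ℚ./ 1
    D = natℚ a ℚ.* (Q c a b ℚ./ 1)
    φ : ℤ → ℚ
    φ t = (t ℚ./ 1) ℚ.* w
    zero-φ : φ 0ℤ ≡ 0ℚ
    zero-φ = ℚₚ.*-zeroˡ w
    φ-xdx : ∀ a → φ (xdx (Q c) a b) ≡ natℚ a ℚ.* E a b c
    φ-xdx a = ≡.trans (cong (ℚ._* w) (≡.trans (/1-homo-* (+ a) (Q c a b))
        (cong (ℚ._* (Q c a b ℚ./ 1)) (≡.sym (natℚ≡/1 a)))))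
      (ℚₚ.*-assoc (natℚ a) (Q c a b ℚ./ 1) w)

  E-Φ : Θz.δ E 𝔸.≈ 𝐳 𝔸.* Φ E
  E-Φ a b zero    = ≡.sym (𝐳-eval0 (Φ E) a b)
  E-Φ a b (suc c) = ≡.trans (Θz-eval E a b (suc c)) (≡.trans (E-suc a b c) (≡.sym (𝐳-eval (Φ E) a b c)))

  egfQ≈closedForm : egfQ 𝔸.≈ closedForm
  egfQ≈closedForm = egfQ≈E ⟨≈⟩ Φ-unique {E} {F} E-Φ F-Φ
    (λ a b c u → ≡.trans (E-initial a b c u) (≡.sym (F-initial a b c u)))
    ⟨≈⟩ 𝔸.sym {closedForm} {F} closedForm≈

-- Boolean tests and bounded quantifiers

∧-true⁻ : ∀ {a b} → a ∧ b ≡ true → a ≡ true × b ≡ true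
∧-true⁻ {true} e = refl , e

∧-true⁺ : ∀ {a b} → a ≡ true → b ≡ true → a ∧ b ≡ true
∧-true⁺ refl e = e

T⇒true : ∀ {b} → T b → b ≡ true
T⇒true {true} _ = refl

true⇒T : ∀ {b} → b ≡ true → T b
true⇒T refl = _

≡ᵇ-refl : ∀ n → (n ≡ᵇ n) ≡ true
≡ᵇ-refl n = T⇒true (ℕₚ.≡⇒≡ᵇ n n refl)

≡ᵇ-true : ∀ m n → (m ≡ᵇ n) ≡ true → m ≡ n
≡ᵇ-true m n e = ℕₚ.≡ᵇ⇒≡ m n (true⇒T e)

≢⇒≡ᵇ-false : ∀ {m n} → m ≢ n → (m ≡ᵇ n) ≡ false
≢⇒≡ᵇ-false {m} {n} m≢n with m ≡ᵇ n in eq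
... | false = refl
... | true  = ⊥-elim (m≢n (≡ᵇ-true m n eq))

<⇒<ᵇ-true : ∀ {m n} → m ℕ.< n → (m <ᵇ n) ≡ true
<⇒<ᵇ-true m<n = T⇒true (ℕₚ.<⇒<ᵇ m<n)

<ᵇ-true : ∀ {m n} → (m <ᵇ n) ≡ true → m ℕ.< n
<ᵇ-true {m} {n} e = ℕₚ.<ᵇ⇒< m n (true⇒T e)

≤⇒≤ᵇ-true : ∀ {m n} → m ℕ.≤ n → (m ≤ᵇ n) ≡ true
≤⇒≤ᵇ-true m≤n = T⇒true (ℕₚ.≤⇒≤ᵇ m≤n)

≤ᵇ-true : ∀ {m n} → (m ≤ᵇ n) ≡ true → m ℕ.≤ n
≤ᵇ-true {m} {n} e = ℕₚ.≤ᵇ⇒≤ m n (true⇒T e)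

module _ {A : Set} {p : A → Bool} where

  all-true⁻ : ∀ xs → all p xs ≡ true → All (λ x → p x ≡ true) xs
  all-true⁻ []       e = []
  all-true⁻ (x ∷ xs) e = let e₁ , e₂ = ∧-true⁻ e in e₁ ∷ all-true⁻ xs e₂

  all-true⁺ : ∀ {xs} → All (λ x → p x ≡ true) xs → all p xs ≡ true
  all-true⁺ []       = refl
  all-true⁺ (e ∷ es) = ∧-true⁺ e (all-true⁺ es)

all-upTo⁻ : ∀ {p : ℕ → Bool} n → all p (upTo n) ≡ true → ∀ {i} → i ℕ.< n → p i ≡ true
all-upTo⁻ n e i<n = All.lookup (all-true⁻ (upTo n) e) (∈ₚ.∈-upTo⁺ i<n)

all-upTo⁺ : ∀ {p : ℕ → Bool} n → (∀ {i} → i ℕ.< n → p i ≡ true) → all p (upTo n) ≡ true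
all-upTo⁺ n e = all-true⁺ (All.tabulate (λ i∈ → e (∈ₚ.∈-upTo⁻ i∈)))

-- Occurrences of letters

occ-∷-≡ : ∀ v w → occ v (v ∷ w) ≡ suc (occ v w)
occ-∷-≡ v w rewrite ≡ᵇ-refl v = refl

occ-∷-≢ : ∀ {x v} w → x ≢ v → occ v (x ∷ w) ≡ occ v w
occ-∷-≢ w x≢v rewrite ≢⇒≡ᵇ-false x≢v = refl

occ-++ : ∀ v u w → occ v (u ++ w) ≡ occ v u ℕ.+ occ v w
occ-++ v []      w = refl
occ-++ v (x ∷ u) w with x ≡ᵇ v
... | true  = cong suc (occ-++ v u w)
... | false = occ-++ v u w

occ-∈ : ∀ {v w} → v ∈ w → 1 ℕ.≤ occ v w
occ-∈ {v} {_ ∷ w} (here refl) rewrite occ-∷-≡ v w = s≤s z≤n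
occ-∈ {v} {x ∷ w} (there v∈w) with x ≡ᵇ v
... | true  = s≤s z≤n
... | false = occ-∈ v∈w

occ-∉ : ∀ {v w} → v ∉ w → occ v w ≡ 0
occ-∉ {v} {[]}    v∉ = refl
occ-∉ {v} {x ∷ w} v∉ = ≡.trans (occ-∷-≢ {x} w (λ { refl → v∉ (here refl) })) (occ-∉ (λ v∈ → v∉ (there v∈)))

occ-zero : ∀ {v w} → occ v w ≡ 0 → v ∉ w
occ-zero {v} {w} e v∈ with occ v w | occ-∈ v∈
occ-zero () v∈ | .(suc _) | s≤s _

occ-suc : ∀ v w {k} → occ v w ≡ suc k → v ∈ w
occ-suc v (x ∷ w) e with x ℕ.≟ v
... | yes refl = here refl
... | no x≢v   = there (occ-suc v w (≡.trans (≡.sym (occ-∷-≢ w x≢v)) e))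

twice : Bool → ℕ
twice b = if b then 2 else 0

-- The multiplicity of `v` in {1, 1, ..., n, n}, by recursion on n so that passing to n + 1 adds the
-- same `twice` term as inserting two copies of n + 1.
mult : ℕ → ℕ → ℕ
mult zero    v = 0
mult (suc n) v = twice (suc n ≡ᵇ v) ℕ.+ mult n v

mult-above : ∀ n {v} → n ℕ.< v → mult n v ≡ 0
mult-above zero    n<v = refl
mult-above (suc n) {v} n<v rewrite ≢⇒≡ᵇ-false (ℕₚ.<⇒≢ n<v) = mult-above n (ℕₚ.<-trans (ℕₚ.n<1+n n) n<v)

mult-zero : ∀ n → mult n 0 ≡ 0
mult-zero zero    = refl
mult-zero (suc n) = mult-zero n

mult-within : ∀ {n i} → i ℕ.< n → mult n (suc i) ≡ 2
mult-within {suc n} {i} (s≤s i≤n) with n ℕ.≟ i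
... | yes refl rewrite ≡ᵇ-refl n = cong (2 ℕ.+_) (mult-above n (ℕₚ.n<1+n n))
... | no n≢i   rewrite ≢⇒≡ᵇ-false n≢i = mult-within (ℕₚ.≤∧≢⇒< i≤n (λ { refl → n≢i refl }))

-- Insertion of two adjacent copies of a letter

data Insertion (N : ℕ) : List ℕ → List ℕ → Set where
  here  : ∀ {r} → Insertion N r (N ∷ N ∷ r)
  there : ∀ {a r w} → Insertion N r w → Insertion N (a ∷ r) (a ∷ w)

-- A cycle begins with its minimum, so a largest letter cannot go in front: `inner` keeps the head
-- and leaves one position per letter. `new` applies only at the end of the list because the heads
-- increase.
data CycleInsertion (N : ℕ) : Cycles → Cycles → Set where
  new   : CycleInsertion N [] ((N ∷ N ∷ []) ∷ [])
  inner : ∀ {a r w σ} → Insertion N r w → CycleInsertion N ((a ∷ r) ∷ σ) ((a ∷ w) ∷ σ)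
  later : ∀ {c σ τ} → CycleInsertion N σ τ → CycleInsertion N (c ∷ σ) (c ∷ τ)

occ-NN : ∀ N v w → occ v (N ∷ N ∷ w) ≡ twice (N ≡ᵇ v) ℕ.+ occ v w
occ-NN N v w with N ≡ᵇ v in eq
... | true  rewrite eq = refl
... | false rewrite eq = refl

+-swap : ∀ a b c → a ℕ.+ (b ℕ.+ c) ≡ b ℕ.+ (a ℕ.+ c)
+-swap a b c = ≡.trans (≡.sym (ℕₚ.+-assoc a b c)) (≡.trans (cong (ℕ._+ c) (ℕₚ.+-comm a b)) (ℕₚ.+-assoc b a c))

occ-insertion : ∀ {N r w} v → Insertion N r w → occ v w ≡ twice (N ≡ᵇ v) ℕ.+ occ v r
occ-insertion {N} {r} v here = occ-NN N v r
occ-insertion {N} {a ∷ r} v (there i) with a ≡ᵇ v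
... | true  = ≡.trans (cong suc (occ-insertion v i)) (≡.sym (ℕₚ.+-suc (twice (N ≡ᵇ v)) (occ v r)))
... | false = occ-insertion v i

occ-cycleInsertion : ∀ {N σ τ} v → CycleInsertion N σ τ → occ v (concat τ) ≡ twice (N ≡ᵇ v) ℕ.+ occ v (concat σ)
occ-cycleInsertion {N} v new = occ-NN N v []
occ-cycleInsertion {N} v (inner {a} {r} {w} {σ} i) = begin
  occ v ((a ∷ w) ++ concat σ)                                ≡⟨ occ-++ v (a ∷ w) (concat σ) ⟩
  occ v (a ∷ w) ℕ.+ occ v (concat σ)                         ≡⟨ cong (ℕ._+ occ v (concat σ))
      (occ-insertion v (there {a = a} i)) ⟩
  twice (N ≡ᵇ v) ℕ.+ occ v (a ∷ r) ℕ.+ occ v (concat σ)      ≡⟨ ℕₚ.+-assoc (twice (N ≡ᵇ v)) (occ v (a ∷ r))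
      (occ v (concat σ)) ⟩
  twice (N ≡ᵇ v) ℕ.+ (occ v (a ∷ r) ℕ.+ occ v (concat σ))    ≡⟨ cong (twice (N ≡ᵇ v) ℕ.+_)
      (occ-++ v (a ∷ r) (concat σ)) ⟨
  twice (N ≡ᵇ v) ℕ.+ occ v ((a ∷ r) ++ concat σ)             ∎
  where open ≡-Reasoning
occ-cycleInsertion {N} v (later {c} {σ} {τ} i) = begin
  occ v (c ++ concat τ)                               ≡⟨ occ-++ v c (concat τ) ⟩
  occ v c ℕ.+ occ v (concat τ)                        ≡⟨ cong (occ v c ℕ.+_) (occ-cycleInsertion v i) ⟩
  occ v c ℕ.+ (twice (N ≡ᵇ v) ℕ.+ occ v (concat σ))   ≡⟨ +-swap (occ v c) (twice (N ≡ᵇ v)) _ ⟩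
  twice (N ≡ᵇ v) ℕ.+ (occ v c ℕ.+ occ v (concat σ))   ≡⟨ cong (twice (N ≡ᵇ v) ℕ.+_) (occ-++ v c (concat σ)) ⟨
  twice (N ≡ᵇ v) ℕ.+ occ v (c ++ concat σ)            ∎
  where open ≡-Reasoning

-- betweenGreater v w, once the first copy of v has been read.
tailGreater : ℕ → List ℕ → Bool
tailGreater v w = all (λ u → v <ᵇ u) (takeWhileᵇ (λ u → not (u ≡ᵇ v)) w)

tailGreater-∷-≡ : ∀ v w → tailGreater v (v ∷ w) ≡ true
tailGreater-∷-≡ v w rewrite ≡ᵇ-refl v = refl

tailGreater-∷-≢ : ∀ {x v} w → x ≢ v → tailGreater v (x ∷ w) ≡ (v <ᵇ x) ∧ tailGreater v w
tailGreater-∷-≢ w x≢v rewrite ≢⇒≡ᵇ-false x≢v = refl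

betweenGreater-∷-≡ : ∀ v w → betweenGreater v (v ∷ w) ≡ tailGreater v w
betweenGreater-∷-≡ v w rewrite ≡ᵇ-refl v = refl

betweenGreater-∷-≢ : ∀ {x v} w → x ≢ v → betweenGreater v (x ∷ w) ≡ betweenGreater v w
betweenGreater-∷-≢ w x≢v rewrite ≢⇒≡ᵇ-false x≢v = refl

betweenGreater-∉ : ∀ {v} w → v ∉ w → betweenGreater v w ≡ true
betweenGreater-∉ []      v∉ = refl
betweenGreater-∉ (x ∷ w) v∉ =
  ≡.trans (betweenGreater-∷-≢ {x} w (λ { refl → v∉ (here refl) })) (betweenGreater-∉ w (λ v∈ → v∉ (there v∈)))

-- A larger letter neither ends the search for the second `v` nor violates the comparison with `v`,
-- so the two copies are invisible to the test.
tailGreater-insertion : ∀ {N v r w} → v ℕ.< N → Insertion N r w → tailGreater v w ≡ tailGreater v r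
tailGreater-insertion {N} {v} {r} v<N here
  rewrite tailGreater-∷-≢ {N} {v} (N ∷ r) (ℕₚ.>⇒≢ v<N) | tailGreater-∷-≢ {N} {v} r (ℕₚ.>⇒≢ v<N) | <⇒<ᵇ-true v<N = refl
tailGreater-insertion {N} {v} v<N (there {a} {r} {w} i) with a ℕ.≟ v
... | yes refl = ≡.trans (tailGreater-∷-≡ a w) (≡.sym (tailGreater-∷-≡ a r))
... | no a≢v   = ≡.trans (tailGreater-∷-≢ w a≢v) (≡.trans
  (cong ((v <ᵇ a) ∧_) (tailGreater-insertion v<N i)) (≡.sym (tailGreater-∷-≢ r a≢v)))

betweenGreater-insertion : ∀ {N v r w} → v ℕ.< N → Insertion N r w → betweenGreater v w ≡ betweenGreater v r
betweenGreater-insertion {N} {v} {r} v<N here =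
  ≡.trans (betweenGreater-∷-≢ (N ∷ r) (ℕₚ.>⇒≢ v<N)) (betweenGreater-∷-≢ r (ℕₚ.>⇒≢ v<N))
betweenGreater-insertion {N} {v} v<N (there {a} {r} {w} i) with a ℕ.≟ v
... | yes refl = ≡.trans (betweenGreater-∷-≡ a w) (≡.trans (tailGreater-insertion v<N i)
    (≡.sym (betweenGreater-∷-≡ a r)))
... | no a≢v   = ≡.trans (betweenGreater-∷-≢ w a≢v) (≡.trans (betweenGreater-insertion v<N i)
    (≡.sym (betweenGreater-∷-≢ r a≢v)))

betweenGreater-inserted : ∀ {N r w} → N ∉ r → Insertion N r w → betweenGreater N w ≡ true
betweenGreater-inserted {N} {r} N∉ here = ≡.trans (betweenGreater-∷-≡ N (N ∷ r)) (tailGreater-∷-≡ N r)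
betweenGreater-inserted N∉ (there {a} {w = w} i) =
  ≡.trans (betweenGreater-∷-≢ {a} w (λ { refl → N∉ (here refl) })) (betweenGreater-inserted (λ N∈ → N∉ (there N∈)) i)

headIsMin-insertion : ∀ {N a r w} → a ℕ.< N → Insertion N r w → headIsMin (a ∷ w) ≡ headIsMin (a ∷ r)
headIsMin-insertion {N} {a} a<N here rewrite ≤⇒≤ᵇ-true (ℕₚ.<⇒≤ a<N) = refl
headIsMin-insertion {N} {a} a<N (there {b} i) = cong ((a ≤ᵇ b) ∧_) (headIsMin-insertion a<N i)

-- Validity of a cycle and of a permutation, free of booleans and of red

record ValidCycle (n : ℕ) (c : List ℕ) : Set where
  constructor validCycle
  field
    even    : ∀ v → occ v c ≡ 0 ⊎ occ v c ≡ 2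
    headMin : headIsMin c ≡ true
    -- Asked of every letter up to `n`; for letters absent from the cycle it holds by
    -- `betweenGreater-∉`.
    between : ∀ v → v ℕ.≤ n → betweenGreater v c ≡ true
open ValidCycle

record Valid (n : ℕ) (σ : Cycles) : Set where
  constructor valid
  field
    cycles     : All (ValidCycle n) σ
    increasing : headsIncreasing σ ≡ true
    letters    : ∀ v → occ v (concat σ) ≡ mult n v
open Valid

Below : ℕ → Cycles → Set
Below N σ = All (All (ℕ._< N)) σ

occ-cycle≤ : ∀ v {c σ} → c ∈ σ → occ v c ℕ.≤ occ v (concat σ)
occ-cycle≤ v {c} {_ ∷ σ} (here refl) rewrite occ-++ v c (concat σ) = ℕₚ.m≤m+n _ _
occ-cycle≤ v {c} {d ∷ σ} (there c∈) rewrite occ-++ v d (concat σ) = ℕₚ.≤-trans (occ-cycle≤ v c∈)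
    (ℕₚ.m≤n+m _ (occ v d))

below : ∀ {N} σ → (∀ v → N ℕ.≤ v → occ v (concat σ) ≡ 0) → Below N σ
below {N} σ absent = All.tabulate (λ c∈σ → All.tabulate (λ {v} v∈c → ℕₚ.≰⇒> (λ N≤v →
  ℕₚ.<⇒≱ (occ-∈ v∈c) (ℕₚ.≤-trans (occ-cycle≤ v c∈σ) (ℕₚ.≤-reflexive (absent v N≤v))))))

valid-below : ∀ {n σ} → Valid n σ → Below (suc n) σ
valid-below {n} {σ} V = below σ (λ v n<v → ≡.trans (letters V v) (mult-above n n<v))

below-∉ : ∀ {N c} → All (ℕ._< N) c → N ∉ c
below-∉ c<N N∈ = ℕₚ.<-irrefl refl (All.lookup c<N N∈)

-- An insertion never changes a head, and the head `N` of a new cycle exceeds the preceding one.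
-- `headIsMin` serves to exclude empty cycles.
headsIncreasing-insertion : ∀ {N σ τ} → CycleInsertion N σ τ → Below N σ →
  All (λ c → headIsMin c ≡ true) σ → headsIncreasing τ ≡ headsIncreasing σ
headsIncreasing-insertion new _ _ = refl
headsIncreasing-insertion (inner {σ = []} i) _ _ = refl
headsIncreasing-insertion (inner {σ = [] ∷ σ} i) _ _ = refl
headsIncreasing-insertion (inner {σ = (b ∷ c) ∷ σ} i) _ _ = refl
headsIncreasing-insertion (later {[]} i) _ (() ∷ _)
headsIncreasing-insertion {N} (later {a ∷ c} new) ((a<N ∷ _) ∷ _) _ rewrite <⇒<ᵇ-true a<N = refl
headsIncreasing-insertion (later {a ∷ c} (inner {b} i)) (_ ∷ p) (_ ∷ q) = cong ((a <ᵇ b) ∧_)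
    (headsIncreasing-insertion (inner i) p q)
headsIncreasing-insertion (later {a ∷ c} (later {b ∷ d} i)) (_ ∷ p) (_ ∷ q) = cong ((a <ᵇ b) ∧_)
    (headsIncreasing-insertion (later i) p q)
headsIncreasing-insertion (later {a ∷ c} (later {[]} i)) _ (_ ∷ () ∷ _)

validCycle-suc : ∀ {n c} → All (ℕ._< suc n) c → ValidCycle n c → ValidCycle (suc n) c
validCycle-suc {n} {c} c<N (validCycle e h b) = validCycle e h b′
  where
  b′ : ∀ v → v ℕ.≤ suc n → betweenGreater v c ≡ true
  b′ v v≤ with ℕₚ.m≤n⇒m<n∨m≡n v≤
  ... | inj₁ (s≤s v≤n) = b v v≤n
  ... | inj₂ refl      = betweenGreater-∉ c (below-∉ c<N)

valid-insertion : ∀ {n σ τ} → CycleInsertion (suc n) σ τ → Valid n σ → Valid (suc n) τ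
valid-insertion {n} {σ} {τ} i V = valid (go i (valid-below V) (cycles V))
  (≡.trans (headsIncreasing-insertion i (valid-below V) (All.map headMin (cycles V))) (increasing V))
  (λ v → ≡.trans (occ-cycleInsertion v i) (cong (twice (suc n ≡ᵇ v) ℕ.+_) (letters V v)))
  where
  N = suc n
  NN-even : ∀ v → occ v (N ∷ N ∷ []) ≡ 0 ⊎ occ v (N ∷ N ∷ []) ≡ 2
  NN-even v rewrite occ-NN N v [] with N ≡ᵇ v
  ... | true  = inj₂ refl
  ... | false = inj₁ refl
  NN-between : ∀ v → v ℕ.≤ N → betweenGreater v (N ∷ N ∷ []) ≡ true
  NN-between v v≤N with ℕₚ.m≤n⇒m<n∨m≡n v≤N
  ... | inj₁ v<N  = betweenGreater-insertion v<N here
  ... | inj₂ refl = betweenGreater-inserted {N} {[]} (λ ()) here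
  go : ∀ {σ τ} → CycleInsertion N σ τ → Below N σ → All (ValidCycle n) σ → All (ValidCycle N) τ
  go new _ _ = validCycle NN-even (∧-true⁺ (≤⇒≤ᵇ-true (ℕₚ.≤-refl {N})) refl) NN-between ∷ []
  go (later i) (c<N ∷ σ<N) (c ∷ cs) = validCycle-suc c<N c ∷ go i σ<N cs
  go (inner {a} {r} {w} i) ((a<N ∷ r<N) ∷ σ<N) (c ∷ cs) =
    validCycle even′ (≡.trans (headIsMin-insertion a<N i) (headMin c)) between′
    ∷ All.zipWith (λ (p , q) → validCycle-suc p q) (σ<N , cs)
    where
    even′ : ∀ v → occ v (a ∷ w) ≡ 0 ⊎ occ v (a ∷ w) ≡ 2
    even′ v with N ℕ.≟ v
    ... | yes refl rewrite occ-insertion N (there {a = a} i) | ≡ᵇ-refl N | occ-∉ (below-∉ (a<N ∷ r<N)) = inj₂ refl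
    ... | no N≢v   rewrite occ-insertion v (there {a = a} i) | ≢⇒≡ᵇ-false N≢v = even c v
    between′ : ∀ v → v ℕ.≤ N → betweenGreater v (a ∷ w) ≡ true
    between′ v v≤N with ℕₚ.m≤n⇒m<n∨m≡n v≤N
    ... | inj₁ (s≤s v≤n) = ≡.trans (betweenGreater-insertion (s≤s v≤n) (there {a = a} i)) (between c v v≤n)
    ... | inj₂ refl      = betweenGreater-inserted (below-∉ (a<N ∷ r<N)) (there {a = a} i)

valid-deletion : ∀ {n σ τ} → CycleInsertion (suc n) σ τ → Valid (suc n) τ → Valid n σ
valid-deletion {n} {σ} {τ} i V = valid cs
  (≡.trans (≡.sym (headsIncreasing-insertion i σ<N (All.map headMin cs))) (increasing V)) letters′
  where
  N = suc n
  letters′ : ∀ v → occ v (concat σ) ≡ mult n v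
  letters′ v = ℕₚ.+-cancelˡ-≡ (twice (N ≡ᵇ v)) _ _ (≡.trans (≡.sym (occ-cycleInsertion v i)) (letters V v))
  -- This follows from the multiplicities alone, before any cycle of σ is known to be valid.
  σ<N : Below N σ
  σ<N = below σ (λ v n<v → ≡.trans (letters′ v) (mult-above n n<v))
  weaken : ∀ {c} → ValidCycle N c → ValidCycle n c
  weaken (validCycle e h b) = validCycle e h (λ v v≤n → b v (ℕₚ.m≤n⇒m≤1+n v≤n))
  go : ∀ {σ τ} → CycleInsertion N σ τ → Below N σ → All (ValidCycle N) τ → All (ValidCycle n) σ
  go new _ _ = []
  go (later i) (_ ∷ σ<N) (c ∷ cs) = weaken c ∷ go i σ<N cs
  go (inner {a} {r} {w} i) ((a<N ∷ r<N) ∷ σ<N) (c ∷ cs) =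
    validCycle even′ (≡.trans (≡.sym (headIsMin-insertion a<N i)) (headMin c))
      (λ v v≤n → ≡.trans (≡.sym (betweenGreater-insertion (s≤s v≤n) (there {a = a} i)))
          (between c v (ℕₚ.m≤n⇒m≤1+n v≤n)))
    ∷ All.map weaken cs
    where
    even′ : ∀ v → occ v (a ∷ r) ≡ 0 ⊎ occ v (a ∷ r) ≡ 2
    even′ v with N ℕ.≟ v | even c v
    ... | yes refl | _ = inj₁ (occ-∉ (below-∉ (a<N ∷ r<N)))
    ... | no N≢v   | e rewrite occ-insertion v (there {a = a} i) | ≢⇒≡ᵇ-false N≢v = e
  cs : All (ValidCycle n) σ
  cs = go i σ<N (cycles V)

-- If the letter after the first `N` were not `N`, the test would force it to exceed `N`, the
-- maximum. That there is a letter after it comes from the second copy.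
word-insertion : ∀ {N} w → All (ℕ._≤ N) w → occ N w ≡ 2 → betweenGreater N w ≡ true → ∃[ r ] Insertion N r w
word-insertion {N} (x ∷ w) (x≤N ∷ w≤N) o b with x ℕ.≟ N
... | no x≢N = let r , i = word-insertion w w≤N (≡.trans (≡.sym (occ-∷-≢ {x} w x≢N)) o) (≡.trans (≡.sym (betweenGreater-∷-≢ {x} w x≢N)) b)
               in x ∷ r , there i
word-insertion {N} (.N ∷ []) _ o b | yes refl = ⊥-elim (ℕₚ.0≢1+n
    (ℕₚ.suc-injective (≡.trans (≡.sym (occ-∷-≡ N [])) o)))
word-insertion {N} (.N ∷ y ∷ w) (_ ∷ y≤N ∷ _) o b | yes refl with y ℕ.≟ N
... | yes refl = w , here
... | no y≢N   = ⊥-elim (ℕₚ.<⇒≱ (<ᵇ-true (proj₁ (∧-true⁻ (≡.trans (≡.sym (tailGreater-∷-≢ {y} w y≢N))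
    (≡.trans (≡.sym (betweenGreater-∷-≡ N (y ∷ w))) b))))) y≤N)

headsIncreasing-tail : ∀ a c σ → headsIncreasing ((a ∷ c) ∷ σ) ≡ true → headsIncreasing σ ≡ true
headsIncreasing-tail a c []            _ = refl
headsIncreasing-tail a c ((b ∷ d) ∷ σ) e = proj₂ (∧-true⁻ e)

-- All entries lie between the head, which is the minimum, and the maximum `N`; the multiplicity
-- then fixes the length.
maximal-cycle : ∀ {N} w → All (ℕ._≤ N) w → headIsMin (N ∷ w) ≡ true → occ N (N ∷ w) ≡ 2 → w ≡ N ∷ []
maximal-cycle {N} w w≤N h o = only w (constant w w≤N (all-true⁻ w h))
    (ℕₚ.suc-injective (≡.trans (≡.sym (occ-∷-≡ N w)) o))
  where
  constant : ∀ w → All (ℕ._≤ N) w → All (λ u → (N ≤ᵇ u) ≡ true) w → All (_≡ N) w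
  constant w p q = All.zipWith (λ (u≤N , N≤u) → ℕₚ.≤-antisym u≤N (≤ᵇ-true N≤u)) (p , q)
  only : ∀ w → All (_≡ N) w → occ N w ≡ 1 → w ≡ N ∷ []
  only (.N ∷ [])     (refl ∷ _)        o = refl
  only (.N ∷ .N ∷ w) (refl ∷ refl ∷ _) o rewrite ≡ᵇ-refl N | ≡ᵇ-refl N with () ← ℕₚ.suc-injective o

-- In the first cycle with copies of `N`, a smaller head leaves them adjacent in the rest. Head `N`
-- makes the cycle (N N), and since heads increase but do not exceed `N`, no cycle can follow: this
-- is the case `new`.
cycle-insertion : ∀ {N} τ → All (ValidCycle N) τ → headsIncreasing τ ≡ true → All (All (ℕ._≤ N)) τ →
  occ N (concat τ) ≡ 2 → ∃[ σ ] CycleInsertion N σ τ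
cycle-insertion ([] ∷ τ) (validCycle _ () _ ∷ _)
cycle-insertion {N} ((a ∷ w) ∷ τ) (c ∷ cs) inc (c≤N ∷ τ≤N) o with even c N
... | inj₁ none = let σ , i = cycle-insertion τ cs (headsIncreasing-tail a w τ inc) τ≤N
                                (≡.trans (cong (ℕ._+ occ N (concat τ)) (≡.sym none))
                                    (≡.trans (≡.sym (occ-++ N (a ∷ w) (concat τ))) o))
                  in (a ∷ w) ∷ σ , later i
... | inj₂ both with a ℕ.≟ N
...   | no a≢N = let r , i = word-insertion w (All.tail c≤N) (≡.trans (≡.sym (occ-∷-≢ {a} w a≢N)) both)
                               (≡.trans (≡.sym (betweenGreater-∷-≢ {a} w a≢N)) (between c N ℕₚ.≤-refl))
                 in (a ∷ r) ∷ τ , inner i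
...   | yes refl with maximal-cycle w (All.tail c≤N) (headMin c) both
cycle-insertion {N} ((.N ∷ .(N ∷ [])) ∷ []) _ _ _ _ | inj₂ _ | yes refl | refl = [] , new
cycle-insertion {N} ((.N ∷ .(N ∷ [])) ∷ (b ∷ _) ∷ _) _ inc (_ ∷ (b≤N ∷ _) ∷ _) _ | inj₂ _ | yes refl | refl =
  ⊥-elim (ℕₚ.<⇒≱ (<ᵇ-true (proj₁ (∧-true⁻ inc))) b≤N)

valid-is-insertion : ∀ {n τ} → Valid (suc n) τ → ∃[ σ ] CycleInsertion (suc n) σ τ × Valid n σ
valid-is-insertion {n} {τ} V =
  let σ , i = cycle-insertion τ (cycles V) (increasing V) (All.map (All.map ℕ.s≤s⁻¹) (valid-below V))
                (≡.trans (letters V (suc n)) (mult-within {suc n} (ℕₚ.n<1+n n)))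
  in σ , i , valid-deletion i V

-- Double counting and ranks

sum-map-≡ : ∀ k {f : ℕ → ℕ} L → (∀ {v} → v ∈ L → f v ≡ k) → sum (map f L) ≡ length L ℕ.* k
sum-map-≡ k []      e = refl
sum-map-≡ k (v ∷ L) e = cong₂ ℕ._+_ (e (here refl)) (sum-map-≡ k L (λ v∈ → e (there v∈)))

occ-unique : ∀ {v L} → Unique L → v ∈ L → occ v L ≡ 1
occ-unique {v} {_ ∷ L} (v∉ ∷ _) (here refl) =
  ≡.trans (occ-∷-≡ v L) (cong suc (occ-∉ (λ v∈ → All.lookup v∉ v∈ refl)))
occ-unique {v} {x ∷ L} (x∉ ∷ u) (there v∈) = ≡.trans (occ-∷-≢ {x} L (All.lookup x∉ v∈)) (occ-unique u v∈)

sum-occ-∷ : ∀ x w L → sum (map (λ v → occ v (x ∷ w)) L) ≡ occ x L ℕ.+ sum (map (λ v → occ v w) L)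
sum-occ-∷ x w []      = refl
sum-occ-∷ x w (v ∷ L) with v ℕ.≟ x
... | yes refl rewrite ≡ᵇ-refl v = cong suc (≡.trans (cong (occ v w ℕ.+_) (sum-occ-∷ v w L))
    (+-swap (occ v w) (occ v L) _))
... | no v≢x   rewrite ≢⇒≡ᵇ-false v≢x | ≢⇒≡ᵇ-false {x} {v} (λ { refl → v≢x refl }) =
  ≡.trans (cong (occ v w ℕ.+_) (sum-occ-∷ x w L)) (+-swap (occ v w) (occ x L) _)

-- Each letter of `w` is counted by exactly one member of the duplicate-free list `L`.
length-sum-occ : ∀ {L} → Unique L → ∀ w → All (_∈ L) w → length w ≡ sum (map (λ v → occ v w) L)
length-sum-occ {L} u [] _ = ≡.sym (≡.trans (sum-map-≡ 0 L (λ _ → refl)) (ℕₚ.*-zeroʳ (length L)))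
length-sum-occ {L} u (x ∷ w) (x∈ ∷ w⊆) = ≡.trans (cong suc (length-sum-occ u w w⊆))
  (≡.sym (≡.trans (sum-occ-∷ x w L) (cong (ℕ._+ _) (occ-unique u x∈))))

length-doubled : ∀ {L} → Unique L → ∀ w → All (_∈ L) w → (∀ {v} → v ∈ L → occ v w ≡ 2) → length w ≡ length L ℕ.+
    length L
length-doubled {L} u w w⊆ e = ≡.trans (length-sum-occ u w w⊆) (≡.trans (sum-map-≡ 2 L e)
  (≡.trans (ℕₚ.*-comm (length L) 2) (cong (length L ℕ.+_) (ℕₚ.+-identityʳ (length L)))))

half-double : ∀ d → half (d ℕ.+ d) ≡ d
half-double zero    = refl
half-double (suc d) rewrite ℕₚ.+-suc d d = cong suc (half-double d)

-- For `L` the list of distinct letters of a word, this is the rank that `red` substitutes for `t`.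
count≤ : ℕ → List ℕ → ℕ
count≤ t L = length (filterᵇ (λ u → u ≤ᵇ t) L)

count≤-bound : ∀ t L → count≤ t L ℕ.≤ length L
count≤-bound t []      = z≤n
count≤-bound t (x ∷ L) with x ≤ᵇ t
... | true  = s≤s (count≤-bound t L)
... | false = ℕₚ.m≤n⇒m≤1+n (count≤-bound t L)

count≤-mono : ∀ {s t} L → s ℕ.≤ t → count≤ s L ℕ.≤ count≤ t L
count≤-mono []      s≤t = z≤n
count≤-mono {s} {t} (x ∷ L) s≤t with x ≤ᵇ s in eq
... | true  rewrite ≤⇒≤ᵇ-true (ℕₚ.≤-trans (≤ᵇ-true {x} eq) s≤t) = s≤s (count≤-mono L s≤t)
... | false with x ≤ᵇ t
...   | true  = ℕₚ.m≤n⇒m≤1+n (count≤-mono L s≤t)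
...   | false = count≤-mono L s≤t

≰⇒≤ᵇ-false : ∀ {m n} → n ℕ.< m → (m ≤ᵇ n) ≡ false
≰⇒≤ᵇ-false {m} {n} n<m with m ≤ᵇ n in eq
... | false = refl
... | true  = ⊥-elim (ℕₚ.<⇒≱ n<m (≤ᵇ-true {m} eq))

count≤-strict : ∀ {s t L} → s ℕ.< t → t ∈ L → count≤ s L ℕ.< count≤ t L
count≤-strict {s} {t} {_ ∷ L} s<t (here refl)
  rewrite ≰⇒≤ᵇ-false s<t | ≤⇒≤ᵇ-true (ℕₚ.≤-refl {t}) = s≤s (count≤-mono L (ℕₚ.<⇒≤ s<t))
count≤-strict {s} {t} {x ∷ L} s<t (there t∈) with x ≤ᵇ s in eq
... | true  rewrite ≤⇒≤ᵇ-true (ℕₚ.≤-trans (≤ᵇ-true {x} eq) (ℕₚ.<⇒≤ s<t)) = s≤s (count≤-strict s<t t∈)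
... | false with x ≤ᵇ t
...   | true  = ℕₚ.m<n⇒m<1+n (count≤-strict s<t t∈)
...   | false = count≤-strict s<t t∈

count≤-positive : ∀ {v L} → v ∈ L → 1 ℕ.≤ count≤ v L
count≤-positive {v} {_ ∷ L} (here refl) rewrite ≤⇒≤ᵇ-true (ℕₚ.≤-refl {v}) = s≤s z≤n
count≤-positive {v} {x ∷ L} (there v∈) with x ≤ᵇ v
... | true  = s≤s z≤n
... | false = count≤-positive v∈

count≤-zero : ∀ L → count≤ 0 L ≡ occ 0 L
count≤-zero []          = refl
count≤-zero (zero ∷ L)  = cong suc (count≤-zero L)
count≤-zero (suc x ∷ L) = count≤-zero L

count≤-suc : ∀ t L → count≤ (suc t) L ≡ occ (suc t) L ℕ.+ count≤ t L
count≤-suc t []      = refl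
count≤-suc t (x ∷ L) with ℕₚ.<-cmp x (suc t)
... | tri< (s≤s x≤t) x≢ _ rewrite ≢⇒≡ᵇ-false x≢ | ≤⇒≤ᵇ-true x≤t | ≤⇒≤ᵇ-true (ℕₚ.m≤n⇒m≤1+n x≤t) =
  ≡.trans (cong suc (count≤-suc t L)) (≡.sym (ℕₚ.+-suc (occ (suc t) L) (count≤ t L)))
... | tri≈ _ refl _ rewrite ≡ᵇ-refl t | ≰⇒≤ᵇ-false (ℕₚ.n<1+n t) | ≤⇒≤ᵇ-true (ℕₚ.≤-refl {suc t}) = cong suc
    (count≤-suc t L)
... | tri> _ x≢ t<x rewrite ≢⇒≡ᵇ-false x≢ | ≰⇒≤ᵇ-false t<x | ≰⇒≤ᵇ-false (ℕₚ.<-trans (ℕₚ.n<1+n t) t<x) = count≤-suc t L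

occ-unique-≤ : ∀ v {L} → Unique L → occ v L ≡ 0 ⊎ v ∈ L × occ v L ≡ 1
occ-unique-≤ v {L} u with occ v L in eq
... | zero  = inj₁ refl
... | suc k = let v∈ = occ-suc v L eq in inj₂ (v∈ , ≡.trans (≡.sym eq) (occ-unique u v∈))

-- A discrete intermediate value argument: since `L` has no duplicates, `count≤ t L` grows by at
-- most 1 with each step of t, and only at members of `L`.
count≤-surjective : ∀ {L} → Unique L → ∀ t {i} → i ℕ.< count≤ t L → ∃[ v ] v ∈ L × count≤ v L ≡ suc i
count≤-surjective {L} u zero {i} i< with occ-unique-≤ 0 u
... | inj₁ e with () ← ≡.subst (i ℕ.<_) (≡.trans (count≤-zero L) e) i<
... | inj₂ (0∈ , e) = 0 , 0∈ , ℕₚ.≤-antisym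
  (ℕₚ.≤-trans (ℕₚ.≤-reflexive (≡.trans (count≤-zero L) e)) (s≤s z≤n)) i<
count≤-surjective {L} u (suc t) {i} i< with occ-unique-≤ (suc t) u
... | inj₁ e = count≤-surjective u t (≡.subst (i ℕ.<_) (≡.trans (count≤-suc t L) (cong (ℕ._+ count≤ t L) e)) i<)
... | inj₂ (t∈ , e) with i ℕ.<? count≤ t L
...   | yes i<′ = count≤-surjective u t i<′
...   | no i≮   = suc t , t∈ , ℕₚ.≤-antisym
  (ℕₚ.≤-trans (ℕₚ.≤-reflexive (≡.trans (count≤-suc t L) (cong (ℕ._+ count≤ t L) e))) (s≤s (ℕₚ.≮⇒≥ i≮))) i<

maximum : List ℕ → ℕ
maximum []      = 0
maximum (x ∷ L) = x ℕ.⊔ maximum L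

count≤-all : ∀ t L → All (ℕ._≤ t) L → count≤ t L ≡ length L
count≤-all t []      []       = refl
count≤-all t (x ∷ L) (p ∷ ps) rewrite ≤⇒≤ᵇ-true p = cong suc (count≤-all t L ps)

≤-maximum : ∀ L → All (ℕ._≤ maximum L) L
≤-maximum []      = []
≤-maximum (x ∷ L) = ℕₚ.m≤m⊔n x (maximum L) ∷ All.map (λ p → ℕₚ.≤-trans p (ℕₚ.m≤n⊔m x (maximum L))) (≤-maximum L)

-- Both `occ v` and `betweenGreater v` see a letter only through its comparison with `v`, so it is
-- enough that `f` preserves these comparisons on the word.
module Relabel (f : ℕ → ℕ) (v : ℕ) where

  Preserves : ℕ → Set
  Preserves u = (f u ≡ᵇ f v) ≡ (u ≡ᵇ v) × (f v <ᵇ f u) ≡ (v <ᵇ u)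

  occ-map : ∀ w → All Preserves w → occ (f v) (map f w) ≡ occ v w
  occ-map []      []             = refl
  occ-map (u ∷ w) ((e , _) ∷ es) rewrite e with u ≡ᵇ v
  ... | true  = cong suc (occ-map w es)
  ... | false = occ-map w es

  tailGreater-map : ∀ w → All Preserves w → tailGreater (f v) (map f w) ≡ tailGreater v w
  tailGreater-map []      []              = refl
  tailGreater-map (u ∷ w) ((e , e′) ∷ es) rewrite e with u ≡ᵇ v
  ... | true  = refl
  ... | false = cong₂ _∧_ e′ (tailGreater-map w es)

  betweenGreater-map : ∀ w → All Preserves w → betweenGreater (f v) (map f w) ≡ betweenGreater v w
  betweenGreater-map []      []             = refl
  betweenGreater-map (u ∷ w) ((e , _) ∷ es) rewrite e with u ≡ᵇ v
  ... | true  = tailGreater-map w es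
  ... | false = betweenGreater-map w es

≮⇒<ᵇ-false : ∀ {m n} → n ℕ.≤ m → (m <ᵇ n) ≡ false
≮⇒<ᵇ-false {m} {n} n≤m with m <ᵇ n in eq
... | false = refl
... | true  = ⊥-elim (ℕₚ.<⇒≱ (<ᵇ-true {m} eq) n≤m)

-- As every letter occurring in the cycle occurs twice, half the length is the number k of distinct
-- letters. The ranks map these onto 1, ..., k and preserve the order, which allows `red` to be
-- removed from the test in both directions.
module Reduction (c : List ℕ) (c-even : ∀ v → occ v c ≡ 0 ⊎ occ v c ≡ 2) where

  distinct : List ℕ
  distinct = deduplicate ℕ._≟_ c

  distinct-unique : Unique distinct
  distinct-unique = deduplicate-! ℕ._≟_ c

  rank : ℕ → ℕ
  rank v = count≤ v distinct

  ∈-distinct⁺ : ∀ {v} → v ∈ c → v ∈ distinct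
  ∈-distinct⁺ = ∈ₚ.∈-deduplicate⁺ ℕ._≟_

  ∈-distinct⁻ : ∀ {v} → v ∈ distinct → v ∈ c
  ∈-distinct⁻ = ∈ₚ.∈-deduplicate⁻ ℕ._≟_ c

  occ-two : ∀ {v} → v ∈ c → occ v c ≡ 2
  occ-two {v} v∈ with c-even v
  ... | inj₁ e = ⊥-elim (occ-zero e v∈)
  ... | inj₂ e = e

  length-c : length c ≡ length distinct ℕ.+ length distinct
  length-c = length-doubled distinct-unique c (All.tabulate ∈-distinct⁺) (λ v∈ → occ-two (∈-distinct⁻ v∈))

  half-length : half (length c) ≡ length distinct
  half-length = ≡.trans (cong half length-c) (half-double (length distinct))

  rank-preserves : ∀ {v} → v ∈ c → All (Relabel.Preserves rank v) c
  rank-preserves {v} v∈ = All.tabulate go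
    where
    go : ∀ {u} → u ∈ c → Relabel.Preserves rank v u
    go {u} u∈ with ℕₚ.<-cmp u v
    ... | tri≈ _ refl _ = ≡.trans (≡ᵇ-refl (rank v)) (≡.sym (≡ᵇ-refl v)) ,
          ≡.trans (≮⇒<ᵇ-false (ℕₚ.≤-refl {rank v})) (≡.sym (≮⇒<ᵇ-false (ℕₚ.≤-refl {v})))
    ... | tri< u<v u≢v _ = let r = count≤-strict u<v (∈-distinct⁺ v∈) in
          ≡.trans (≢⇒≡ᵇ-false (ℕₚ.<⇒≢ r)) (≡.sym (≢⇒≡ᵇ-false u≢v)) ,
          ≡.trans (≮⇒<ᵇ-false (ℕₚ.<⇒≤ r)) (≡.sym (≮⇒<ᵇ-false (ℕₚ.<⇒≤ u<v)))
    ... | tri> _ u≢v v<u = let r = count≤-strict v<u (∈-distinct⁺ u∈) in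
          ≡.trans (≢⇒≡ᵇ-false (ℕₚ.>⇒≢ r)) (≡.sym (≢⇒≡ᵇ-false u≢v)) ,
          ≡.trans (<⇒<ᵇ-true r) (≡.sym (<⇒<ᵇ-true v<u))

  rank-surjective : ∀ {i} → i ℕ.< half (length c) → ∃[ v ] v ∈ c × rank v ≡ suc i
  rank-surjective {i} i< =
    let v , v∈ , e = count≤-surjective distinct-unique (maximum distinct)
          (≡.subst (i ℕ.<_) (≡.trans half-length (≡.sym (count≤-all (maximum distinct) distinct
              (≤-maximum distinct)))) i<)
    in v , ∈-distinct⁻ v∈ , e

  stirling⁺ : (∀ {v} → v ∈ c → betweenGreater v c ≡ true) → isStirling (half (length c)) (red c) ≡ true
  stirling⁺ b = ∧-true⁺ (∧-true⁺ lengths (all-upTo⁺ k occs)) (all-upTo⁺ k betweens)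
    where
    k = half (length c)
    lengths : (length (red c) ℕ.≡ᵇ (k ℕ.+ k)) ≡ true
    lengths rewrite Listₚ.length-map rank c | half-length | length-c = ≡ᵇ-refl (length distinct ℕ.+ length distinct)
    occs : ∀ {i} → i ℕ.< k → (occ (suc i) (red c) ≡ᵇ 2) ≡ true
    occs {i} i< with rank-surjective i<
    ... | v , v∈ , e rewrite ≡.sym e | Relabel.occ-map rank v c (rank-preserves v∈) | occ-two v∈ = refl
    betweens : ∀ {i} → i ℕ.< k → betweenGreater (suc i) (red c) ≡ true
    betweens {i} i< with rank-surjective i<
    ... | v , v∈ , e rewrite ≡.sym e = ≡.trans (Relabel.betweenGreater-map rank v c (rank-preserves v∈)) (b v∈)

  stirling⁻ : isStirling (half (length c)) (red c) ≡ true → ∀ {v} → v ∈ c → betweenGreater v c ≡ true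
  -- `count≤-positive` excludes rank 0, so the rank of `v` lies in the range 1, ..., k covered by
  -- the test.
  stirling⁻ e {v} v∈ with rank v in eq | count≤-positive (∈-distinct⁺ v∈)
  ... | suc i | _ = ≡.trans (≡.sym (Relabel.betweenGreater-map rank v c (rank-preserves v∈)))
    (≡.subst (λ t → betweenGreater t (red c) ≡ true) (≡.sym eq)
      (all-upTo⁻ (half (length c)) (proj₂ (∧-true⁻ {isPermDoubled (half (length c)) (red c)} e))
        (≡.subst₂ ℕ._≤_ eq (≡.sym half-length) (count≤-bound v distinct))))

-- Enumeration of the candidates

module _ {A B : Set} {f : A → List B} where

  ∈-concatMap⁺ : ∀ {x y xs} → x ∈ xs → y ∈ f x → y ∈ concatMap f xs
  ∈-concatMap⁺ {xs = xs} x∈ y∈ = ∈ₚ.∈-concatMap⁺ f {xs = xs} (Any.map (λ { refl → y∈ }) x∈)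

  ∈-concatMap⁻ : ∀ {y} xs → y ∈ concatMap f xs → ∃[ x ] x ∈ xs × y ∈ f x
  ∈-concatMap⁻ xs y∈ = find (∈ₚ.∈-concatMap⁻ f {xs = xs} y∈)

  concatMap-unique : ∀ {xs} → Unique xs → (∀ {x} → x ∈ xs → Unique (f x)) →
    (∀ {x x′ y} → x ∈ xs → x′ ∈ xs → y ∈ f x → y ∈ f x′ → x ≡ x′) → Unique (concatMap f xs)
  concatMap-unique []                       _ _ = []
  concatMap-unique {x ∷ xs} (x∉ ∷ unique) u d = Uniqueₚ.++⁺ (u (here refl))
    (concatMap-unique unique (u ∘ there) (λ x∈ x′∈ → d (there x∈) (there x′∈)))
    (λ (y∈ , y∈′) → let x′ , x′∈ , y∈fx′ = ∈-concatMap⁻ xs y∈′ in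
      All.lookup x∉ x′∈ (d (here refl) (there x′∈) y∈ y∈fx′))

letterList : ℕ → List ℕ
letterList n = map suc (upTo n)

letterList-unique : ∀ n → Unique (letterList n)
letterList-unique n = Uniqueₚ.map⁺ ℕₚ.suc-injective (Uniqueₚ.upTo⁺ n)

length-letterList : ∀ n → length (letterList n) ≡ n
length-letterList n = ≡.trans (Listₚ.length-map suc (upTo n)) (Listₚ.length-upTo n)

∈-letterList⁺ : ∀ {n i} → i ℕ.< n → suc i ∈ letterList n
∈-letterList⁺ i<n = ∈ₚ.∈-map⁺ suc (∈ₚ.∈-upTo⁺ i<n)

∈-letterList⁻ : ∀ {n v} → v ∈ letterList n → ∃[ i ] i ℕ.< n × v ≡ suc i
∈-letterList⁻ {n} v∈ = let i , i∈ , e = ∈ₚ.∈-map⁻ suc v∈ in i , ∈ₚ.∈-upTo⁻ i∈ , e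

∈-words⁺ : ∀ {n} w → All (_∈ letterList n) w → w ∈ words n (length w)
∈-words⁺ []      []         = here refl
∈-words⁺ {n} (v ∷ w) (v∈ ∷ w⊆) with ∈-letterList⁻ v∈
... | i , i<n , refl = ∈-concatMap⁺ (∈ₚ.∈-upTo⁺ i<n) (∈ₚ.∈-map⁺ (suc i ∷_) (∈-words⁺ w w⊆))

∈-words⁻ : ∀ n m {w} → w ∈ words n m → length w ≡ m × All (_∈ letterList n) w
∈-words⁻ n zero (here refl) = refl , []
∈-words⁻ n (suc m) w∈ with ∈-concatMap⁻ {f = λ i → map (suc i ∷_) (words n m)} (upTo n) w∈
... | i , i∈ , w∈′ with ∈ₚ.∈-map⁻ (suc i ∷_) w∈′
...   | w′ , w′∈ , refl = let l , a = ∈-words⁻ n m w′∈ in cong suc l , ∈-letterList⁺ (∈ₚ.∈-upTo⁻ i∈) ∷ a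

words-unique : ∀ n m → Unique (words n m)
words-unique n zero    = [] ∷ []
words-unique n (suc m) = concatMap-unique (Uniqueₚ.upTo⁺ n)
  (λ _ → Uniqueₚ.map⁺ Listₚ.∷-injectiveʳ (words-unique n m))
  (λ {i} {i′} _ _ y∈ y∈′ → heads (∈ₚ.∈-map⁻ (suc i ∷_) y∈) (∈ₚ.∈-map⁻ (suc i′ ∷_) y∈′))
  where
  heads : ∀ {i i′ y} → ∃[ w ] w ∈ words n m × y ≡ suc i ∷ w → ∃[ w ] w ∈ words n m × y ≡ suc i′ ∷ w → i ≡ i′
  heads (_ , _ , refl) (_ , _ , refl) = refl

NonEmpty : List ℕ → Set
NonEmpty c = c ≢ []

SplitOf : List ℕ → Cycles → Set
SplitOf w σ = concat σ ≡ w × All NonEmpty σ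

∈-splits⁻ : ∀ w {σ} → σ ∈ splits w → SplitOf w σ
∈-splits⁻ (a ∷ [])    (here refl) = refl , (λ ()) ∷ []
∈-splits⁻ (a ∷ b ∷ w) σ∈ = extend (λ _ _ → refl) (∈-splits⁻ (b ∷ w))
  (∈ₚ.∈-++⁻ (map (λ σ → (a ∷ []) ∷ σ) (splits (b ∷ w))) σ∈)
  where
  -- Here `f` stands for the anonymous function in `splits` that prepends `a` to the first cycle;
  -- only its value on nonempty lists matters.
  extend : ∀ {f : Cycles → Cycles} {σ} → (∀ c τ → f (c ∷ τ) ≡ (a ∷ c) ∷ τ) →
    (∀ {τ} → τ ∈ splits (b ∷ w) → SplitOf (b ∷ w) τ) →
    σ ∈ map (λ σ → (a ∷ []) ∷ σ) (splits (b ∷ w)) ⊎ σ ∈ map f (splits (b ∷ w)) → SplitOf (a ∷ b ∷ w) σ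
  extend f-∷ ih (inj₁ σ∈) with ∈ₚ.∈-map⁻ _ σ∈
  ... | τ , τ∈ , refl = let e , p = ih τ∈ in cong (a ∷_) e , (λ ()) ∷ p
  extend f-∷ ih (inj₂ σ∈) with ∈ₚ.∈-map⁻ _ σ∈
  ... | τ , τ∈ , refl with τ | ih τ∈
  ...   | []     | () , _
  ...   | c ∷ τ′ | e , _ ∷ p rewrite f-∷ c τ′ = cong (a ∷_) e , (λ ()) ∷ p

∈-splits⁺ : ∀ a c σ → All NonEmpty σ → ((a ∷ c) ∷ σ) ∈ splits (concat ((a ∷ c) ∷ σ))
∈-splits⁺ a []      []            []      = here refl
∈-splits⁺ a []      ([] ∷ σ)      (p ∷ _) = ⊥-elim (p refl)
∈-splits⁺ a []      ((b ∷ d) ∷ σ) (_ ∷ p) = ∈ₚ.∈-++⁺ˡ (∈ₚ.∈-map⁺ _ (∈-splits⁺ b d σ p))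
∈-splits⁺ a (b ∷ c) σ             p       = ∈ₚ.∈-++⁺ʳ (map (λ σ → (a ∷ []) ∷ σ) (splits (b ∷ c ++ concat σ)))
    (∈ₚ.∈-map⁺ _ (∈-splits⁺ b c σ p))

map-unique : ∀ {A B : Set} {P : A → Set} {f : A → B} → (∀ {x y} → P x → P y → f x ≡ f y → x ≡ y) →
  ∀ {L} → All P L → Unique L → Unique (map f L)
map-unique inj []       []       = []
map-unique inj (p ∷ ps) (x∉ ∷ u) =
  Allₚ.map⁺ (All.zipWith (λ (q , x≢y) fx≡fy → x≢y (inj p q fx≡fy)) (ps , x∉)) ∷ map-unique inj ps u

StartsNonEmpty : Cycles → Set
StartsNonEmpty σ = ∃[ b ] ∃[ c ] ∃[ τ ] σ ≡ (b ∷ c) ∷ τ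

splits-starts : ∀ b w {σ} → σ ∈ splits (b ∷ w) → StartsNonEmpty σ
splits-starts b w {σ} σ∈ with σ | ∈-splits⁻ (b ∷ w) σ∈
... | []          | () , _
... | [] ∷ _      | _ , p ∷ _ = ⊥-elim (p refl)
... | (b ∷ c) ∷ τ | _         = b , c , τ , refl

-- The two halves are disjoint: the leading cycle is the single letter `a` in the first, and longer
-- in the second because `splits` yields no empty cycle.
splits-unique : ∀ w → Unique (splits w)
splits-unique []          = []
splits-unique (a ∷ [])    = [] ∷ []
splits-unique (a ∷ b ∷ w) = Uniqueₚ.++⁺ (Uniqueₚ.map⁺ Listₚ.∷-injectiveʳ (splits-unique (b ∷ w)))
  (map-unique (λ { (_ , _ , _ , refl) (_ , _ , _ , refl) refl → refl }) (All.tabulate (splits-starts b w))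
      (splits-unique (b ∷ w)))
  (λ (p , q) → disjoint (λ { (_ , _ , _ , refl) () }) (∈ₚ.∈-map⁻ _ p) (∈ₚ.∈-map⁻ _ q))
  where
  disjoint : ∀ {f : Cycles → Cycles} {σ} → (∀ {τ τ′} → StartsNonEmpty τ → (a ∷ []) ∷ τ′ ≢ f τ) →
    ∃[ τ ] τ ∈ splits (b ∷ w) × σ ≡ (a ∷ []) ∷ τ → ∃[ τ ] τ ∈ splits (b ∷ w) × σ ≡ f τ → ⊥
  disjoint ≢f (_ , _ , e) (_ , τ∈ , e′) = ≢f (splits-starts b w τ∈) (≡.trans (≡.sym e) e′)

-- A splitting determines its word by `concat`, so different words have no splitting in common.
candidates-unique : ∀ n → Unique (candidates n)
candidates-unique n = concatMap-unique (words-unique n (n ℕ.+ n)) (λ {w} _ → splits-unique w)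
  (λ {w} {w′} _ _ y∈ y∈′ → ≡.trans (≡.sym (proj₁ (∈-splits⁻ w y∈))) (proj₁ (∈-splits⁻ w′ y∈′)))

-- The boolean test isStirling2 decides validity

even-absent : ∀ v σ → occ v (concat σ) ≡ 0 → All (λ c → occ v c ≡ 0) σ
even-absent v []      _ = []
even-absent v (c ∷ σ) e = let e′ = ≡.trans (≡.sym (occ-++ v c (concat σ))) e in
  ℕₚ.m+n≡0⇒m≡0 (occ v c) e′ ∷ even-absent v σ (ℕₚ.m+n≡0⇒n≡0 (occ v c) e′)

-- With two copies in all, a cycle holding two of them leaves none for the others.
even-present : ∀ v σ → occ v (concat σ) ≡ 2 → any (λ c → occ v c ≡ᵇ 2) σ ≡ true → All
    (λ c → occ v c ≡ 0 ⊎ occ v c ≡ 2) σ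
even-present v (c ∷ σ) e a with occ v c ℕ.≟ 2
... | yes two = inj₂ two ∷ All.map inj₁ (even-absent v σ
  (ℕₚ.+-cancelˡ-≡ 2 _ _ (≡.trans (cong (ℕ._+ occ v (concat σ)) (≡.sym two))
      (≡.trans (≡.sym (occ-++ v c (concat σ))) e))))
... | no ≢two rewrite ≢⇒≡ᵇ-false ≢two = inj₁ zero-c ∷ even-present v σ
    (≡.trans (cong (ℕ._+ occ v (concat σ)) (≡.sym zero-c)) sum≡2) a
  where
  sum≡2 : occ v c ℕ.+ occ v (concat σ) ≡ 2
  sum≡2 = ≡.trans (≡.sym (occ-++ v c (concat σ))) e
  at-least : ∀ σ → any (λ c → occ v c ≡ᵇ 2) σ ≡ true → 2 ℕ.≤ occ v (concat σ)
  at-least (d ∷ σ) a with occ v d ≡ᵇ 2 in eq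
  ... | true  = ℕₚ.≤-trans (ℕₚ.≤-reflexive (≡.sym (≡ᵇ-true (occ v d) 2 eq))) (occ-cycle≤ v {d} {d ∷ σ} (here refl))
  ... | false = ℕₚ.≤-trans (at-least σ a) (ℕₚ.≤-trans (ℕₚ.m≤n+m _ (occ v d))
      (ℕₚ.≤-reflexive (≡.sym (occ-++ v d (concat σ)))))
  zero-c : occ v c ≡ 0
  zero-c = ℕₚ.n≤0⇒n≡0 (ℕₚ.+-cancelʳ-≤ 2 _ _ (ℕₚ.≤-trans (ℕₚ.+-monoʳ-≤ (occ v c) (at-least σ a))
      (ℕₚ.≤-reflexive sum≡2)))

any-two : ∀ v σ → All (λ c → occ v c ≡ 0 ⊎ occ v c ≡ 2) σ → occ v (concat σ) ≡ 2 → any (λ c → occ v c ≡ᵇ 2) σ ≡ true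
any-two v (c ∷ σ) (inj₂ two ∷ _)   e rewrite two = refl
any-two v (c ∷ σ) (inj₁ none ∷ ev) e rewrite none =
  any-two v σ ev (≡.trans (cong (ℕ._+ occ v (concat σ)) (≡.sym none)) (≡.trans (≡.sym (occ-++ v c (concat σ))) e))

module _ {n : ℕ} {σ : Cycles} where

  -- The occurrence tests concern the letters 1, ..., n; that no others occur is taken from the
  -- hypothesis on `concat σ`, which holds for candidates because their words are written in these
  -- letters.
  isStirling2⇒valid : All (_∈ letterList n) (concat σ) → isStirling2 n σ ≡ true → Valid n σ
  isStirling2⇒valid ⊆ e = valid
    (All.tabulate (λ {c} c∈ → validCycle (even′ c∈) (All.lookup heads c∈) (between′ c∈)))
    (proj₁ e₅) letters′
    where
    e₁ = proj₂ (∧-true⁻ {nonEmpty σ} e)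
    e₂ = ∧-true⁻ {isPermDoubled n (concat σ)} e₁
    e₃ = ∧-true⁻ {all (λ i → any (λ c → occ (suc i) c ≡ᵇ 2) σ) (upTo n)} (proj₂ e₂)
    e₄ = ∧-true⁻ {all headIsMin σ} (proj₂ e₃)
    e₅ = ∧-true⁻ {headsIncreasing σ} (proj₂ e₄)
    heads : All (λ c → headIsMin c ≡ true) σ
    heads = all-true⁻ σ (proj₁ e₄)
    twos : ∀ {i} → i ℕ.< n → occ (suc i) (concat σ) ≡ 2
    twos i<n = ≡ᵇ-true _ 2 (all-upTo⁻ n (proj₂ (∧-true⁻ {length (concat σ) ≡ᵇ (n ℕ.+ n)} (proj₁ e₂))) i<n)
    absent : ∀ v → v ∉ letterList n → occ v (concat σ) ≡ 0
    absent v v∉ = occ-∉ (λ v∈ → v∉ (All.lookup ⊆ v∈))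
    large-∉ : ∀ {i} → i ℕ.≮ n → suc i ∉ letterList n
    large-∉ i≮n v∈ with ∈-letterList⁻ v∈
    ... | i , i<n , refl = i≮n i<n
    zero-∉ : 0 ∉ letterList n
    zero-∉ v∈ with ∈-letterList⁻ v∈
    ... | _ , _ , ()
    letters′ : ∀ v → occ v (concat σ) ≡ mult n v
    letters′ zero = ≡.trans (absent 0 zero-∉) (≡.sym (mult-zero n))
    letters′ (suc i) with i ℕ.<? n
    ... | yes i<n = ≡.trans (twos i<n) (≡.sym (mult-within i<n))
    ... | no i≮n  = ≡.trans (absent (suc i) (large-∉ i≮n)) (≡.sym (mult-above n (s≤s (ℕₚ.≮⇒≥ i≮n))))
    even′ : ∀ {c} → c ∈ σ → ∀ v → occ v c ≡ 0 ⊎ occ v c ≡ 2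
    even′ c∈ zero = inj₁ (All.lookup (even-absent 0 σ (absent 0 zero-∉)) c∈)
    even′ c∈ (suc i) with i ℕ.<? n
    ... | yes i<n = All.lookup (even-present (suc i) σ (twos i<n) (all-upTo⁻ n (proj₁ e₃) i<n)) c∈
    ... | no i≮n  = inj₁ (All.lookup (even-absent (suc i) σ (absent (suc i) (large-∉ i≮n))) c∈)
    between′ : ∀ {c} → c ∈ σ → ∀ v → v ℕ.≤ n → betweenGreater v c ≡ true
    between′ {c} c∈ v _ with even′ c∈ v
    ... | inj₁ none = betweenGreater-∉ c (occ-zero none)
    ... | inj₂ two  = Reduction.stirling⁻ c (even′ c∈) (All.lookup (all-true⁻ σ (proj₂ e₅)) c∈) (occ-suc v c two)

  valid-letters : Valid n σ → All (_∈ letterList n) (concat σ)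
  valid-letters V = All.tabulate go
    where
    go : ∀ {v} → v ∈ concat σ → v ∈ letterList n
    go {zero} v∈ = ⊥-elim (occ-zero (≡.trans (letters V 0) (mult-zero n)) v∈)
    go {suc i} v∈ with i ℕ.<? n
    ... | yes i<n = ∈-letterList⁺ i<n
    ... | no i≮n  = ⊥-elim (occ-zero (≡.trans (letters V (suc i)) (mult-above n (s≤s (ℕₚ.≮⇒≥ i≮n)))) v∈)

  valid-twos : Valid n σ → ∀ {i} → i ℕ.< n → occ (suc i) (concat σ) ≡ 2
  valid-twos V i<n = ≡.trans (letters V _) (mult-within i<n)

  valid-length : Valid n σ → length (concat σ) ≡ n ℕ.+ n
  valid-length V = ≡.trans (length-doubled (letterList-unique n) (concat σ) (valid-letters V)
    (λ v∈ → occ-two (∈-letterList⁻ v∈))) (cong₂ ℕ._+_ (length-letterList n) (length-letterList n))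
    where
    occ-two : ∀ {v} → ∃[ i ] i ℕ.< n × v ≡ suc i → occ v (concat σ) ≡ 2
    occ-two (i , i<n , refl) = valid-twos V i<n

  -- Order 0 is excluded because the empty list is then valid but fails `nonEmpty`.
  valid⇒isStirling2 : 1 ℕ.≤ n → Valid n σ → isStirling2 n σ ≡ true
  valid⇒isStirling2 1≤n V =
    ∧-true⁺ (nonEmpty-σ σ (valid-twos V 1≤n))
    (∧-true⁺ (∧-true⁺ (≡.trans (cong (_≡ᵇ (n ℕ.+ n)) (valid-length V)) (≡ᵇ-refl (n ℕ.+ n)))
               (all-upTo⁺ n (λ i<n → cong (_≡ᵇ 2) (valid-twos V i<n))))
    (∧-true⁺ (all-upTo⁺ n (λ {i} i<n → any-two (suc i) σ (All.map (λ c → even c (suc i)) (cycles V))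
        (valid-twos V i<n)))
    (∧-true⁺ (all-true⁺ (All.map headMin (cycles V)))
    (∧-true⁺ (increasing V)
      (all-true⁺ (All.tabulate (λ {c} c∈ → let C = All.lookup (cycles V) c∈ in
        Reduction.stirling⁺ c (even C) (λ {v} v∈ → between C v (bound v (occ-cycle≤ v c∈) v∈)))))))))
    where
    nonEmpty-σ : ∀ σ → occ 1 (concat σ) ≡ 2 → nonEmpty σ ≡ true
    nonEmpty-σ (_ ∷ _) _ = refl
    bound : ∀ v {c} → occ v c ℕ.≤ occ v (concat σ) → v ∈ c → v ℕ.≤ n
    bound v o v∈ with v ℕ.≤? n
    ... | yes v≤n = v≤n
    ... | no v≰n  = ⊥-elim (ℕₚ.<⇒≱ (occ-∈ v∈) (ℕₚ.≤-trans o (ℕₚ.≤-reflexive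
        (≡.trans (letters V v) (mult-above n (ℕₚ.≰⇒> v≰n))))))

  valid⇒candidate : 1 ℕ.≤ n → Valid n σ → σ ∈ candidates n
  valid⇒candidate 1≤n V = ∈-concatMap⁺
    (≡.subst (λ m → concat σ ∈ words n m) (valid-length V) (∈-words⁺ (concat σ) (valid-letters V)))
    (split σ (valid-twos V 1≤n) (All.map (λ c → nonEmpty-c (headMin c)) (cycles V)))
    where
    nonEmpty-c : ∀ {c} → headIsMin c ≡ true → NonEmpty c
    nonEmpty-c () refl
    split : ∀ σ → occ 1 (concat σ) ≡ 2 → All NonEmpty σ → σ ∈ splits (concat σ)
    split ([] ∷ _)      _ (p ∷ _) = ⊥-elim (p refl)
    split ((a ∷ c) ∷ σ) _ (_ ∷ p) = ∈-splits⁺ a c σ p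

stirling2s : ℕ → List Cycles
stirling2s n = filterᵇ (isStirling2 n) (candidates n)

∈-filterᵇ⁺ : ∀ {A : Set} {p : A → Bool} {x xs} → x ∈ xs → p x ≡ true → x ∈ filterᵇ p xs
∈-filterᵇ⁺ {p = p} x∈ px = ∈ₚ.∈-filter⁺ (λ x → T? (p x)) x∈ (true⇒T px)

∈-filterᵇ⁻ : ∀ {A : Set} {p : A → Bool} {x xs} → x ∈ filterᵇ p xs → x ∈ xs × p x ≡ true
∈-filterᵇ⁻ {p = p} {xs = xs} x∈ = let y , z = ∈ₚ.∈-filter⁻ (λ x → T? (p x)) {xs = xs} x∈ in y , T⇒true z

∈-stirling2s⁺ : ∀ {n σ} → 1 ℕ.≤ n → Valid n σ → σ ∈ stirling2s n
∈-stirling2s⁺ {n} 1≤n V = ∈-filterᵇ⁺ (valid⇒candidate 1≤n V) (valid⇒isStirling2 1≤n V)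

∈-stirling2s⁻ : ∀ {n σ} → σ ∈ stirling2s n → Valid n σ
∈-stirling2s⁻ {n} {σ} σ∈ with ∈-filterᵇ⁻ {p = isStirling2 n} {xs = candidates n} σ∈
... | σ∈′ , e with ∈-concatMap⁻ (words n (n ℕ.+ n)) σ∈′
...   | w , w∈ , σ∈″ = isStirling2⇒valid
  (≡.subst (All (_∈ letterList n)) (≡.sym (proj₁ (∈-splits⁻ w σ∈″))) (proj₂ (∈-words⁻ n (n ℕ.+ n) w∈))) e

stirling2s-unique : ∀ n → Unique (stirling2s n)
stirling2s-unique n = Uniqueₚ.filter⁺ (λ σ → T? (isStirling2 n σ)) (candidates-unique n)

-- Enumeration of the insertions

insertions : ℕ → List ℕ → List (List ℕ)
insertions N []      = (N ∷ N ∷ []) ∷ []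
insertions N (a ∷ r) = (N ∷ N ∷ a ∷ r) ∷ map (a ∷_) (insertions N r)

cycleInsertions : ℕ → Cycles → List Cycles
cycleInsertions N []            = ((N ∷ N ∷ []) ∷ []) ∷ []
cycleInsertions N ([] ∷ σ)      = map ([] ∷_) (cycleInsertions N σ)
cycleInsertions N ((a ∷ r) ∷ σ) = map (λ w → (a ∷ w) ∷ σ) (insertions N r) ++ map ((a ∷ r) ∷_) (cycleInsertions N σ)

∈-insertions⁺ : ∀ {N r w} → Insertion N r w → w ∈ insertions N r
∈-insertions⁺ {r = []}    here      = here refl
∈-insertions⁺ {r = _ ∷ _} here      = here refl
∈-insertions⁺             (there i) = there (∈ₚ.∈-map⁺ _ (∈-insertions⁺ i))

∈-insertions⁻ : ∀ {N} r {w} → w ∈ insertions N r → Insertion N r w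
∈-insertions⁻ []      (here refl) = here
∈-insertions⁻ (a ∷ r) (here refl) = here
∈-insertions⁻ (a ∷ r) (there w∈)  with ∈ₚ.∈-map⁻ _ w∈
... | _ , w′∈ , refl = there (∈-insertions⁻ r w′∈)

∈-cycleInsertions⁺ : ∀ {N σ τ} → CycleInsertion N σ τ → τ ∈ cycleInsertions N σ
∈-cycleInsertions⁺ new                                = here refl
∈-cycleInsertions⁺ (inner i)                          = ∈ₚ.∈-++⁺ˡ (∈ₚ.∈-map⁺ _ (∈-insertions⁺ i))
∈-cycleInsertions⁺ (later {[]} i)                     = ∈ₚ.∈-map⁺ _ (∈-cycleInsertions⁺ i)
∈-cycleInsertions⁺ {N} (later {a ∷ r} {σ} i)          =
  ∈ₚ.∈-++⁺ʳ (map (λ w → (a ∷ w) ∷ σ) (insertions N r)) (∈ₚ.∈-map⁺ _ (∈-cycleInsertions⁺ i))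

∈-cycleInsertions⁻ : ∀ {N} σ {τ} → τ ∈ cycleInsertions N σ → CycleInsertion N σ τ
∈-cycleInsertions⁻ [] (here refl) = new
∈-cycleInsertions⁻ ([] ∷ σ) τ∈ with ∈ₚ.∈-map⁻ _ τ∈
... | _ , τ′∈ , refl = later (∈-cycleInsertions⁻ σ τ′∈)
∈-cycleInsertions⁻ {N} ((a ∷ r) ∷ σ) τ∈ with ∈ₚ.∈-++⁻ (map (λ w → (a ∷ w) ∷ σ) (insertions N r)) τ∈
... | inj₁ p with ∈ₚ.∈-map⁻ _ p
...   | _ , w∈ , refl = inner (∈-insertions⁻ r w∈)
∈-cycleInsertions⁻ {N} ((a ∷ r) ∷ σ) τ∈ | inj₂ p with ∈ₚ.∈-map⁻ _ p
...   | _ , τ′∈ , refl = later (∈-cycleInsertions⁻ σ τ′∈)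

insertion-∈ : ∀ {N r w} → Insertion N r w → N ∈ w
insertion-∈ here      = here refl
insertion-∈ (there i) = there (insertion-∈ i)

cycleInsertion-not-below : ∀ {N σ τ} → CycleInsertion N σ τ → Below N τ → ⊥
cycleInsertion-not-below new       ((N<N ∷ _) ∷ _) = ℕₚ.<-irrefl refl N<N
cycleInsertion-not-below (inner i) (w<N ∷ _)       = below-∉ w<N (there (insertion-∈ i))
cycleInsertion-not-below (later i) (_ ∷ τ<N)       = cycleInsertion-not-below i τ<N

-- Since `N` is absent from both words, the first `N` met in `w` is the inserted one in either
-- derivation.
insertion-injective : ∀ {N r r′ w} → N ∉ r → N ∉ r′ → Insertion N r w → Insertion N r′ w → r ≡ r′
insertion-injective p q here      here      = refl
insertion-injective p q here      (there _) = ⊥-elim (q (here refl))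
insertion-injective p q (there _) here      = ⊥-elim (p (here refl))
insertion-injective p q (there i) (there j) = cong (_ ∷_) (insertion-injective (p ∘ there) (q ∘ there) i j)

cycleInsertion-injective : ∀ {N σ σ′ τ} → Below N σ → Below N σ′ → CycleInsertion N σ τ → CycleInsertion N σ′ τ → σ
    ≡ σ′
cycleInsertion-injective p q new new = refl
cycleInsertion-injective p ((N<N ∷ _) ∷ _) new (inner _) = ⊥-elim (ℕₚ.<-irrefl refl N<N)
cycleInsertion-injective p ((N<N ∷ _) ∷ _) new (later _) = ⊥-elim (ℕₚ.<-irrefl refl N<N)
cycleInsertion-injective ((N<N ∷ _) ∷ _) q (inner _) new = ⊥-elim (ℕₚ.<-irrefl refl N<N)
cycleInsertion-injective ((N<N ∷ _) ∷ _) q (later _) new = ⊥-elim (ℕₚ.<-irrefl refl N<N)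
cycleInsertion-injective (p ∷ _) (q ∷ _) (inner i) (inner j) =
  cong (λ r → (_ ∷ r) ∷ _) (insertion-injective (below-∉ (All.tail p)) (below-∉ (All.tail q)) i j)
cycleInsertion-injective (_ ∷ p) (q ∷ _) (inner i) (later j) = ⊥-elim (below-∉ q (there (insertion-∈ i)))
cycleInsertion-injective (p ∷ _) (_ ∷ q) (later i) (inner j) = ⊥-elim (below-∉ p (there (insertion-∈ j)))
cycleInsertion-injective (_ ∷ p) (_ ∷ q) (later i) (later j) = cong (_ ∷_) (cycleInsertion-injective p q i j)

insertions-unique : ∀ {N} r → N ∉ r → Unique (insertions N r)
insertions-unique []      _  = [] ∷ []
insertions-unique {N} (a ∷ r) N∉ = Allₚ.map⁺ (All.tabulate (λ { _ refl → N∉ (here refl) }))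
  ∷ Uniqueₚ.map⁺ Listₚ.∷-injectiveʳ (insertions-unique r (N∉ ∘ there))

cycleInsertions-unique : ∀ {N} σ → Below N σ → Unique (cycleInsertions N σ)
cycleInsertions-unique []       _       = [] ∷ []
cycleInsertions-unique ([] ∷ σ) (_ ∷ p) = Uniqueₚ.map⁺ Listₚ.∷-injectiveʳ (cycleInsertions-unique σ p)
cycleInsertions-unique {N} ((a ∷ r) ∷ σ) (c<N ∷ p) = Uniqueₚ.++⁺
  (Uniqueₚ.map⁺ (λ { refl → refl }) (insertions-unique r (below-∉ (All.tail c<N))))
  (Uniqueₚ.map⁺ Listₚ.∷-injectiveʳ (cycleInsertions-unique σ p))
  (λ (x , y) → disjoint (∈ₚ.∈-map⁻ _ x) (∈ₚ.∈-map⁻ _ y))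
  where
  disjoint : ∀ {τ} → ∃[ w ] w ∈ insertions N r × τ ≡ (a ∷ w) ∷ σ →
    ∃[ τ′ ] τ′ ∈ cycleInsertions N σ × τ ≡ (a ∷ r) ∷ τ′ → ⊥
  disjoint (_ , _ , refl) (_ , σ∈ , refl) = cycleInsertion-not-below (∈-cycleInsertions⁻ σ σ∈) p

-- Both lists are free of duplicates and have the same members. Equality up to order is enough, as
-- only sums over them are compared.
stirling2s-suc : ∀ n → 1 ℕ.≤ n → stirling2s (suc n) ↭ concatMap (cycleInsertions (suc n)) (stirling2s n)
stirling2s-suc n 1≤n = ∼bag⇒↭ (unique∧set⇒bag (stirling2s-unique (suc n))
  (concatMap-unique (stirling2s-unique n)
    (λ {σ} σ∈ → cycleInsertions-unique σ (valid-below (∈-stirling2s⁻ σ∈)))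
    (λ {σ} {σ′} σ∈ σ′∈ τ∈ τ∈′ → cycleInsertion-injective (valid-below (∈-stirling2s⁻ σ∈))
        (valid-below (∈-stirling2s⁻ σ′∈))
      (∈-cycleInsertions⁻ σ τ∈) (∈-cycleInsertions⁻ σ′ τ∈′)))
  (mk⇔ to from))
  where
  to : ∀ {τ} → τ ∈ stirling2s (suc n) → τ ∈ concatMap (cycleInsertions (suc n)) (stirling2s n)
  to τ∈ = let σ , i , V = valid-is-insertion (∈-stirling2s⁻ τ∈) in ∈-concatMap⁺ (∈-stirling2s⁺ 1≤n V) (∈-cycleInsertions⁺ i)
  from : ∀ {τ} → τ ∈ concatMap (cycleInsertions (suc n)) (stirling2s n) → τ ∈ stirling2s (suc n)
  from τ∈ = let σ , σ∈ , τ∈′ = ∈-concatMap⁻ (stirling2s n) τ∈ in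
    ∈-stirling2s⁺ (s≤s z≤n) (valid-insertion (∈-cycleInsertions⁻ σ τ∈′) (∈-stirling2s⁻ σ∈))

-- Weighted sums over lists

indicator : Bool → ℕ
indicator b = if b then 1 else 0

module _ {A : Set} where

  total : (A → ℕ) → List A → ℕ
  total f L = sum (map f L)

  total-++ : ∀ f K L → total f (K ++ L) ≡ total f K ℕ.+ total f L
  total-++ f K L = ≡.trans (cong sum (Listₚ.map-++ f K L)) (sum-++ (map f K) (map f L))

  total-cong : ∀ {f g} L → (∀ {x} → x ∈ L → f x ≡ g x) → total f L ≡ total g L
  total-cong []      e = refl
  total-cong (x ∷ L) e = cong₂ ℕ._+_ (e (here refl)) (total-cong L (e ∘ there))

  total-+ : ∀ f g L → total (λ x → f x ℕ.+ g x) L ≡ total f L ℕ.+ total g L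
  total-+ f g []      = refl
  total-+ f g (x ∷ L) = ≡.trans (cong (f x ℕ.+ g x ℕ.+_) (total-+ f g L))
    (solve 4 (λ a b c d → (a :+ b) :+ (c :+ d) := (a :+ c) :+ (b :+ d)) refl (f x) (g x) _ _)
    where open +-*-Solver

  total-* : ∀ k f L → total (λ x → k ℕ.* f x) L ≡ k ℕ.* total f L
  total-* k f []      = ≡.sym (ℕₚ.*-zeroʳ k)
  total-* k f (x ∷ L) = ≡.trans (cong (k ℕ.* f x ℕ.+_) (total-* k f L)) (≡.sym (ℕₚ.*-distribˡ-+ k (f x) _))

  total-zero : ∀ L → total (λ _ → 0) L ≡ 0
  total-zero []      = refl
  total-zero (_ ∷ L) = total-zero L

  length-filterᵇ : ∀ p L → length (filterᵇ p L) ≡ total (indicator ∘ p) L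
  length-filterᵇ p []      = refl
  length-filterᵇ p (x ∷ L) with p x
  ... | true  = cong suc (length-filterᵇ p L)
  ... | false = length-filterᵇ p L

  filterᵇ-∧ : ∀ (p q : A → Bool) L → filterᵇ (λ x → p x ∧ q x) L ≡ filterᵇ q (filterᵇ p L)
  filterᵇ-∧ p q []      = refl
  filterᵇ-∧ p q (x ∷ L) with p x
  ... | false = filterᵇ-∧ p q L
  ... | true  with q x
  ...   | true  = cong (x ∷_) (filterᵇ-∧ p q L)
  ...   | false = filterᵇ-∧ p q L

module _ {A B : Set} (f : B → ℕ) where

  total-map : ∀ (g : A → B) L → total f (map g L) ≡ total (f ∘ g) L
  total-map g L = cong sum (≡.sym (Listₚ.map-∘ {g = f} {g} L))

  total-concatMap : ∀ (g : A → List B) L → total f (concatMap g L) ≡ total (λ x → total f (g x)) L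
  total-concatMap g []      = refl
  total-concatMap g (x ∷ L) = ≡.trans (total-++ f (g x) (concatMap g L))
      (cong (total f (g x) ℕ.+_) (total-concatMap g L))

-- Effect of the insertions on the number of plateaus

capCycle-descent : ∀ {N} b r → b ℕ.≤ N → capCycle (N ∷ b ∷ r) ≡ capCycle (b ∷ r)
capCycle-descent b []      _   = refl
capCycle-descent {N} b (d ∷ r) b≤N rewrite ≮⇒<ᵇ-false {N} b≤N = refl

-- The inserted pair is a plateau because a < N, and it is followed by a descent, so what precedes
-- `r` contributes nothing further.
capCycle-NN : ∀ {N a} r → a ℕ.< N → All (ℕ._< N) r → capCycle (a ∷ N ∷ N ∷ r) ≡ suc (capCycle r)
capCycle-NN {N} []      a<N _         rewrite <⇒<ᵇ-true a<N | ≡ᵇ-refl N = refl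
capCycle-NN {N} (b ∷ r) a<N (b<N ∷ _) rewrite <⇒<ᵇ-true a<N | ≡ᵇ-refl N | ≮⇒<ᵇ-false (ℕₚ.≤-refl {N}) =
  cong suc (capCycle-descent b r (ℕₚ.<⇒≤ b<N))

capCycle-skip : ∀ a b w d → (a <ᵇ b) ∧ (b ≡ᵇ d) ≡ false → capCycle (a ∷ b ∷ d ∷ w) ≡ capCycle (b ∷ d ∷ w)
capCycle-skip a b w d e rewrite e = refl

capCycle-plateau : ∀ a b w → a ℕ.< b → capCycle (a ∷ b ∷ b ∷ w) ≡ suc (capCycle (b ∷ w))
capCycle-plateau a b w a<b rewrite <⇒<ᵇ-true a<b | ≡ᵇ-refl b = cong suc (capCycle-descent b w ℕₚ.≤-refl)

capCycle-beside : ∀ {N} a b w → b ℕ.< N → capCycle (a ∷ b ∷ N ∷ w) ≡ capCycle (b ∷ N ∷ w)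
capCycle-beside {N} a b w b<N = capCycle-skip a b w N (b≢N (a <ᵇ b))
  where
  b≢N : ∀ t → t ∧ (b ≡ᵇ N) ≡ false
  b≢N true  = ≢⇒≡ᵇ-false (ℕₚ.<⇒≢ b<N)
  b≢N false = refl

-- The arithmetic of the case a < b = d. Here `x₁` and `x₂` weigh the insertions on the two sides of
-- the first b, where the new plateau replaces the old one; `rest` weighs the others, for which the
-- old one survives.
plateau-balance : ∀ (h : ℕ → ℕ) k l rest {k′ x₁ x₂ rest′} →
  x₁ ≡ h (suc k′) → x₂ ≡ h (suc k) → rest′ ≡ rest → k′ ≡ k →
  rest ℕ.+ 2 ℕ.* k ℕ.* h (suc (suc k)) ≡ 2 ℕ.* k ℕ.* h (suc k) ℕ.+ suc l ℕ.* h (suc (suc k)) →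
  x₁ ℕ.+ (x₂ ℕ.+ rest′) ℕ.+ 2 ℕ.* suc k′ ℕ.* h (suc (suc k′))
    ≡ 2 ℕ.* suc k′ ℕ.* h (suc k′) ℕ.+ suc (suc (suc l)) ℕ.* h (suc (suc k′))
plateau-balance h k l rest refl refl refl refl ih = begin
  x ℕ.+ (x ℕ.+ rest) ℕ.+ 2 ℕ.* suc k ℕ.* y
    ≡⟨ solve 4 (λ x s k y → x :+ (x :+ s) :+ con 2 :* (con 1 :+ k) :* y := con 2 :* x :+ con 2 :* y :+
        (s :+ con 2 :* k :* y)) refl x rest k y ⟩
  2 ℕ.* x ℕ.+ 2 ℕ.* y ℕ.+ (rest ℕ.+ 2 ℕ.* k ℕ.* y)
    ≡⟨ cong (2 ℕ.* x ℕ.+ 2 ℕ.* y ℕ.+_) ih ⟩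
  2 ℕ.* x ℕ.+ 2 ℕ.* y ℕ.+ (2 ℕ.* k ℕ.* x ℕ.+ suc l ℕ.* y)
    ≡⟨ solve 4 (λ x y k l → con 2 :* x :+ con 2 :* y :+ (con 2 :* k :* x :+ (con 1 :+ l) :* y)
         := con 2 :* (con 1 :+ k) :* x :+ (con 3 :+ l) :* y) refl x y k l ⟩
  2 ℕ.* suc k ℕ.* x ℕ.+ suc (suc (suc l)) ℕ.* y
    ∎
  where
  open ≡-Reasoning
  open +-*-Solver
  x = h (suc k)
  y = h (suc (suc k))

-- With k plateaus and l letters in the cycle, 2k insertions keep the number of plateaus and l - 2k
-- raise it by one. The term `2 k h (k + 1)` stands on the left to avoid the subtraction.
CapBalance : ℕ → (ℕ → ℕ) → ℕ → List ℕ → Set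
CapBalance N h a r = let k = capCycle (a ∷ r) in
  total (λ w → h (capCycle (a ∷ w))) (insertions N r) ℕ.+ 2 ℕ.* k ℕ.* h (suc k)
  ≡ 2 ℕ.* k ℕ.* h k ℕ.+ suc (length r) ℕ.* h (suc k)

-- If b starts no plateau after a, then dropping a changes no count and removes one position. If a <
-- b = d, both a and the first b are dropped, and the weight `h ∘ suc` remembers the plateau lost
-- with them.
insertions-cap-step : ∀ N h a b d r → All (ℕ._< N) (a ∷ b ∷ d ∷ r) →
  CapBalance N h b (d ∷ r) → CapBalance N (h ∘ suc) d r → CapBalance N h a (b ∷ d ∷ r)
insertions-cap-step N h a b d r (a<N ∷ b<N ∷ d<N ∷ r<N) ih₁ ih₂ with (a <ᵇ b) ∧ (b ≡ᵇ d) in eq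
... | false = begin
  h (capCycle (a ∷ N ∷ N ∷ b ∷ d ∷ r)) ℕ.+ total (λ w → h (capCycle (a ∷ w))) (map (b ∷_) (insertions N (d ∷ r)))
      ℕ.+ 2 ℕ.* k ℕ.* h (suc k)
    ≡⟨ cong₂ (λ s t → s ℕ.+ t ℕ.+ 2 ℕ.* k ℕ.* h (suc k)) (cong h (capCycle-NN (b ∷ d ∷ r) a<N (b<N ∷ d<N ∷ r<N)))
         (≡.trans (total-map (λ w → h (capCycle (a ∷ w))) (b ∷_) (insertions N (d ∷ r)))
             (total-cong (insertions N (d ∷ r)) same)) ⟩
  h (suc k) ℕ.+ rest ℕ.+ 2 ℕ.* k ℕ.* h (suc k)
    ≡⟨ ℕₚ.+-assoc (h (suc k)) rest _ ⟩
  h (suc k) ℕ.+ (rest ℕ.+ 2 ℕ.* k ℕ.* h (suc k))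
    ≡⟨ cong (h (suc k) ℕ.+_) ih₁ ⟩
  h (suc k) ℕ.+ (2 ℕ.* k ℕ.* h k ℕ.+ suc (suc (length r)) ℕ.* h (suc k))
    ≡⟨ solve 3 (λ x y l → x :+ (y :+ (con 2 :+ l) :* x) := y :+ (con 3 :+ l) :* x) refl (h (suc k))
        (2 ℕ.* k ℕ.* h k) (length r) ⟩
  2 ℕ.* k ℕ.* h k ℕ.+ suc (suc (suc (length r))) ℕ.* h (suc k)
    ∎
  where
  open ≡-Reasoning
  open +-*-Solver
  k = capCycle (b ∷ d ∷ r)
  rest = total (λ w → h (capCycle (b ∷ w))) (insertions N (d ∷ r))
  -- Between b and d, the inserted `N` differs from b, so b starts no plateau; further right, the
  -- letters a, b, d stay together as before.
  same : ∀ {w} → w ∈ insertions N (d ∷ r) → h (capCycle (a ∷ b ∷ w)) ≡ h (capCycle (b ∷ w))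
  same w∈ with ∈-insertions⁻ (d ∷ r) w∈
  ... | here = cong h (capCycle-beside a b (N ∷ d ∷ r) b<N)
  ... | there {w = w} _ = cong h (capCycle-skip a b w d eq)
... | true with <ᵇ-true {a} {b} (proj₁ (∧-true⁻ eq)) | ≡ᵇ-true b d (proj₂ (∧-true⁻ {a <ᵇ b} eq))
...   | a<b | refl = plateau-balance h (capCycle (b ∷ r)) (length r)
    (total (λ w → h (suc (capCycle (b ∷ w)))) (insertions N r))
  (cong h (capCycle-NN (b ∷ b ∷ r) a<N (b<N ∷ b<N ∷ r<N)))
  (cong h (≡.trans (capCycle-beside a b (N ∷ b ∷ r) b<N) (capCycle-NN (b ∷ r) b<N (b<N ∷ r<N))))
  (≡.trans (total-map (λ w → h (capCycle (a ∷ w))) (b ∷_) (map (b ∷_) (insertions N r)))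
    (≡.trans (total-map (λ w → h (capCycle (a ∷ b ∷ w))) (b ∷_) (insertions N r))
      (total-cong (insertions N r) (λ {w} _ → cong h (capCycle-plateau a b w a<b)))))
  (capCycle-descent b r ℕₚ.≤-refl)
  ih₂

-- A plateau a < b = b is destroyed exactly by the insertions on either side of its first b, and every
-- insertion creates one plateau; the weight h stands for an arbitrary statistic of the number of plateaus.
insertions-cap : ∀ N h a r → All (ℕ._< N) (a ∷ r) → CapBalance N h a r
insertions-cap N h a [] (a<N ∷ _) = ≡.trans (ℕₚ.+-identityʳ _) (cong (λ t → h t ℕ.+ 0) (capCycle-NN [] a<N []))
insertions-cap N h a (b ∷ []) (a<N ∷ b<N ∷ []) = ≡.trans (ℕₚ.+-identityʳ _)
  (cong₂ (λ s t → h s ℕ.+ (h t ℕ.+ 0)) (capCycle-NN (b ∷ []) a<N (b<N ∷ []))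
    (≡.trans (capCycle-beside a b (N ∷ []) b<N) (capCycle-NN [] b<N [])))
insertions-cap N h a (b ∷ d ∷ r) below@(_ ∷ b<N ∷ d<N ∷ r<N) = insertions-cap-step N h a b d r below
  (insertions-cap N h b (d ∷ r) (b<N ∷ d<N ∷ r<N)) (insertions-cap N (h ∘ suc) d r (d<N ∷ r<N))

-- Passing to the remaining cycles shifts the weight by the plateaus of the first cycle and by one
-- cycle. The extra term on the right comes from the new cycle (N N), which has no plateau.
cycleInsertions-cap : ∀ N (g : ℕ → ℕ → ℕ) σ → Below N σ → All NonEmpty σ →
  total (λ τ → g (cap τ) (cyc τ)) (cycleInsertions N σ) ℕ.+ 2 ℕ.* cap σ ℕ.* g (suc (cap σ)) (cyc σ)
  ≡ g (cap σ) (suc (cyc σ)) ℕ.+ 2 ℕ.* cap σ ℕ.* g (cap σ) (cyc σ) ℕ.+ length (concat σ) ℕ.* g (suc (cap σ)) (cyc σ)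
cycleInsertions-cap N g [] _ _ = refl
cycleInsertions-cap N g ([] ∷ σ) _ (p ∷ _) = ⊥-elim (p refl)
cycleInsertions-cap N g ((a ∷ r) ∷ σ) (c<N ∷ σ<N) (_ ∷ ne) = begin
  total G (map (λ w → (a ∷ w) ∷ σ) (insertions N r) ++ map ((a ∷ r) ∷_) (cycleInsertions N σ)) ℕ.+ 2 ℕ.* (k ℕ.+ s)
      ℕ.* y
    ≡⟨ cong (ℕ._+ 2 ℕ.* (k ℕ.+ s) ℕ.* y) (≡.trans (total-++ G (map (λ w → (a ∷ w) ∷ σ) (insertions N r)) _)
         (cong₂ ℕ._+_ (total-map G (λ w → (a ∷ w) ∷ σ) (insertions N r))
             (total-map G ((a ∷ r) ∷_) (cycleInsertions N σ)))) ⟩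
  P ℕ.+ R ℕ.+ 2 ℕ.* (k ℕ.+ s) ℕ.* y
    ≡⟨ solve 5 (λ P R k s y → P :+ R :+ con 2 :* (k :+ s) :* y := (P :+ con 2 :* k :* y) :+ (R :+ con 2 :* s :* y))
        refl P R k s y ⟩
  (P ℕ.+ 2 ℕ.* k ℕ.* y) ℕ.+ (R ℕ.+ 2 ℕ.* s ℕ.* y)
    ≡⟨ cong₂ ℕ._+_ (insertions-cap N (λ t → g (t ℕ.+ s) (suc (cyc σ))) a r c<N)
         (≡.trans (cong (λ t → R ℕ.+ 2 ℕ.* s ℕ.* g t (suc (cyc σ))) (≡.sym (ℕₚ.+-suc k s)))
           (cycleInsertions-cap N (λ t c → g (k ℕ.+ t) (suc c)) σ σ<N ne)) ⟩
  (2 ℕ.* k ℕ.* x ℕ.+ suc (length r) ℕ.* y) ℕ.+ (z ℕ.+ 2 ℕ.* s ℕ.* x ℕ.+ length (concat σ) ℕ.* g (k ℕ.+ suc s)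
      (suc (cyc σ)))
    ≡⟨ cong (λ t → (2 ℕ.* k ℕ.* x ℕ.+ suc (length r) ℕ.* y) ℕ.+
        (z ℕ.+ 2 ℕ.* s ℕ.* x ℕ.+ length (concat σ) ℕ.* g t (suc (cyc σ)))) (ℕₚ.+-suc k s) ⟩
  (2 ℕ.* k ℕ.* x ℕ.+ suc (length r) ℕ.* y) ℕ.+ (z ℕ.+ 2 ℕ.* s ℕ.* x ℕ.+ length (concat σ) ℕ.* y)
    ≡⟨ solve 7 (λ k s x y z l m → (con 2 :* k :* x :+ l :* y) :+ (z :+ con 2 :* s :* x :+ m :* y)
         := z :+ con 2 :* (k :+ s) :* x :+ (l :+ m) :* y) refl k s x y z (suc (length r)) (length (concat σ)) ⟩
  z ℕ.+ 2 ℕ.* (k ℕ.+ s) ℕ.* x ℕ.+ (suc (length r) ℕ.+ length (concat σ)) ℕ.* y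
    ≡⟨ cong (λ t → z ℕ.+ 2 ℕ.* (k ℕ.+ s) ℕ.* x ℕ.+ t ℕ.* y) (Listₚ.length-++ (a ∷ r)) ⟨
  z ℕ.+ 2 ℕ.* (k ℕ.+ s) ℕ.* x ℕ.+ length (concat ((a ∷ r) ∷ σ)) ℕ.* y
    ∎
  where
  open ≡-Reasoning
  open +-*-Solver
  G : Cycles → ℕ
  G τ = g (cap τ) (cyc τ)
  k = capCycle (a ∷ r)
  s = cap σ
  x = g (k ℕ.+ s) (suc (cyc σ))
  y = g (suc (k ℕ.+ s)) (suc (cyc σ))
  z = g (k ℕ.+ s) (suc (suc (cyc σ)))
  P = total (λ w → g (capCycle (a ∷ w) ℕ.+ s) (suc (cyc σ))) (insertions N r)
  R = total (λ τ → g (k ℕ.+ cap τ) (suc (cyc τ))) (cycleInsertions N σ)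

-- From weighted sums to the coefficients of Q

at : ℕ → ℕ → ℕ → ℕ → ℕ
at i j x y = indicator ((x ≡ᵇ i) ∧ (y ≡ᵇ j))

Qcount-total : ∀ n i j → Qcount n i j ≡ total (λ σ → at i j (cap σ) (cyc σ)) (stirling2s n)
Qcount-total n i j = ≡.trans
  (cong (length {A = Cycles}) (filterᵇ-∧ (isStirling2 n) (λ σ → (cap σ ≡ᵇ i) ∧ (cyc σ ≡ᵇ j)) (candidates n)))
  (length-filterᵇ _ (stirling2s n))

at-zero : ∀ i x y → at i 0 x (suc y) ≡ 0
at-zero i x y with x ≡ᵇ i
... | true  = refl
... | false = refl

-- On the support of the indicator x equals i. This is how the factor cap(σ) becomes the operator x
-- ∂/∂x.
at-weight : ∀ i j x y → x ℕ.* at i j x y ≡ i ℕ.* at i j x y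
at-weight i j x y with x ≡ᵇ i in eq
... | false = ≡.trans (ℕₚ.*-zeroʳ x) (≡.sym (ℕₚ.*-zeroʳ i))
... | true  rewrite ≡ᵇ-true x i eq = refl

-- `cycleInsertions-cap` with the weight `at i j`, summed over all σ. The term -2x² ∂Q/∂x of the
-- recurrence appears on the left.
Qcount-suc : ∀ n i j → 1 ℕ.≤ n →
  Qcount (suc n) i j ℕ.+ 2 ℕ.* up 0 (λ i → i ℕ.* Qcount n i j) i
  ≡ up 0 (Qcount n i) j ℕ.+ 2 ℕ.* (i ℕ.* Qcount n i j) ℕ.+ 2 ℕ.* n ℕ.* up 0 (λ i → Qcount n i j) i
Qcount-suc n i j 1≤n = begin
  Qcount (suc n) i j ℕ.+ 2 ℕ.* up 0 (λ i → i ℕ.* Qcount n i j) i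
    ≡⟨ cong₂ ℕ._+_ count-new (cong (2 ℕ.*_) weighted-up) ⟩
  total (λ σ → total (λ τ → g (cap τ) (cyc τ)) (cycleInsertions (suc n) σ)) V ℕ.+ 2 ℕ.* total
      (λ σ → cap σ ℕ.* g (suc (cap σ)) (cyc σ)) V
    ≡⟨ cong (λ t → total (λ σ → total (λ τ → g (cap τ) (cyc τ)) (cycleInsertions (suc n) σ)) V ℕ.+ t)
        (total-* 2 _ V) ⟨
  total (λ σ → total (λ τ → g (cap τ) (cyc τ)) (cycleInsertions (suc n) σ)) V ℕ.+ total
      (λ σ → 2 ℕ.* (cap σ ℕ.* g (suc (cap σ)) (cyc σ))) V
    ≡⟨ total-+ _ _ V ⟨
  total (λ σ → total (λ τ → g (cap τ) (cyc τ)) (cycleInsertions (suc n) σ) ℕ.+ 2 ℕ.*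
      (cap σ ℕ.* g (suc (cap σ)) (cyc σ))) V
    ≡⟨ total-cong V (λ {σ} σ∈ → local (∈-stirling2s⁻ σ∈)) ⟩
  total (λ σ → g (cap σ) (suc (cyc σ)) ℕ.+ 2 ℕ.* (i ℕ.* g (cap σ) (cyc σ)) ℕ.+ 2 ℕ.* n ℕ.* g (suc (cap σ)) (cyc σ)) V
    ≡⟨ ≡.trans (total-+ _ _ V) (cong₂ ℕ._+_ (total-+ _ _ V) (total-* (2 ℕ.* n) _ V)) ⟩
  total (λ σ → g (cap σ) (suc (cyc σ))) V ℕ.+ total (λ σ → 2 ℕ.* (i ℕ.* g (cap σ) (cyc σ))) V ℕ.+ 2 ℕ.* n ℕ.* total
      (λ σ → g (suc (cap σ)) (cyc σ)) V
    ≡⟨ cong₂ (λ s t → s ℕ.+ 2 ℕ.* n ℕ.* t) (cong₂ ℕ._+_ (right j) middle) (left i) ⟩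
  up 0 (Qcount n i) j ℕ.+ 2 ℕ.* (i ℕ.* Qcount n i j) ℕ.+ 2 ℕ.* n ℕ.* up 0 (λ i → Qcount n i j) i
    ∎
  where
  open ≡-Reasoning
  V = stirling2s n
  g = at i j
  count-new : Qcount (suc n) i j ≡ total (λ σ → total (λ τ → g (cap τ) (cyc τ)) (cycleInsertions (suc n) σ)) V
  count-new = ≡.trans (Qcount-total (suc n) i j) (≡.trans
    (sum-↭ (↭ₚ.map⁺ (λ τ → g (cap τ) (cyc τ)) (stirling2s-suc n 1≤n)))
    (total-concatMap (λ τ → g (cap τ) (cyc τ)) (cycleInsertions (suc n)) V))
  right : ∀ j → total (λ σ → at i j (cap σ) (suc (cyc σ))) V ≡ up 0 (Qcount n i) j
  right zero    = ≡.trans (total-cong V (λ {σ} _ → at-zero i (cap σ) (cyc σ))) (total-zero V)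
  right (suc j) = ≡.sym (Qcount-total n i j)
  left : ∀ i → total (λ σ → at i j (suc (cap σ)) (cyc σ)) V ≡ up 0 (λ i → Qcount n i j) i
  left zero    = total-zero V
  left (suc i) = ≡.sym (Qcount-total n i j)
  middle : total (λ σ → 2 ℕ.* (i ℕ.* g (cap σ) (cyc σ))) V ≡ 2 ℕ.* (i ℕ.* Qcount n i j)
  middle = ≡.trans (total-* 2 _ V) (cong (2 ℕ.*_) (≡.trans (total-* i _ V)
      (cong (i ℕ.*_) (≡.sym (Qcount-total n i j)))))
  weighted-up : up 0 (λ i → i ℕ.* Qcount n i j) i ≡ total (λ σ → cap σ ℕ.* g (suc (cap σ)) (cyc σ)) V
  weighted-up = go i
    where
    go : ∀ i → up 0 (λ i → i ℕ.* Qcount n i j) i ≡ total (λ σ → cap σ ℕ.* at i j (suc (cap σ)) (cyc σ)) V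
    go zero    = ≡.sym (≡.trans (total-cong V (λ {σ} _ → ℕₚ.*-zeroʳ (cap σ))) (total-zero V))
    go (suc i) = ≡.trans (cong (i ℕ.*_) (Qcount-total n i j)) (≡.trans (≡.sym (total-* i _ V))
      (total-cong V (λ {σ} _ → ≡.sym (at-weight i j (cap σ) (cyc σ)))))
  local : ∀ {σ} → Valid n σ →
    total (λ τ → g (cap τ) (cyc τ)) (cycleInsertions (suc n) σ) ℕ.+ 2 ℕ.* (cap σ ℕ.* g (suc (cap σ)) (cyc σ))
    ≡ g (cap σ) (suc (cyc σ)) ℕ.+ 2 ℕ.* (i ℕ.* g (cap σ) (cyc σ)) ℕ.+ 2 ℕ.* n ℕ.* g (suc (cap σ)) (cyc σ)
  local {σ} v = begin
    total (λ τ → g (cap τ) (cyc τ)) (cycleInsertions (suc n) σ) ℕ.+ 2 ℕ.* (cap σ ℕ.* g (suc (cap σ)) (cyc σ))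
      ≡⟨ cong (total (λ τ → g (cap τ) (cyc τ)) (cycleInsertions (suc n) σ) ℕ.+_) (≡.sym (ℕₚ.*-assoc 2 (cap σ) _)) ⟩
    total (λ τ → g (cap τ) (cyc τ)) (cycleInsertions (suc n) σ) ℕ.+ 2 ℕ.* cap σ ℕ.* g (suc (cap σ)) (cyc σ)
      ≡⟨ cycleInsertions-cap (suc n) g σ (valid-below v) (All.map (λ c → headed (headMin c)) (cycles v)) ⟩
    g (cap σ) (suc (cyc σ)) ℕ.+ 2 ℕ.* cap σ ℕ.* g (cap σ) (cyc σ) ℕ.+ length (concat σ) ℕ.* g (suc (cap σ)) (cyc σ)
      ≡⟨ cong₂ (λ s t → g (cap σ) (suc (cyc σ)) ℕ.+ s ℕ.+ t ℕ.* g (suc (cap σ)) (cyc σ))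
           (≡.trans (ℕₚ.*-assoc 2 (cap σ) _) (cong (2 ℕ.*_) (at-weight i j (cap σ) (cyc σ))))
           (≡.trans (valid-length v) (cong (n ℕ.+_) (≡.sym (ℕₚ.+-identityʳ n)))) ⟩
    g (cap σ) (suc (cyc σ)) ℕ.+ 2 ℕ.* (i ℕ.* g (cap σ) (cyc σ)) ℕ.+ 2 ℕ.* n ℕ.* g (suc (cap σ)) (cyc σ)
      ∎
    where
    headed : ∀ {c} → headIsMin c ≡ true → NonEmpty c
    headed () refl

-- The passage to ℤ, where the term kept on the left can be subtracted.
balance : ∀ a b c d m e → a ℕ.+ 2 ℕ.* b ≡ c ℕ.+ 2 ℕ.* d ℕ.+ m ℕ.* e →
  + a ≡ + c ℤ.+ (+ m ℤ.* + e ℤ.+ (+ 2 ℤ.* + d ℤ.+ -1ℤ ℤ.* (+ 2 ℤ.* + b)))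
balance a b c d m e eq = begin
  + a
    ≡⟨ solve 2 (λ a b → a := a :+ con (+ 2) :* b :+ con -1ℤ :* (con (+ 2) :* b)) refl (+ a) (+ b) ⟩
  + a ℤ.+ + 2 ℤ.* + b ℤ.+ -1ℤ ℤ.* (+ 2 ℤ.* + b)
    ≡⟨ cong (λ t → + a ℤ.+ t ℤ.+ -1ℤ ℤ.* (+ 2 ℤ.* + b)) (ℤₚ.pos-* 2 b) ⟨
  + (a ℕ.+ 2 ℕ.* b) ℤ.+ -1ℤ ℤ.* (+ 2 ℤ.* + b)
    ≡⟨ cong (λ t → + t ℤ.+ -1ℤ ℤ.* (+ 2 ℤ.* + b)) eq ⟩
  + c ℤ.+ + (2 ℕ.* d) ℤ.+ + (m ℕ.* e) ℤ.+ -1ℤ ℤ.* (+ 2 ℤ.* + b)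
    ≡⟨ cong₂ (λ s t → + c ℤ.+ s ℤ.+ t ℤ.+ -1ℤ ℤ.* (+ 2 ℤ.* + b)) (ℤₚ.pos-* 2 d) (ℤₚ.pos-* m e) ⟩
  + c ℤ.+ + 2 ℤ.* + d ℤ.+ + m ℤ.* + e ℤ.+ -1ℤ ℤ.* (+ 2 ℤ.* + b)
    ≡⟨ solve 5 (λ b c d e m → c :+ con (+ 2) :* d :+ m :* e :+ con -1ℤ :* (con (+ 2) :* b)
         := c :+ (m :* e :+ (con (+ 2) :* d :+ con -1ℤ :* (con (+ 2) :* b)))) refl (+ b) (+ c) (+ d) (+ e) (+ m) ⟩
  + c ℤ.+ (+ m ℤ.* + e ℤ.+ (+ 2 ℤ.* + d ℤ.+ -1ℤ ℤ.* (+ 2 ℤ.* + b)))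
    ∎
  where
  open ≡-Reasoning
  open ℤ-Solver

-- `Q 0` is set to 1 by definition and order 0 has no candidate to insert into, so insertion starts
-- at order 1, and the step from 0 to 1 is evaluated directly.
Q-suc : ∀ n i j → Q (suc n) i j ≡ step n (Q n) i j
Q-suc zero zero          zero                = refl
Q-suc zero zero          (suc zero)          = refl
Q-suc zero zero          (suc (suc j))       = refl
Q-suc zero (suc zero)    zero                = refl
Q-suc zero (suc zero)    (suc zero)          = refl
Q-suc zero (suc zero)    (suc (suc j))       = refl
Q-suc zero (suc (suc i)) zero
  rewrite ℤₚ.*-zeroʳ (+ suc (suc i)) = refl
Q-suc zero (suc (suc i)) (suc j)
  rewrite ℤₚ.*-zeroʳ (+ suc (suc i)) = refl
Q-suc (suc n) i j = ≡.trans (balance (Qcount (suc (suc n)) i j) (up 0 (λ i → i ℕ.* Qcount (suc n) i j) i)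
    (up 0 (Qcount (suc n) i) j) (i ℕ.* Qcount (suc n) i j) (2 ℕ.* suc n) (up 0 (λ i → Qcount (suc n) i j) i)
    (Qcount-suc (suc n) i j (s≤s z≤n)))
  (cong₂ ℤ._+_ (up-map +_ refl (λ _ → refl) j) (cong₂ ℤ._+_
    (cong (+ (2 ℕ.* suc n) ℤ.*_) (up-map +_ refl (λ _ → refl) i))
    (cong₂ ℤ._+_ (cong (+ 2 ℤ.*_) (ℤₚ.pos-* i (Qcount (suc n) i j)))
      (cong (λ t → -1ℤ ℤ.* (+ 2 ℤ.* t)) (up-map +_ refl (λ i → ℤₚ.pos-* i (Qcount (suc n) i j)) i)))))

open import Data.Nat using (_*_)

theorem10 : ((i j : ℕ) → Q 0 i j ≡ constP (+ 1) i j)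
    × ((n i j : ℕ) →
    Q (suc n) i j
    ≡ (((qP +P (constP (+ (2 * n)) *P xP)) *P Q n)
    +P ((constP (+ 2) *P (xP *P (constP (+ 1) +P (constP (-1ℤ) *P xP)))) *P dxP (Q n))) i j)
    × ((a b c : ℕ) → egfQ a b c ≡ closedForm a b c)
theorem10 = (λ _ _ → refl)
  , (λ n i j → ≡.trans (Q-suc n i j) (≡.sym (rhs≈step n (Q n) i j)))
  , GeneratingFunction.egfQ≈closedForm Q-suc
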